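{- Let $\varepsilon>0$. There is $t_0(\varepsilon)$ such that for every integer $t\geq t_0(\varepsilon)$ there is a constant $C=C(\varepsilon,t)$ such that every graph $G$ with $n$ vertices and average degree $d(G)\geq(1+\varepsilon)c(t)$ contains either a $K_t$-minor consisting of at most $C$ vertices or a $K_t$-subdivision consisting of at most $C\log n$ vertices.
   Context: All graphs are finite and simple; $d(G)$ is the average degree and $\log$ is the natural logarithm. $c(t)$ is the smallest real $c$ such that every graph with $d(G)\geq c$ has a $K_t$-minor. A $K_t$-minor consisting of at most $N$ vertices means a subgraph with at most $N$ vertices having $K_t$ as a minor; a $K_t$-subdivision consisting of at most $N$ vertices means a subgraph with at most $N$ vertices which is obtained from $K_t$ by replacing its edges with internally vertex-disjoint paths. -}

module Defs where

open import Data.Nat as ℕ using (ℕ; zero; suc; _≤_; _<ᵇ_)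
open import Data.Fin using (Fin; toℕ)
open import Data.Bool using (Bool; true; false; if_then_else_; _∧_)
open import Data.List using (List; []; _∷_; map; allFin; length)
open import Data.Nat.ListAction using (sum)
open import Data.List.Membership.Propositional using (_∈_)
open import Data.List.Relation.Unary.Unique.Propositional using (Unique)
open import Data.Maybe using (Maybe; just; nothing; is-just)
open import Data.Integer using (+_)
open import Data.Rational as ℚ using (ℚ; 1ℚ)
open import Data.Product using (Σ; ∃; ∃-syntax; _×_; _,_)
open import Relation.Binary.PropositionalEquality using (_≡_; _≢_)

record Graph (n : ℕ) : Set where
  field
    adj   : Fin n → Fin n → Bool
    sym   : ∀ u v → adj u v ≡ adj v u
    irref : ∀ v → adj v v ≡ false
open Graph public

count : ∀ {n} → (Fin n → Bool) → ℕ
count {n} p = sum (map (λ v → if p v then 1 else 0) (allFin n))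

edges : ∀ {n} → Graph n → ℕ
edges {n} G = sum (map (λ u → count (λ v → (toℕ u <ᵇ toℕ v) ∧ adj G u v)) (allFin n))

ℕ→ℚ : ℕ → ℚ
ℕ→ℚ k = (+ k) ℚ./ 1

-- d(G) ≥ x, where d(G) = 2|E(G)|/|V(G)| (graphs have at least one vertex)
AvgDeg≥ : ∀ {n} → Graph n → ℚ → Set
AvgDeg≥ {n} G x = (1 ≤ n) × (x ℚ.* ℕ→ℚ n ℚ.≤ ℕ→ℚ (2 ℕ.* edges G))

-- walks staying inside a vertex set P (starting vertex assumed in P)
data ReachIn {n} (G : Graph n) (P : Fin n → Set) : Fin n → Fin n → Set where
  here : ∀ {u} → ReachIn G P u u
  step : ∀ {u w v} → adj G u w ≡ true → P w → ReachIn G P w v → ReachIn G P u v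

-- A K_t-minor model in G whose branch sets together have at most N vertices.
-- β v = just i means v lies in branch set i; nothing means v is unused.
-- (Disjointness of branch sets is automatic.)
KtMinorWithin : ℕ → ℕ → ∀ {n} → Graph n → Set
KtMinorWithin t N {n} G =
  Σ (Fin n → Maybe (Fin t)) λ β →
    (∀ i → ∃[ v ] β v ≡ just i)
  × (∀ i u v → β u ≡ just i → β v ≡ just i → ReachIn G (λ w → β w ≡ just i) u v)
  × (∀ i j → i ≢ j → ∃[ u ] ∃[ v ] (β u ≡ just i × β v ≡ just j × adj G u v ≡ true))
  × (count (λ v → is-just (β v)) ≤ N)

Chain : ∀ {n} → Graph n → Fin n → List (Fin n) → Fin n → Set
Chain G u [] v = adj G u v ≡ true
Chain G u (w ∷ ws) v = (adj G u w ≡ true) × Chain G w ws v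

_<F_ : ∀ {t} → Fin t → Fin t → Set
i <F j = suc (toℕ i) ≤ toℕ j

subdivSize : ∀ {n} (t : ℕ) → (Fin t → Fin t → List (Fin n)) → ℕ
subdivSize t L = t ℕ.+ sum (map (λ i → sum (map (λ j →
  if toℕ i <ᵇ toℕ j then length (L i j) else 0) (allFin t))) (allFin t))

KtSubdivOfSize : ℕ → ℕ → ∀ {n} → Graph n → Set
KtSubdivOfSize t s {n} G =
  Σ (Fin t → Fin n) λ b → Σ (Fin t → Fin t → List (Fin n)) λ L →
    (∀ i j → b i ≡ b j → i ≡ j)
  × (∀ i j → i <F j → Chain G (b i) (L i j) (b j))
  × (∀ i j → i <F j → Unique (L i j))
  × (∀ i j → i <F j → ∀ v → v ∈ L i j → ∀ k → v ≢ b k)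
  × (∀ i j i' j' → i <F j → i' <F j' → (i ≢ i' Data.Sum.⊎ j ≢ j') →
       ∀ v → v ∈ L i j → v ∈ L i' j' → Data.Empty.⊥)
  × (subdivSize t L ≡ s)
  where import Data.Sum; import Data.Empty

-- q ∈ S_t : every graph H with d(H) ≥ q has a K_t-minor.  c(t) = inf S_t.
ForcesMinor : ℕ → ℚ → Set
ForcesMinor t q = ∀ m (H : Graph m) → AvgDeg≥ H q → KtMinorWithin t m H

-- d(G) ≥ (1+ε) c(t), expressed without reals:
-- every rational q with (1+ε) q > d(G) lies in S_t.
DegHyp : ℚ → ℕ → ∀ {n} → Graph n → Set
DegHyp ε t {n} G = ∀ (q : ℚ) →
  ℕ→ℚ (2 ℕ.* edges G) ℚ.< (1ℚ ℚ.+ ε) ℚ.* q ℚ.* ℕ→ℚ n → ForcesMinor t q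

{-# OPTIONS --safe #-}
module Submission where

-- Let ε ≥ 1 / k. A random graph on (2K + 1) t vertices shows that c(t) ≥ K t for every K and large t (a union bound over all
-- partitions into branch sets, derandomised), so the gap between d(G) and c(t) is a large multiple of t. If a set of
-- bounded size spans more than a slightly smaller average degree D′, then it contains a K_t minor. Otherwise small sets
-- expand by a constant factor inside every minimal dense subgraph K.
--
-- The main tool takes a ball around a vertex, of logarithmic radius, at which it stops growing fast, and averages over
-- windows of consecutive layers: almost all of the density survives in some window, and the inner layers form a connected
-- hub S of logarithmic radius which is disjoint from the window but close to all of it.
--
-- If the average degree exceeds a constant depending on t, use windows of two layers in a bipartite graph. After 2 t²
-- rounds there are t² hubs adjacent to all vertices on one side of a dense graph; any t of these are the branch vertices.
-- Hence the density may be assumed to be bounded, and deleting the vertices of large degree then costs only O(t).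
--
-- In bounded degree, t² rounds with wide windows give t² hubs within bounded distance of every vertex of a dense K; the
-- margin between a window and its hub keeps the walks to the previous hubs. Take t vertices of K far apart and lead from
-- each of them disjoint legs to its t hubs, every leg being a geodesic in the complement of the earlier ones. Such legs
-- meet the i-th ball around the vertex in at most i vertices each, so the balls keep growing until some vertex of the ball
-- is far from all earlier legs, and its walk to the next hub is free.

open import Defs
open import Data.Bool using (Bool; true; false; if_then_else_; _∧_; _∨_; not; _xor_; T)
open import Data.Bool.Properties using (∧-conicalˡ; ∧-conicalʳ; ∨-zeroʳ; ∨-comm; ∧-comm; xor-comm; ¬-not; not-¬) renaming (_≟_ to _≟ᵇ_)
open import Data.Empty using (⊥; ⊥-elim)
open import Data.Fin using (Fin; zero; suc; toℕ; _≟_; combine; fromℕ<; inject≤; _↑ˡ_; _↑ʳ_; remQuot; funToFin; finToFun)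
open import Data.Fin.Properties using (all?; any?; toℕ-injective; toℕ<n; toℕ-fromℕ<; inject≤-injective; combine-injectiveˡ; combine-injectiveʳ; remQuot-combine; combine-remQuot; finToFun-funToFin) renaming (suc-injective to suc-injectiveᶠ)
open import Data.Fin.Subset.Properties using (anySubset?)
import Data.Integer as ℤ
import Data.Integer.Properties as ℤ
open import Data.List as L using (List; []; _∷_; length)
open import Data.List.Membership.Propositional using () renaming (_∈_ to _∈ᴸ_)
import Data.List.Membership.DecPropositional as DecMembership
open import Data.List.Properties using (map-tabulate)
open import Data.List.Relation.Unary.All using ([]; _∷_)
open import Data.List.Relation.Unary.All.Properties using (¬Any⇒All¬)
open import Data.List.Relation.Unary.AllPairs using ([]; _∷_)
open import Data.List.Relation.Unary.Any using (here; there)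
open import Data.List.Relation.Unary.Unique.Propositional using (Unique)
open import Data.Maybe using (Maybe; just; nothing; is-just)
open import Data.Nat using (ℕ; zero; suc; _+_; _*_; _^_; _∸_; _≤_; _<_; _≤?_; _<?_; z≤n; s≤s; s≤s⁻¹; z<s; NonZero; >-nonZero; _<ᵇ_)
open import Data.Nat.DivMod using (_/_; _%_; m≡m%n+[m/n]*n; m%n<n; m/n*n≤m)
open import Data.Nat.ListAction using () renaming (sum to lsum)
open import Data.Nat.Properties hiding (_≟_)
open import Data.Nat.Tactic.RingSolver using (solve-∀)
open import Data.Product using (Σ; ∃; ∃-syntax; _×_; _,_; proj₁; proj₂)
import Data.Rational as ℚ
import Data.Rational.Properties as ℚ
import Data.Rational.Unnormalised as ℚᵘ
import Data.Rational.Unnormalised.Properties as ℚᵘ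
open import Data.Rational using (ℚ; mkℚ; 0ℚ; 1ℚ)
open import Data.Rational.Unnormalised using (mkℚᵘ; 1ℚᵘ; ↧ₙ_)
open import Data.Sum using (_⊎_; inj₁; inj₂; [_,_]′)
open import Data.Vec using (lookup; tabulate)
open import Data.Vec.Properties using (lookup∘tabulate)
open import Function using (_∘_; id; case_of_)
open import Relation.Binary.Definitions using (tri<; tri≈; tri>)
open import Relation.Binary.PropositionalEquality renaming (sym to ≡sym)
open import Relation.Nullary using (¬_; Dec; yes; no; contradiction)
open import Relation.Nullary.Decidable using (⌊_⌋; _×-dec_; _→-dec_; ¬?; map′; decidable-stable)
open import Algebra.Properties.CommutativeMonoid.Sum +-0-commutativeMonoid using (sum; ∑-distrib-+; ∑-comm; sum-cong-≗)
open import Algebra.Properties.CommutativeMonoid.Sum *-1-commutativeMonoid using () renaming (sum to prod; ∑-distrib-+ to prod-distrib-*)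
open import Algebra.Properties.Semiring.Sum +-*-semiring using (*-distribˡ-sum)
open import Algebra.Properties.CommutativeSemigroup *-commutativeSemigroup using (x∙yz≈y∙xz)

-- The number `c(t)` is never handled as a real. The degree hypothesis is applied to integers only:
-- to a large multiple of `t`, which bounds the average degree of `G` from below, and to the
-- threshold `D′`, which turns a dense set of bounded size into a minor. A multiple of `t` has to be
-- available because two steps lose a multiple of `t` and not a factor: deleting the vertices of
-- large degree, and growing a ball around a branch vertex past the legs already in place. The
-- factor `1 + 1 / k` between the average degree and `D′` pays for the rest: with `h = 8 (k + 1)`,
-- the rounds keep the fraction `(h - 1) / h` of the density, and what remains exceeds `D′` by the
-- factor `(h + 1) / h`, which gives expansion. Only the radii of hubs may depend on `n`. All other
-- lengths are constants, so that bounded degree bounds the balls of these radii and local sparsity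
-- applies to them. The choice of constants is not circular: the window width depends on `k` and `t`
-- only and fixes the distance to the hubs; this and the degree bound fix the legs, and all of these
-- fix the size up to which sparsity is demanded.

private variable
  n n′ : ℕ

-- Sums and cardinalities over Fin n

sum-mono : (f g : Fin n → ℕ) → (∀ i → f i ≤ g i) → sum f ≤ sum g
sum-mono {zero} f g h = z≤n
sum-mono {suc n} f g h = +-mono-≤ (h zero) (sum-mono (f ∘ suc) (g ∘ suc) (h ∘ suc))

sum-mono-< : (f g : Fin n → ℕ) → (∀ i → f i ≤ g i) → ∀ i → f i < g i → sum f < sum g
sum-mono-< f g h zero l = +-mono-<-≤ l (sum-mono (f ∘ suc) (g ∘ suc) (h ∘ suc))
sum-mono-< f g h (suc i) l = +-mono-≤-< (h zero) (sum-mono-< (f ∘ suc) (g ∘ suc) (h ∘ suc) i l)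

sum-const : ∀ n c → sum {n} (λ _ → c) ≡ n * c
sum-const zero c = refl
sum-const (suc n) c = cong (c +_) (sum-const n c)

sum-zero : (f : Fin n → ℕ) → (∀ i → f i ≡ 0) → sum f ≡ 0
sum-zero {zero} f h = refl
sum-zero {suc n} f h rewrite h zero = sum-zero (f ∘ suc) (h ∘ suc)

term≤sum : (f : Fin n → ℕ) → ∀ i → f i ≤ sum f
term≤sum f zero = m≤m+n _ _
term≤sum f (suc i) = ≤-trans (term≤sum (f ∘ suc) i) (m≤n+m _ _)

sum>0⇒term>0 : (f : Fin n → ℕ) → 0 < sum f → ∃[ i ] 0 < f i
sum>0⇒term>0 {suc n} f p with f zero in eq
... | suc k = zero , subst (0 <_) (≡sym eq) z<s
... | zero = let i , q = sum>0⇒term>0 (f ∘ suc) p in suc i , q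

b2n : Bool → ℕ
b2n b = if b then 1 else 0

b2n≤1 : ∀ b → b2n b ≤ 1
b2n≤1 true = s≤s z≤n
b2n≤1 false = z≤n

b2n-mono : ∀ {a b} → (a ≡ true → b ≡ true) → b2n a ≤ b2n b
b2n-mono {false} h = z≤n
b2n-mono {true} h rewrite h refl = ≤-refl

b2n-≤+ : ∀ {a} b c → (a ≡ true → b ≡ true ⊎ c ≡ true) → b2n a ≤ b2n b + b2n c
b2n-≤+ {false} b c h = z≤n
b2n-≤+ {true} b c h with h refl
... | inj₁ refl = s≤s z≤n
... | inj₂ refl = m≤n+m 1 (b2n b)

VSet : ℕ → Set
VSet n = Fin n → Bool

infix 4 _∈_ _∉_ _⊆_
infixr 6 _∪_
infixr 7 _∩_ _∖_

_∈_ _∉_ : Fin n → VSet n → Set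
x ∈ A = A x ≡ true
x ∉ A = ¬ x ∈ A

_⊆_ : VSet n → VSet n → Set
A ⊆ B = ∀ x → x ∈ A → x ∈ B

_∪_ _∩_ _∖_ : VSet n → VSet n → VSet n
(A ∪ B) x = A x ∨ B x
(A ∩ B) x = A x ∧ B x
(A ∖ B) x = A x ∧ not (B x)

⁅_⁆ : Fin n → VSet n
⁅ v ⁆ x = ⌊ v ≟ x ⌋

_∈?_ : (x : Fin n) (A : VSet n) → Dec (x ∈ A)
x ∈? A = A x ≟ᵇ true

∧-intro : ∀ {a b} → a ≡ true → b ≡ true → a ∧ b ≡ true
∧-intro refl refl = refl

∨-introˡ : ∀ {a} b → a ≡ true → a ∨ b ≡ true
∨-introˡ b refl = refl

∨-introʳ : ∀ a {b} → b ≡ true → a ∨ b ≡ true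
∨-introʳ a refl = ∨-zeroʳ a

∨-elim : ∀ a b → a ∨ b ≡ true → a ≡ true ⊎ b ≡ true
∨-elim true b p = inj₁ refl
∨-elim false b p = inj₂ p

∧-elim : ∀ a b → a ∧ b ≡ true → a ≡ true × b ≡ true
∧-elim a b p = ∧-conicalˡ a b p , ∧-conicalʳ a b p

∧ˡ : ∀ a {b} → a ∧ b ≡ true → a ≡ true
∧ˡ a = ∧-conicalˡ a _

∧ʳ : ∀ a {b} → a ∧ b ≡ true → b ≡ true
∧ʳ a = ∧-conicalʳ a _

not-intro : ∀ {a} → ¬ a ≡ true → not a ≡ true
not-intro {false} p = refl
not-intro {true} p = contradiction refl p

not-elim : ∀ {a} → not a ≡ true → ¬ a ≡ true
not-elim {false} p ()

∈∖-intro : ∀ (A B : VSet n) {x} → x ∈ A → x ∉ B → x ∈ A ∖ B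
∈∖-intro A B p q = ∧-intro p (not-intro q)

∈∖-elim : ∀ (A B : VSet n) {x} → x ∈ A ∖ B → x ∈ A × x ∉ B
∈∖-elim A B {x} p = let a , b = ∧-elim (A x) (not (B x)) p in a , not-elim b

∖ˡ : ∀ (A : VSet n) {b x} → A x ∧ b ≡ true → x ∈ A
∖ˡ A {x = x} = ∧ˡ (A x)

⌊⌋-intro : ∀ {P : Set} {d : Dec P} → P → ⌊ d ⌋ ≡ true
⌊⌋-intro {d = yes _} p = refl
⌊⌋-intro {d = no q} p = contradiction p q

⌊⌋-elim : ∀ {P : Set} (d : Dec P) → ⌊ d ⌋ ≡ true → P
⌊⌋-elim (yes p) _ = p

∈⁅⁆ : ∀ (v : Fin n) → v ∈ ⁅ v ⁆
∈⁅⁆ v = ⌊⌋-intro refl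

∈⁅⁆-elim : ∀ (v x : Fin n) → x ∈ ⁅ v ⁆ → v ≡ x
∈⁅⁆-elim v x p = ⌊⌋-elim (v ≟ x) p

some : (Fin n → Bool) → Bool
some f = ⌊ any? (λ i → f i ≟ᵇ true) ⌋

some-intro : (f : Fin n → Bool) → ∀ i → f i ≡ true → some f ≡ true
some-intro f i p = ⌊⌋-intro (i , p)

some-elim : (f : Fin n → Bool) → some f ≡ true → ∃[ i ] f i ≡ true
some-elim f p = ⌊⌋-elim (any? (λ i → f i ≟ᵇ true)) p

∣_∣ : VSet n → ℕ
∣ A ∣ = sum (b2n ∘ A)

∣∣-mono : (A B : VSet n) → A ⊆ B → ∣ A ∣ ≤ ∣ B ∣
∣∣-mono A B h = sum-mono _ _ (λ x → b2n-mono (h x))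

∣∣-cover : (A B C : VSet n) → (∀ x → x ∈ A → x ∈ B ⊎ x ∈ C) → ∣ A ∣ ≤ ∣ B ∣ + ∣ C ∣
∣∣-cover A B C h = ≤-trans (sum-mono _ (λ x → b2n (B x) + b2n (C x)) (λ x → b2n-≤+ (B x) (C x) (h x)))
  (≤-reflexive (∑-distrib-+ (b2n ∘ B) (b2n ∘ C)))

∣∣-disjoint : (A B C : VSet n) → (∀ x → x ∈ A → x ∈ B → ⊥) → A ⊆ C → B ⊆ C → ∣ A ∣ + ∣ B ∣ ≤ ∣ C ∣
∣∣-disjoint A B C d p q = ≤-trans (≤-reflexive (≡sym (∑-distrib-+ (b2n ∘ A) (b2n ∘ B)))) (sum-mono _ _ λ x → aux (A x) (B x) (C x) (d x) (p x) (q x))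
  where
  aux : ∀ a b c → (a ≡ true → b ≡ true → ⊥) → (a ≡ true → c ≡ true) → (b ≡ true → c ≡ true) → b2n a + b2n b ≤ b2n c
  aux false b c d p q = b2n-mono q
  aux true false c d p q = b2n-mono p
  aux true true c d p q = ⊥-elim (d refl refl)

∣∣≤n : (A : VSet n) → ∣ A ∣ ≤ n
∣∣≤n {n} A = ≤-trans (sum-mono _ (λ _ → 1) (λ x → b2n≤1 (A x))) (≤-reflexive (trans (sum-const n 1) (*-identityʳ n)))

∈⇒∣∣>0 : (A : VSet n) → ∀ x → x ∈ A → 0 < ∣ A ∣
∈⇒∣∣>0 A x p = ≤-trans (≤-reflexive (≡sym (cong b2n p))) (term≤sum (b2n ∘ A) x)

b2n>0 : ∀ b → 0 < b2n b → b ≡ true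
b2n>0 true p = refl

∣∣>0⇒∈ : (A : VSet n) → 0 < ∣ A ∣ → ∃[ x ] x ∈ A
∣∣>0⇒∈ A p = let x , q = sum>0⇒term>0 (b2n ∘ A) p in x , b2n>0 (A x) q

∣∣<⇒∈∖ : (A B : VSet n) → ∣ B ∣ < ∣ A ∣ → ∃[ x ] x ∈ A × x ∉ B
∣∣<⇒∈∖ A B p with ∣∣>0⇒∈ (A ∖ B) (+-cancelˡ-< ∣ B ∣ 0 _ (<-≤-trans (subst (_< ∣ A ∣) (≡sym (+-identityʳ _)) p)
    (∣∣-cover A B (A ∖ B) λ x q → case x ∈? B of λ { (yes r) → inj₁ r ; (no r) → inj₂ (∈∖-intro A B q r) })))
... | x , q = x , ∈∖-elim A B q

∣⁅⁆∣≤1 : (v : Fin n) → ∣ ⁅ v ⁆ ∣ ≤ 1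
∣⁅⁆∣≤1 {suc n} zero = ≤-reflexive (cong suc (sum-zero {n} (b2n ∘ ⁅ zero ⁆ ∘ suc) (λ _ → refl)))
∣⁅⁆∣≤1 {suc n} (suc v) = ≤-trans (∣∣-mono (⁅ suc v ⁆ ∘ suc) ⁅ v ⁆ λ x p → ⌊⌋-intro (suc-injectiveᶠ (⌊⌋-elim (suc v ≟ suc x) p))) (∣⁅⁆∣≤1 v)

∣∣₂ : (Fin n → Fin n′ → Bool) → ℕ
∣∣₂ f = sum (λ u → sum (λ v → b2n (f u v)))

∣∣₂-mono : (f g : Fin n → Fin n′ → Bool) → (∀ u v → f u v ≡ true → g u v ≡ true) → ∣∣₂ f ≤ ∣∣₂ g
∣∣₂-mono f g h = sum-mono _ _ λ u → sum-mono _ _ λ v → b2n-mono (h u v)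

∣∣₂-cover : (f g h : Fin n → Fin n′ → Bool) → (∀ u v → f u v ≡ true → g u v ≡ true ⊎ h u v ≡ true) → ∣∣₂ f ≤ ∣∣₂ g + ∣∣₂ h
∣∣₂-cover f g h p = ≤-trans (sum-mono _ (λ u → ∣ g u ∣ + ∣ h u ∣) λ u → ∣∣-cover (f u) (g u) (h u) (p u))
  (≤-reflexive (∑-distrib-+ (λ u → ∣ g u ∣) (λ u → ∣ h u ∣)))

∣∣₂-swap : (f : Fin n → Fin n′ → Bool) → ∣∣₂ f ≡ ∣∣₂ (λ v u → f u v)
∣∣₂-swap f = ∑-comm (λ u v → b2n (f u v))

∣∣₂-rows : (A : VSet n) (f : Fin n → Fin n′ → Bool) (d : ℕ) → (∀ u → u ∈ A → ∣ f u ∣ ≤ d) →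
  ∣∣₂ (λ u v → A u ∧ f u v) ≤ d * ∣ A ∣
∣∣₂-rows A f d h = ≤-trans (sum-mono _ (λ u → d * b2n (A u)) λ u → aux u (A u) (h u))
  (≤-reflexive (≡sym (*-distribˡ-sum d (b2n ∘ A))))
  where
  aux : ∀ u a → (a ≡ true → ∣ f u ∣ ≤ d) → sum (λ v → b2n (a ∧ f u v)) ≤ d * b2n a
  aux u true p = ≤-trans (p refl) (≤-reflexive (≡sym (*-identityʳ d)))
  aux u false p = ≤-trans (≤-reflexive (sum-zero (λ v → b2n (false ∧ f u v)) (λ _ → refl))) z≤n

∣∣₂-row : (v : Fin n) (f : VSet n′) → ∣∣₂ (λ u w → ⌊ v ≟ u ⌋ ∧ f w) ≤ ∣ f ∣
∣∣₂-row v f = ≤-trans (∣∣₂-rows ⁅ v ⁆ (λ _ → f) ∣ f ∣ (λ _ _ → ≤-refl)) (≤-trans (*-monoʳ-≤ ∣ f ∣ (∣⁅⁆∣≤1 v)) (≤-reflexive (*-identityʳ _)))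

-- Only tables are enumerated, and a function is merely pointwise equal to its table: hence the last hypothesis.
search : (P : VSet n → Set) → (∀ A → Dec (P A)) → (∀ {A B} → (∀ x → A x ≡ B x) → P A → P B) → Dec (∃ P)
search P P? resp = map′ (λ (V , p) → lookup V , p) (λ (A , p) → tabulate A , resp (λ x → ≡sym (lookup∘tabulate A x)) p)
  (anySubset? (λ V → P? (lookup V)))

∣∣-cong : {A B : VSet n} → (∀ x → A x ≡ B x) → ∣ A ∣ ≡ ∣ B ∣
∣∣-cong h = sum-cong-≗ (λ x → cong b2n (h x))

-- The field `sum-elt` is what carries edge counts over to the induced subgraph on `A`.
record Enum (A : VSet n) (m : ℕ) : Set where
  field
    elt : Fin m → Fin n
    elt∈ : ∀ i → elt i ∈ A
    elt-inj : ∀ i j → elt i ≡ elt j → i ≡ j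
    index : ∀ x → x ∈ A → ∃[ i ] elt i ≡ x
    sum-elt : ∀ f → sum (λ x → if A x then f x else 0) ≡ sum (f ∘ elt)

enum : (A : VSet n) → Enum A ∣ A ∣
enum {zero} A = record { elt = λ () ; elt∈ = λ () ; elt-inj = λ () ; index = λ () ; sum-elt = λ _ → refl }
enum {suc n} A with A zero in eq | enum (A ∘ suc)
... | true | E = record { elt = e ; elt∈ = e∈ ; elt-inj = inj ; index = ix ; sum-elt = λ f → cong₂ _+_ (cong (λ b → if b then f zero else 0) eq) (E.sum-elt (f ∘ suc)) }
  where
  module E = Enum E
  e : Fin (suc ∣ A ∘ suc ∣) → Fin (suc n)
  e zero = zero
  e (suc i) = suc (E.elt i)
  e∈ : ∀ i → e i ∈ A
  e∈ zero = eq
  e∈ (suc i) = E.elt∈ i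
  inj : ∀ i j → e i ≡ e j → i ≡ j
  inj zero zero p = refl
  inj (suc i) (suc j) p = cong suc (E.elt-inj i j (suc-injectiveᶠ p))
  ix : ∀ x → x ∈ A → ∃[ i ] e i ≡ x
  ix zero p = zero , refl
  ix (suc x) p = let i , q = E.index x p in suc i , cong suc q
... | false | E = record { elt = suc ∘ E.elt ; elt∈ = E.elt∈ ; elt-inj = λ i j p → E.elt-inj i j (suc-injectiveᶠ p)
                         ; index = ix ; sum-elt = λ f → cong₂ _+_ (cong (λ b → if b then f zero else 0) eq) (E.sum-elt (f ∘ suc)) }
  where
  module E = Enum E
  ix : ∀ x → x ∈ A → ∃[ i ] suc (E.elt i) ≡ x
  ix zero p with () ← trans (≡sym p) eq
  ix (suc x) p = let i , q = E.index x p in i , cong suc q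

choose : (A : VSet n) (k : ℕ) → k ≤ ∣ A ∣ → Σ (Fin k → Fin n) λ b → (∀ i → b i ∈ A) × (∀ i j → b i ≡ b j → i ≡ j)
choose A k le = (λ i → elt (Data.Fin.inject≤ i le)) , (λ i → elt∈ _) ,
  λ i j p → Data.Fin.Properties.inject≤-injective le le i j (elt-inj _ _ p)
  where
  open Enum (enum A)
  import Data.Fin.Properties

log₂ : ∀ n → 1 ≤ n → ∃[ L ] 2 ^ L ≤ n × n < 2 ^ suc L
log₂ (suc zero) _ = 0 , s≤s z≤n , s≤s (s≤s z≤n)
log₂ (suc (suc n)) _ with log₂ (suc n) (s≤s z≤n)
... | L , p , q with suc (suc n) <? 2 ^ suc L
... | yes r = L , ≤-trans p (n≤1+n _) , r
... | no r = suc L , ≮⇒≥ r , ≤-<-trans q (^-monoʳ-< 2 (s≤s (s≤s z≤n)) (n<1+n (suc L)))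

-- Minimal dense vertex sets

-- Twice the number of edges inside A.
E : Graph n → VSet n → ℕ
E G A = ∣∣₂ (λ u v → A u ∧ (A v ∧ adj G u v))

module _ (G : Graph n) where

  deg : VSet n → Fin n → ℕ
  deg A v = ∣ (λ w → A w ∧ adj G v w) ∣

  nbr : VSet n → VSet n
  nbr S x = some (λ y → S y ∧ adj G y x)

  nbr-intro : ∀ (S : VSet n) y x → y ∈ S → adj G y x ≡ true → x ∈ nbr S
  nbr-intro S y x p q = some-intro _ y (∧-intro p q)

  nbr-elim : ∀ (S : VSet n) x → x ∈ nbr S → ∃[ y ] y ∈ S × adj G y x ≡ true
  nbr-elim S x p = let y , q = some-elim (λ y → S y ∧ adj G y x) p in y , ∧-elim (S y) (adj G y x) q

  adj-sym : ∀ {u v} → adj G u v ≡ true → adj G v u ≡ true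
  adj-sym {u} {v} p = trans (sym G v u) p

  adj-irr : ∀ {v} → ¬ adj G v v ≡ true
  adj-irr {v} p = case trans (≡sym p) (irref G v) of λ ()

  E-elim : ∀ (A : VSet n) u v → A u ∧ (A v ∧ adj G u v) ≡ true → u ∈ A × v ∈ A × adj G u v ≡ true
  E-elim A u v p = let a , q = ∧-elim (A u) (A v ∧ adj G u v) p
                       b , c = ∧-elim (A v) (adj G u v) q in a , b , c

  E-intro : ∀ {A : VSet n} {u v} → u ∈ A → v ∈ A → adj G u v ≡ true → A u ∧ (A v ∧ adj G u v) ≡ true
  E-intro p q r = ∧-intro p (∧-intro q r)

  E-empty : ∀ (A : VSet n) → ∣ A ∣ ≡ 0 → E G A ≡ 0
  E-empty A p = n≤0⇒n≡0 (≤-trans (∣∣₂-rows A (λ u v → A v ∧ adj G u v) n (λ _ _ → ∣∣≤n _))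
    (≤-reflexive (trans (cong (n *_) p) (*-zeroʳ n))))

  E-cong : ∀ {A B : VSet n} → (∀ x → A x ≡ B x) → E G A ≡ E G B
  E-cong {A} {B} h = ≤-antisym (le h) (le (λ x → ≡sym (h x)))
    where
    le : ∀ {A B : VSet n} → (∀ x → A x ≡ B x) → E G A ≤ E G B
    le {A} {B} h = ∣∣₂-mono _ _ λ u v p → let a , b , c = E-elim A u v p in
      E-intro (trans (≡sym (h u)) a) (trans (≡sym (h v)) b) c

  -- Average degree at least `p / q` inside `A`, with the fraction cleared. The empty set is
  -- excluded because it would satisfy every such inequality.
  Dense : ℕ → ℕ → VSet n → Set
  Dense q p A = 1 ≤ ∣ A ∣ × p * ∣ A ∣ ≤ q * E G A

  findDense : ∀ q p b K → Dec (∃[ A ] (A ⊆ K × ∣ A ∣ ≤ b × Dense q p A))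
  findDense q p b K = search _ (λ A → all? (λ x → (x ∈? A) →-dec (x ∈? K)) ×-dec ((∣ A ∣ ≤? b) ×-dec ((1 ≤? ∣ A ∣) ×-dec (p * ∣ A ∣ ≤? q * E G A))))
    λ { {A} {B} h (s , l , o , d) → (λ x r → s x (trans (h x) r)) , subst (_≤ b) (∣∣-cong h) l , subst (1 ≤_) (∣∣-cong h) o ,
        subst₂ (λ c e → p * c ≤ q * e) (∣∣-cong h) (E-cong h) d }

  notDense : ∀ q p A → ¬ Dense q p A → q * E G A ≤ p * ∣ A ∣
  notDense q p A h with 1 ≤? ∣ A ∣
  ... | no z = ≤-trans (≤-reflexive (trans (cong (q *_) (E-empty A (n<1⇒n≡0 (≰⇒> z)))) (*-zeroʳ q))) z≤n
  ... | yes o with p * ∣ A ∣ ≤? q * E G A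
  ... | yes d = contradiction (o , d) h
  ... | no d = <⇒≤ (≰⇒> d)

  -- Minimality is by cardinality; the bound in `smaller` is not strict because it also covers the
  -- empty set.
  record MinDense (q p : ℕ) (K : VSet n) : Set where
    constructor minDense
    field
      dense : Dense q p K
      smaller : ∀ A → A ⊆ K → ∣ A ∣ < ∣ K ∣ → q * E G A ≤ p * ∣ A ∣

  shrink : ∀ q p b K → ∣ K ∣ ≤ b → Dense q p K → ∃[ K′ ] (K′ ⊆ K × MinDense q p K′)
  shrink q p b K le d with findDense q p (∣ K ∣ ∸ 1) K
  shrink q p zero K le d | _ = contradiction (≤-trans (proj₁ d) le) λ ()
  shrink q p (suc b) K le d | yes (A , s , l , e) =
    let K′ , s′ , m = shrink q p b A (≤-trans l (∸-monoˡ-≤ 1 le)) e in K′ , (λ x r → s x (s′ x r)) , m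
  shrink q p (suc b) K le d | no h = K , (λ _ r → r) , minDense d λ A s l → notDense q p A λ e →
    h (A , s , m<n⇒m≤n∸1 l , e)
    where
    m<n⇒m≤n∸1 : ∀ {m n} → m < n → m ≤ n ∸ 1
    m<n⇒m≤n∸1 (s≤s p) = p

  module _ {q p : ℕ} {K : VSet n} (md : MinDense q p K) where
    open MinDense md

    private
      -- What is left of `K` has density at most `p / q`, while `K` itself has at least that.
      -- Subtracting the two bounds charges the share of `S` to the lost edges `X`.
      remove : ∀ (S : VSet n) → S ⊆ K → 1 ≤ ∣ S ∣ → ∀ X → E G K ≤ E G (K ∖ S) + X → p * ∣ S ∣ ≤ q * X
      remove S S⊆K o X le = +-cancelˡ-≤ (p * ∣ K ∖ S ∣) _ _ (begin
        p * ∣ K ∖ S ∣ + p * ∣ S ∣ ≡⟨ *-distribˡ-+ p _ _ ⟨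
        p * (∣ K ∖ S ∣ + ∣ S ∣) ≤⟨ *-monoʳ-≤ p split ⟩
        p * ∣ K ∣ ≤⟨ proj₂ dense ⟩
        q * E G K ≤⟨ *-monoʳ-≤ q le ⟩
        q * (E G (K ∖ S) + X) ≡⟨ *-distribˡ-+ q _ _ ⟩
        q * E G (K ∖ S) + q * X ≤⟨ +-monoˡ-≤ _ (smaller (K ∖ S) (λ x r → ∖ˡ K r)
           (<-≤-trans (m<m+n _ o) split)) ⟩
        p * ∣ K ∖ S ∣ + q * X ∎)
        where
        open ≤-Reasoning
        split : ∣ K ∖ S ∣ + ∣ S ∣ ≤ ∣ K ∣
        split = ∣∣-disjoint _ _ _ (λ x r s → proj₂ (∈∖-elim K S r) s) (λ x r → ∖ˡ K r) S⊆K

    -- Every edge of `K` that meets `S` lies inside `S′` and can be counted there. If `S′` is known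
    -- to be sparse, it must therefore be larger than `S`: this is the source of all expansion.
    closed-dense : ∀ (S S′ : VSet n) → S ⊆ K → S ⊆ S′ → (∀ x y → x ∈ S → y ∈ K → adj G x y ≡ true → y ∈ S′) →
      p * ∣ S ∣ ≤ q * E G S′
    closed-dense S S′ S⊆K S⊆S′ cl with 1 ≤? ∣ S ∣
    ... | no z = ≤-trans (≤-reflexive (trans (cong (p *_) (n<1⇒n≡0 (≰⇒> z))) (*-zeroʳ p))) z≤n
    ... | yes o = remove S S⊆K o (E G S′) (∣∣₂-cover _ _ _ λ u v r → let a , b , c = E-elim K u v r in
        case (u ∈? S) , (v ∈? S) of λ
        { (yes s , _) → inj₂ (E-intro (S⊆S′ u s) (cl u v s b c) c)
        ; (no s , yes t) → inj₂ (E-intro (cl v u t a (adj-sym c)) (S⊆S′ v t) c)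
        ; (no s , no t) → inj₁ (E-intro {A = K ∖ S} (∈∖-intro K S a s) (∈∖-intro K S b t) c) })

    deg-lower : ∀ v → v ∈ K → p ≤ q * (deg K v + deg K v)
    deg-lower v v∈K = begin
      p ≡⟨ *-identityʳ p ⟨
      p * 1 ≤⟨ *-monoʳ-≤ p o ⟩
      p * ∣ ⁅ v ⁆ ∣ ≤⟨ remove ⁅ v ⁆ (λ x r → subst (_∈ K) (∈⁅⁆-elim v x r) v∈K) o X le ⟩
      q * X ≤⟨ *-monoʳ-≤ q (+-mono-≤ (∣∣₂-row v (λ w → K w ∧ adj G v w))
          (≤-trans (≤-reflexive (∣∣₂-swap (λ w u → ⌊ v ≟ u ⌋ ∧ (K w ∧ adj G v w)))) (∣∣₂-row v (λ w → K w ∧ adj G v w)))) ⟩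
      q * (deg K v + deg K v) ∎
      where
      open ≤-Reasoning
      o = ∈⇒∣∣>0 ⁅ v ⁆ v (∈⁅⁆ v)
      X = ∣∣₂ (λ u w → ⌊ v ≟ u ⌋ ∧ (K w ∧ adj G v w)) + ∣∣₂ (λ w u → ⌊ v ≟ u ⌋ ∧ (K w ∧ adj G v w))
      le : E G K ≤ E G (K ∖ ⁅ v ⁆) + X
      le = ≤-trans (∣∣₂-cover _ (λ a b → (⌊ v ≟ a ⌋ ∧ (K b ∧ adj G v b)) ∨ (⌊ v ≟ b ⌋ ∧ (K a ∧ adj G v a))) (λ a b → (K ∖ ⁅ v ⁆) a ∧ ((K ∖ ⁅ v ⁆) b ∧ adj G a b)) f)
          (≤-trans (+-monoˡ-≤ _ (∣∣₂-cover _ (λ u w → ⌊ v ≟ u ⌋ ∧ (K w ∧ adj G v w)) (λ w u → ⌊ v ≟ u ⌋ ∧ (K w ∧ adj G v w)) λ a b → ∨-elim _ _)) (≤-reflexive (+-comm _ (E G (K ∖ ⁅ v ⁆)))))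
        where
        f : ∀ a b → K a ∧ (K b ∧ adj G a b) ≡ true → _
        f a b r with E-elim K a b r
        ... | ka , kb , c with v ≟ a
        ... | yes refl = inj₁ (∨-introˡ _ (∧-intro {⌊ v ≟ v ⌋} (⌊⌋-intro refl) (∧-intro kb c)))
        ... | no va with v ≟ b
        ... | yes refl = inj₁ (∨-introʳ (⌊ v ≟ a ⌋ ∧ (K v ∧ adj G v v)) (∧-intro {⌊ v ≟ v ⌋} (⌊⌋-intro refl) (∧-intro ka (adj-sym c))))
        ... | no vb = inj₂ (E-intro {A = K ∖ ⁅ v ⁆} (∈∖-intro K ⁅ v ⁆ ka (λ z → va (∈⁅⁆-elim v a z))) (∈∖-intro K ⁅ v ⁆ kb (λ z → vb (∈⁅⁆-elim v b z))) c)

  -- Walks and balls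

  -- At most i steps; the start u need not lie in A.
  data Walk (A : VSet n) : Fin n → ℕ → Fin n → Set where
    stop : ∀ {u i} → Walk A u i u
    go : ∀ {u w v i} → adj G u w ≡ true → w ∈ A → Walk A w i v → Walk A u (suc i) v

  walk-mono : ∀ {A B} → A ⊆ B → ∀ {u i v} → Walk A u i v → Walk B u i v
  walk-mono s stop = stop
  walk-mono s (go e p w) = go e (s _ p) (walk-mono s w)

  walk-≤ : ∀ {A u i j v} → i ≤ j → Walk A u i v → Walk A u j v
  walk-≤ le stop = stop
  walk-≤ (s≤s le) (go e p w) = go e p (walk-≤ le w)

  walk-++ : ∀ {A u v x i j} → Walk A u i v → Walk A v j x → Walk A u (i + j) x
  walk-++ {i = i} stop w = walk-≤ (m≤n+m _ i) w
  walk-++ (go e p v) w = go e p (walk-++ v w)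

  walk-snoc : ∀ {A u v x i} → Walk A u i v → adj G v x ≡ true → x ∈ A → Walk A u (suc i) x
  walk-snoc stop e p = go e p stop
  walk-snoc (go e p w) f q = go e p (walk-snoc w f q)

  walk-rev : ∀ {A u i v} → u ∈ A → Walk A u i v → Walk A v i u
  walk-rev p stop = stop
  walk-rev p (go e q w) = walk-snoc (walk-rev q w) (adj-sym e) p

  walk-end : ∀ {A u i v} → Walk A u i v → u ∈ A → v ∈ A
  walk-end stop p = p
  walk-end (go e q w) p = walk-end w q

  ball : VSet n → VSet n → ℕ → VSet n
  ball A U zero = U
  ball A U (suc i) = ball A U i ∪ (A ∩ nbr (ball A U i))

  ball-step : ∀ A U i y x → y ∈ ball A U i → adj G y x ≡ true → x ∈ A → x ∈ ball A U (suc i)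
  ball-step A U i y x p e q = ∨-introʳ (ball A U i x) (∧-intro q (nbr-intro (ball A U i) y x p e))

  ball-suc : ∀ A U i → ball A U i ⊆ ball A U (suc i)
  ball-suc A U i x p = ∨-introˡ _ p

  ball-≤ : ∀ A U {i j} → i ≤ j → ball A U i ⊆ ball A U j
  ball-≤ A U {i} {zero} z≤n x p = p
  ball-≤ A U {i} {suc j} le x p with m≤n⇒m<n∨m≡n le
  ... | inj₁ (s≤s l) = ball-suc A U j x (ball-≤ A U l x p)
  ... | inj₂ refl = p

  ball-elim : ∀ A U i x → x ∈ ball A U (suc i) → x ∈ ball A U i ⊎ (x ∈ A × ∃[ y ] y ∈ ball A U i × adj G y x ≡ true)
  ball-elim A U i x p with ∨-elim (ball A U i x) _ p
  ... | inj₁ q = inj₁ q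
  ... | inj₂ q = let a , b = ∧-elim (A x) (nbr (ball A U i) x) q in inj₂ (a , nbr-elim (ball A U i) x b)

  ball⇒walk : ∀ A U i x → x ∈ ball A U i → ∃[ u ] u ∈ U × Walk A u i x
  ball⇒walk A U zero x p = x , p , stop
  ball⇒walk A U (suc i) x p with ball-elim A U i x p
  ... | inj₁ q = let u , r , w = ball⇒walk A U i x q in u , r , walk-≤ (n≤1+n i) w
  ... | inj₂ (a , y , q , e) = let u , r , w = ball⇒walk A U i y q in u , r , walk-snoc w e a

  ball+walk : ∀ A U j {u i x} → u ∈ ball A U j → Walk A u i x → x ∈ ball A U (j + i)
  ball+walk A U j {x = x} p stop = ball-≤ A U (m≤m+n j _) x p
  ball+walk A U j {i = suc i} {x} p (go {w = w} e q wk) =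
    subst (λ k → x ∈ ball A U k) (≡sym (+-suc j i)) (ball+walk A U (suc j) (ball-step A U j _ w p e q) wk)

  walk⇒ball : ∀ A U {u i x} → u ∈ U → Walk A u i x → x ∈ ball A U i
  walk⇒ball A U = ball+walk A U 0

  ball-mono : ∀ {A A′} U → A ⊆ A′ → ∀ i → ball A U i ⊆ ball A′ U i
  ball-mono U s i x p = let u , q , w = ball⇒walk _ U i x p in walk⇒ball _ U q (walk-mono s w)

  ball⊆ : ∀ {A U K} → A ⊆ K → U ⊆ K → ∀ i → ball A U i ⊆ K
  ball⊆ s t i x p = let u , q , w = ball⇒walk _ _ i x p in walk-end (walk-mono s w) (t u q)

  ball-size : ∀ A U Δ → U ⊆ A → (∀ x → x ∈ A → deg A x ≤ Δ) → ∀ i → ∣ ball A U i ∣ ≤ ∣ U ∣ * suc Δ ^ i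
  ball-size A U Δ s h zero = ≤-reflexive (≡sym (*-identityʳ _))
  ball-size A U Δ s h (suc i) = begin
    ∣ B ∪ (A ∩ nbr B) ∣ ≤⟨ ∣∣-cover _ B (A ∩ nbr B) (λ x → ∨-elim (B x) _) ⟩
    ∣ B ∣ + ∣ A ∩ nbr B ∣ ≤⟨ +-monoʳ-≤ ∣ B ∣ nb ⟩
    ∣ B ∣ + Δ * ∣ B ∣ ≡⟨⟩
    suc Δ * ∣ B ∣ ≤⟨ *-monoʳ-≤ (suc Δ) (ball-size A U Δ s h i) ⟩
    suc Δ * (∣ U ∣ * suc Δ ^ i) ≡⟨ x∙yz≈y∙xz (suc Δ) ∣ U ∣ (suc Δ ^ i) ⟩
    ∣ U ∣ * (suc Δ * suc Δ ^ i) ∎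
    where
    open ≤-Reasoning
    B = ball A U i
    nb : ∣ A ∩ nbr B ∣ ≤ Δ * ∣ B ∣
    nb = begin
      ∣ A ∩ nbr B ∣ ≤⟨ sum-mono _ _ (λ x → le x) ⟩
      sum (λ x → ∣ (λ y → B y ∧ (A x ∧ adj G y x)) ∣) ≡⟨ ∣∣₂-swap (λ y x → B y ∧ (A x ∧ adj G y x)) ⟨
      ∣∣₂ (λ y x → B y ∧ (A x ∧ adj G y x)) ≤⟨ ∣∣₂-rows B (λ y x → A x ∧ adj G y x) Δ (λ y p → h y (ball⊆ (λ _ r → r) s i y p)) ⟩
      Δ * ∣ B ∣ ∎
      where
      le : ∀ x → b2n ((A ∩ nbr B) x) ≤ ∣ (λ y → B y ∧ (A x ∧ adj G y x)) ∣
      le x with (A ∩ nbr B) x in eq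
      ... | false = z≤n
      ... | true = let a , b = ∧-elim (A x) (nbr B x) eq ; y , c , d = nbr-elim B x b in
        ∈⇒∣∣>0 (λ y → B y ∧ (A x ∧ adj G y x)) y (∧-intro c (∧-intro a d))

<ᵇ-intro : ∀ {a b} → a < b → (a <ᵇ b) ≡ true
<ᵇ-intro {a} {b} p with a <ᵇ b | <⇒<ᵇ p
... | true | _ = refl

<ᵇ-elim : ∀ {a b} → (a <ᵇ b) ≡ true → a < b
<ᵇ-elim {a} {b} p = <ᵇ⇒< a b (subst T (≡sym p) _)

private module DM {n} = DecMembership (_≟_ {n})

-- Linkages and subdivisions

lsum-allFin : (f : Fin n → ℕ) → lsum (L.map f (L.allFin n)) ≡ sum f
lsum-allFin {n} f = trans (cong lsum (map-tabulate id f)) (aux f)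
  where
  aux : ∀ {n} (f : Fin n → ℕ) → lsum (L.tabulate f) ≡ sum f
  aux {zero} f = refl
  aux {suc n} f = cong (f zero +_) (aux (f ∘ suc))

lsum-≤ : (f : Fin n → ℕ) (c : ℕ) → (∀ i → f i ≤ c) → lsum (L.map f (L.allFin n)) ≤ n * c
lsum-≤ {n} f c h = ≤-trans (≤-reflexive (lsum-allFin f)) (≤-trans (sum-mono f (λ _ → c) h) (≤-reflexive (sum-const n c)))

combine-inj : ∀ {t} (i j i′ j′ : Fin t) → combine i j ≡ combine i′ j′ → i ≡ i′ × j ≡ j′
combine-inj i j i′ j′ eq = combine-injectiveˡ i j i′ j′ eq , combine-injectiveʳ i j i′ j′ eq

module _ (G : Graph n) where

  -- A subdivision in which each path is replaced by a vertex set containing it; simple paths are extracted at the very end.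
  record Linkage (t ℓ : ℕ) : Set where
    field
      b : Fin t → Fin n
      Q : Fin t → Fin t → VSet n
      b-inj : ∀ i j → b i ≡ b j → i ≡ j
      avoid : ∀ i j k → i <F j → b k ∉ Q i j
      disj : ∀ i j i′ j′ x → i <F j → i′ <F j′ → x ∈ Q i j → x ∈ Q i′ j′ → i ≡ i′ × j ≡ j′
      path : ∀ i j → i <F j → Walk G (Q i j ∪ ⁅ b j ⁆) (b i) ℓ (b j)

  private
    suffix : ∀ {w v} w₁ L₁ → w ∈ᴸ (w₁ ∷ L₁) → Chain G w₁ L₁ v → Unique (w₁ ∷ L₁) →
      ∃[ L ] (Chain G w L v × Unique (w ∷ L) × (∀ x → x ∈ᴸ L → x ∈ᴸ L₁) × length L ≤ length L₁)
    suffix w₁ L₁ (here refl) c u = L₁ , c , u , (λ _ p → p) , ≤-refl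
    suffix w₁ (w₂ ∷ L₂) (there p) (_ , c) (_ ∷ u) =
      let L , c′ , u′ , s , l = suffix w₂ L₂ p c u in L , c′ , u′ , (λ x q → there (s x q)) , m≤n⇒m≤1+n l

  -- Loop erasure: if `w` occurs again on the path found from the next vertex, everything before
  -- that occurrence is dropped.
  simple-path : ∀ {A w i v} → Walk G A w i v → w ≢ v →
    ∃[ L ] (Chain G w L v × Unique (w ∷ L) × (∀ x → x ∈ᴸ L → x ∈ A × x ≢ v) × length L ≤ i)
  simple-path stop ne = contradiction refl ne
  simple-path {w = w} {v = v} (go {w = w₁} e p wk) ne with w₁ ≟ v
  ... | yes refl = [] , e , ([] ∷ []) , (λ _ ()) , z≤n
  ... | no ne₁ with simple-path wk ne₁
  ... | L₁ , c , u , s , l with DM._∈?_ w (w₁ ∷ L₁)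
  ... | yes q = let L , c′ , u′ , s′ , l′ = suffix w₁ L₁ q c u in
        L , c′ , u′ , (λ x r → s x (s′ x r)) , m≤n⇒m≤1+n (≤-trans l′ l)
  ... | no q = w₁ ∷ L₁ , (e , c) , (¬Any⇒All¬ _ q ∷ u) ,
        (λ { x (here refl) → p , ne₁ ; x (there r) → s x r }) , s≤s l

  linkage⇒subdivision : ∀ {t ℓ} → Linkage t ℓ → ∃[ s ] (KtSubdivOfSize t s G × s ≤ t + t * (t * ℓ))
  linkage⇒subdivision {t} {ℓ} Λ = subdivSize t Ls , (b , Ls , b-inj ,
      (λ i j p → proj₁ (spec i j p)) , (λ i j p → proj₁ (proj₂ (spec i j p))) ,
      (λ i j p x q k eq → avoid i j k p (subst (_∈ Q i j) eq (inQ i j p x q))) ,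
      (λ i j i′ j′ p p′ ne x q q′ → let a , c = disj i j i′ j′ x p p′ (inQ i j p x q) (inQ i′ j′ p′ x q′) in
        [ (λ f → f a) , (λ f → f c) ]′ ne) , refl) , size
    where
    open Linkage Λ
    Spec : (i j : Fin t) → List (Fin n) → Set
    Spec i j L = Chain G (b i) L (b j) × Unique L × (∀ x → x ∈ᴸ L → x ∈ Q i j ∪ ⁅ b j ⁆ × x ≢ b j) × length L ≤ ℓ
    find : ∀ i j → ∃[ L ] (i <F j → Spec i j L)
    find i j with suc (toℕ i) ≤? toℕ j
    ... | no q = [] , λ p → contradiction p q
    ... | yes p with simple-path (path i j p) (λ eq → <⇒≢ p (cong toℕ (b-inj i j eq)))
    ... | L , c , (_ ∷ u) , s , l = L , λ _ → c , u , s , l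
    Ls : Fin t → Fin t → List (Fin n)
    Ls i j = proj₁ (find i j)
    spec : ∀ i j → i <F j → Spec i j (Ls i j)
    spec i j = proj₂ (find i j)
    inQ : ∀ i j → i <F j → ∀ x → x ∈ᴸ Ls i j → x ∈ Q i j
    inQ i j p x q with proj₁ (proj₂ (proj₂ (spec i j p))) x q
    ... | r , ne with ∨-elim (Q i j x) _ r
    ... | inj₁ s = s
    ... | inj₂ s = contradiction (≡sym (∈⁅⁆-elim (b j) x s)) ne
    len : ∀ i j → (if toℕ i <ᵇ toℕ j then length (Ls i j) else 0) ≤ ℓ
    len i j = bound (toℕ i <ᵇ toℕ j) _ λ eq → proj₂ (proj₂ (proj₂ (spec i j (<ᵇ-elim eq))))
      where
      bound : ∀ c x → (c ≡ true → x ≤ ℓ) → (if c then x else 0) ≤ ℓ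
      bound true x h = h refl
      bound false x h = z≤n
    size : subdivSize t Ls ≤ t + t * (t * ℓ)
    size = +-monoʳ-≤ t (lsum-≤ {t} _ _ (λ i → lsum-≤ {t} _ _ (len i)))

  -- Each pair of branch vertices will be joined through its own hub S c. Only the radius R is logarithmic; W is a constant.
  record Web (K H : VSet n) (W R k : ℕ) : Set where
    field
      S : Fin k → VSet n
      S-disj : ∀ c d x → x ∈ S c → x ∈ S d → c ≡ d
      S-out : ∀ c x → x ∈ S c → x ∉ H
      centre : ∀ c → ∃[ z ] z ∈ S c × (∀ x → x ∈ S c → Walk G (S c) z R x)
      near : ∀ c u → u ∈ K → ∃[ x ] ∃[ y ] Walk G H u W x × y ∈ S c × adj G x y ≡ true

  emptyWeb : ∀ {K H W R} → Web K H W R 0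
  emptyWeb = record { S = λ () ; S-disj = λ () ; S-out = λ () ; centre = λ () ; near = λ () }

  restrictWeb : ∀ {K K′ H H′ W W′ R k} → K′ ⊆ K → H′ ⊆ H →
    (∀ u x → u ∈ K′ → Walk G H u W x → Walk G H′ u W′ x) → Web K H W R k → Web K′ H′ W′ R k
  restrictWeb s s′ f w = record { S = S ; S-disj = S-disj ; S-out = λ c x p q → S-out c x p (s′ x q) ; centre = centre
    ; near = λ c u p → let x , y , a , b , e = near c u (s u p) in x , y , f u x p a , b , e }
    where open Web w

  -- The old hubs lie outside `H` and the new one inside, so they are disjoint; passing to `H′`
  -- keeps later walks and hubs away from the new one as well. The function argument says that the
  -- walks to the old hubs survive this.
  extendWeb : ∀ {K K′ H H′ W W′ R k} → K′ ⊆ K → H′ ⊆ H →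
    (∀ u x → u ∈ K′ → Walk G H u W x → Walk G H′ u W′ x) → Web K H W R k →
    (z : Fin n) (S₀ : VSet n) → S₀ ⊆ H → (∀ x → x ∈ S₀ → x ∉ H′) → z ∈ S₀ → (∀ x → x ∈ S₀ → Walk G S₀ z R x) →
    (∀ u → u ∈ K′ → ∃[ x ] ∃[ y ] Walk G H′ u W′ x × y ∈ S₀ × adj G x y ≡ true) → Web K′ H′ W′ R (suc k)
  extendWeb {n} s s′ f w z S₀ S₀⊆H out z∈ rad nr = record
    { S = λ { zero → S₀ ; (suc c) → S c }
    ; S-disj = λ { zero zero x p q → refl ; zero (suc d) x p q → contradiction (S₀⊆H x p) (S-out′ d x q)
                 ; (suc c) zero x p q → contradiction (S₀⊆H x q) (S-out′ c x p) ; (suc c) (suc d) x p q → cong suc (S-disj c d x p q) }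
    ; S-out = λ { zero → out ; (suc c) x p q → S-out′ c x p (s′ x q) }
    ; centre = λ { zero → z , z∈ , rad ; (suc c) → centre c }
    ; near = λ { zero → nr ; (suc c) u p → let x , y , a , b , e = near c u (s u p) in x , y , f u x p a , b , e } }
    where open Web w renaming (S-out to S-out′)

  -- The hub numbered combine i j joins the end of leg i j to the end of leg j i.
  record Legs {K H W R t} (w : Web K H W R (t * t)) (v : Fin t → Fin n) (Λ : ℕ) : Set where
    open Web w
    field
      v∈H : ∀ i → v i ∈ H
      v-inj : ∀ i j → v i ≡ v j → i ≡ j
      P : Fin t → Fin t → VSet n
      P⊆H : ∀ i j → P i j ⊆ H
      v∉P : ∀ k i j → v k ∉ P i j
      P-disj : ∀ i j i′ j′ x → x ∈ P i j → x ∈ P i′ j′ → i ≡ i′ × j ≡ j′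
      reach : ∀ i j (c : Fin (t * t)) → c ≡ (if toℕ i <ᵇ toℕ j then combine i j else combine j i) →
        ∃[ y ] ∃[ s ] Walk G (P i j) (v i) Λ y × s ∈ S c × adj G y s ≡ true

  -- The path from `v i` to `v j` follows leg `i j`, crosses the hub by way of its centre and
  -- returns along leg `j i`.
  legs⇒linkage : ∀ {K H W R t Λ v} (w : Web K H W R (t * t)) → Legs w v Λ → Linkage t (Λ + (2 + (R + R)) + suc Λ)
  legs⇒linkage {R = R} {t} {Λ} {v} w l = record
    { b = v ; Q = Q ; b-inj = v-inj ; avoid = av ; disj = dj ; path = pa }
    where
    open Web w
    open Legs l
    Q : Fin t → Fin t → VSet n
    Q i j = P i j ∪ (P j i ∪ S (combine i j))
    Q-elim : ∀ i j x → x ∈ Q i j → x ∈ P i j ⊎ x ∈ P j i ⊎ x ∈ S (combine i j)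
    Q-elim i j x p with ∨-elim (P i j x) _ p
    ... | inj₁ q = inj₁ q
    ... | inj₂ q = inj₂ (∨-elim (P j i x) _ q)
    av : ∀ i j k → i <F j → v k ∉ Q i j
    av i j k _ p with Q-elim i j (v k) p
    ... | inj₁ q = v∉P k i j q
    ... | inj₂ (inj₁ q) = v∉P k j i q
    ... | inj₂ (inj₂ q) = S-out _ _ q (v∈H k)
    dj : ∀ i j i′ j′ x → i <F j → i′ <F j′ → x ∈ Q i j → x ∈ Q i′ j′ → i ≡ i′ × j ≡ j′
    dj i j i′ j′ x p p′ q q′ with Q-elim i j x q | Q-elim i′ j′ x q′
    ... | inj₁ r | inj₁ r′ = P-disj i j i′ j′ x r r′
    ... | inj₁ r | inj₂ (inj₂ r′) = contradiction (P⊆H i j x r) (S-out _ x r′)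
    ... | inj₂ (inj₁ r) | inj₂ (inj₂ r′) = contradiction (P⊆H j i x r) (S-out _ x r′)
    ... | inj₂ (inj₂ r) | inj₁ r′ = contradiction (P⊆H i′ j′ x r′) (S-out _ x r)
    ... | inj₂ (inj₂ r) | inj₂ (inj₁ r′) = contradiction (P⊆H j′ i′ x r′) (S-out _ x r)
    ... | inj₂ (inj₂ r) | inj₂ (inj₂ r′) = combine-inj i j i′ j′ (S-disj _ _ x r r′)
    ... | inj₂ (inj₁ r) | inj₂ (inj₁ r′) = let a , c = P-disj j i j′ i′ x r r′ in c , a
    -- Here leg `i j` would be leg `j′ i′`, although both index pairs are increasing.
    ... | inj₁ r | inj₂ (inj₁ r′) with P-disj i j j′ i′ x r r′
    ... | refl , refl = ⊥-elim (<-asym p p′)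
    dj i j i′ j′ x p p′ q q′ | inj₂ (inj₁ r) | inj₁ r′ with P-disj j i i′ j′ x r r′
    ... | refl , refl = ⊥-elim (<-asym p p′)
    pa : ∀ i j → i <F j → Walk G (Q i j ∪ ⁅ v j ⁆) (v i) (Λ + (2 + (R + R)) + suc Λ) (v j)
    pa i j p with reach i j (combine i j) (cong (λ c → if c then combine i j else combine j i) (≡sym (<ᵇ-intro p)))
                | reach j i (combine i j) (cong (λ c → if c then combine j i else combine i j) (≡sym (¬-not λ e → <-asym p (<ᵇ-elim {toℕ j} {toℕ i} e))))
                | centre (combine i j)
    ... | y , s , wy , s∈ , ys | y′ , s′ , wy′ , s′∈ , ys′ | z , z∈ , rad =
      walk-++ G (walk-++ G (walk-mono G inP wy) (walk-mono G inS mid)) last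
      where
      inP : P i j ⊆ Q i j ∪ ⁅ v j ⁆
      inP x q = ∨-introˡ _ (∨-introˡ _ q)
      inP′ : P j i ⊆ Q i j
      inP′ x q = ∨-introʳ (P i j x) (∨-introˡ _ q)
      inS : S (combine i j) ⊆ Q i j ∪ ⁅ v j ⁆
      inS x q = ∨-introˡ _ (∨-introʳ (P i j x) (∨-introʳ (P j i x) q))
      mid : Walk G (S (combine i j)) y (2 + (R + R)) s′
      mid = walk-≤ G (n≤1+n _) (go ys s∈ (walk-++ G (walk-rev G z∈ (rad s s∈)) (rad s′ s′∈)))
      vj∈ : v j ∈ Q i j ∪ ⁅ v j ⁆
      vj∈ = ∨-introʳ (Q i j (v j)) (∈⁅⁆ (v j))
      wy″ : Walk G (Q i j ∪ ⁅ v j ⁆) (v j) Λ y′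
      wy″ = walk-mono G (λ x q → ∨-introˡ _ (inP′ x q)) wy′
      last : Walk G (Q i j ∪ ⁅ v j ⁆) s′ (suc Λ) (v j)
      last = go (adj-sym G ys′) (walk-end G wy″ vj∈) (walk-rev G vj∈ wy″)

-- Layers around a vertex

interval-≤ : ∀ {X} (A : VSet X) l M → (∀ a → a ∈ A → l ≤ toℕ a × toℕ a < l + M) → ∣ A ∣ ≤ M
interval-≤ {zero} A l M h = z≤n
interval-≤ {suc X} A (suc l) M h with A zero in eq
... | true = contradiction (proj₁ (h zero eq)) λ ()
... | false = interval-≤ (A ∘ suc) l M λ a p → let x , y = h (suc a) p in s≤s⁻¹ x , s≤s⁻¹ y
interval-≤ {suc X} A zero zero h with A zero in eq
... | true = contradiction (proj₂ (h zero eq)) λ ()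
... | false = interval-≤ (A ∘ suc) zero zero λ a p → contradiction (proj₂ (h (suc a) p)) λ ()
interval-≤ {suc X} A zero (suc M) h =
  +-mono-≤ (b2n≤1 (A zero)) (interval-≤ (A ∘ suc) zero M λ a p → z≤n , s≤s⁻¹ (proj₂ (h (suc a) p)))

interval-≥ : ∀ {X} (A : VSet X) l M → l + M ≤ X → (∀ a → l ≤ toℕ a → toℕ a < l + M → a ∈ A) → M ≤ ∣ A ∣
interval-≥ A l zero le h = z≤n
interval-≥ {zero} A zero (suc M) () h
interval-≥ {suc X} A zero (suc M) (s≤s le) h rewrite h zero z≤n z<s =
  s≤s (interval-≥ (A ∘ suc) zero M le λ a p q → h (suc a) z≤n (s≤s q))
interval-≥ {suc X} A (suc l) M@(suc _) (s≤s le) h =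
  ≤-trans (interval-≥ (A ∘ suc) l M le λ a p q → h (suc a) (s≤s p) (s≤s q)) (m≤n+m _ _)

-- This is `(1 + 1 / h) ^ k ≥ 1 + k / h` without denominators.
bernoulli : ∀ h k → h ^ k * (h + k) ≤ h * suc h ^ k
bernoulli h zero = ≤-reflexive (eq h)
  where
  eq : ∀ h → 1 * (h + 0) ≡ h * 1
  eq = solve-∀
bernoulli h (suc k) = begin
  h * h ^ k * (h + suc k) ≤⟨ m≤m+n _ (h ^ k * k) ⟩
  h * h ^ k * (h + suc k) + h ^ k * k ≡⟨ eq h (h ^ k) k ⟩
  suc h * (h ^ k * (h + k)) ≤⟨ *-monoʳ-≤ (suc h) (bernoulli h k) ⟩
  suc h * (h * suc h ^ k) ≡⟨ x∙yz≈y∙xz (suc h) h (suc h ^ k) ⟩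
  h * (suc h * suc h ^ k) ∎
  where
  open ≤-Reasoning
  eq : ∀ h x k → h * x * (h + suc k) + x * k ≡ suc h * (x * (h + k))
  eq = solve-∀

doubling : ∀ h → 1 ≤ h → 2 * h ^ h ≤ suc h ^ h
doubling h@(suc _) _ = *-cancelˡ-≤ h (≤-trans (≤-reflexive (eq h (h ^ h))) (bernoulli h h))
  where
  eq : ∀ h x → h * (2 * x) ≡ x * (h + h)
  eq = solve-∀

^-distribʳ-* : ∀ k a b → (a * b) ^ k ≡ a ^ k * b ^ k
^-distribʳ-* zero a b = refl
^-distribʳ-* (suc k) a b = trans (cong (a * b *_) (^-distribʳ-* k a b)) (eq a b (a ^ k) (b ^ k))
  where
  eq : ∀ a b x y → a * b * (x * y) ≡ a * x * (b * y)
  eq = solve-∀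

-- A factor `1 + 1 / h` doubles every `h` steps. This serves twice: for the growth of balls, and for
-- the union bound over colourings.
pow-doubling : ∀ h L → 1 ≤ h → 2 ^ L * h ^ (h * L) ≤ suc h ^ (h * L)
pow-doubling h L 1≤h = begin
  2 ^ L * h ^ (h * L) ≡⟨ cong (2 ^ L *_) (^-*-assoc h h L) ⟨
  2 ^ L * (h ^ h) ^ L ≡⟨ ^-distribʳ-* L 2 (h ^ h) ⟨
  (2 * h ^ h) ^ L ≤⟨ ^-monoˡ-≤ L (doubling h 1≤h) ⟩
  (suc h ^ h) ^ L ≡⟨ ^-*-assoc (suc h) h L ⟩
  suc h ^ (h * L) ∎
  where open ≤-Reasoning

module Layers (G : Graph n) (H : VSet n) (z : Fin n) where

  B : ℕ → VSet n
  B = ball G H ⁅ z ⁆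

  least : ∀ i u → u ∈ B i → ∃[ l ] l ≤ i × u ∈ B l × (∀ j → u ∈ B j → l ≤ j)
  least zero u p = 0 , z≤n , p , λ _ _ → z≤n
  least (suc i) u p with u ∈? B i
  ... | yes r = let l , a , b , c = least i u r in l , m≤n⇒m≤1+n a , b , c
  ... | no r = suc i , ≤-refl , p , λ j s → ≰⇒> λ le → r (ball-≤ G H ⁅ z ⁆ le u s)

  z∈B : ∀ i → z ∈ B i
  z∈B i = ball-≤ G H ⁅ z ⁆ {0} {i} z≤n z (∈⁅⁆ z)

  -- A walk of `i` steps from the centre cannot leave the ball of radius `i`; hence a ball is a
  -- connected hub whose radius is measured inside itself.
  radius : ∀ i x → x ∈ B i → Walk G (B i) z i x
  radius i x p with ball⇒walk G H ⁅ z ⁆ i x p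
  ... | u , q , w rewrite ∈⁅⁆-elim z u q = inside 0 i (∈⁅⁆ u) w
    where
    inside : ∀ j k {y} → y ∈ ball G H ⁅ u ⁆ j → Walk G H y k x → Walk G (ball G H ⁅ u ⁆ (j + k)) y k x
    inside j k r stop = stop
    inside j (suc k) r (go {w = v} e s wk) = go e (ball-≤ G H ⁅ u ⁆ (≤-trans (s≤s (m≤m+n j k)) (≤-reflexive (≡sym (+-suc j k)))) v r′)
        (subst (λ A → Walk G (ball G H ⁅ u ⁆ A) v k x) (≡sym (+-suc j k)) (inside (suc j) k r′ wk))
      where r′ = ball-step G H ⁅ u ⁆ j _ v r e s

  -- `W` lies in the layers `a - m` to `a`. The balls of radius `i` with `i + m + 1 ≤ a` are
  -- disjoint from it and provide the hub.
  Window : ℕ → ℕ → VSet n → ℕ → ℕ → Set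
  Window q p K R m = ∃[ a ] ∃[ W ] (a ≤ R × W ⊆ K × Dense G q p W × W ⊆ B a × (∀ i u → i + suc m ≤ a → u ∈ W → u ∉ B i))

  module _ {q p : ℕ} {K : VSet n} (md : MinDense G q p K) (K⊆H : K ⊆ H) (z∈K : z ∈ K) where

    private
      c : ℕ → ℕ
      c i = ∣ K ∩ B i ∣

      c-step : ∀ i → p * c i ≤ q * E G (K ∩ B (suc i))
      c-step i = closed-dense G md (K ∩ B i) (K ∩ B (suc i)) (λ x r → ∧ˡ (K x) r)
        (λ x r → let a , b = ∧-elim (K x) (B i x) r in ∧-intro a (ball-suc G H ⁅ z ⁆ i x b))
        λ x y r y∈K e → ∧-intro y∈K (ball-step G H ⁅ z ⁆ i x y (∧ʳ (K x) r) e (K⊆H y y∈K))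

      -- Otherwise the `h (L + 1)` steps would multiply `c 0 ≥ 1` by at least `2 ^ (L + 1)`, which
      -- exceeds `n`.
      slow-growth : ∀ h L → 1 ≤ h → n < 2 ^ suc L → ∃[ r ] r < h * suc L × h * c (suc r) ≤ suc h * c r
      slow-growth h L 1≤h lt with any? (λ (r : Fin (h * suc L)) → h * c (suc (toℕ r)) ≤? suc h * c (toℕ r))
      ... | yes (r , le) = toℕ r , toℕ<n r , le
      ... | no none = contradiction lt (≤⇒≯ (*-cancelʳ-≤ (2 ^ suc L) n (h ^ R) {{>-nonZero (m^n>0 h {{>-nonZero 1≤h}} R)}} (begin
          2 ^ suc L * h ^ R ≤⟨ pow-doubling h (suc L) 1≤h ⟩
          suc h ^ R ≡⟨ *-identityʳ _ ⟨
          suc h ^ R * 1 ≤⟨ *-monoʳ-≤ (suc h ^ R) (∈⇒∣∣>0 (K ∩ B 0) z (∧-intro z∈K (z∈B 0))) ⟩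
          suc h ^ R * c 0 ≤⟨ fast R ≤-refl ⟩
          h ^ R * c R ≤⟨ *-monoʳ-≤ (h ^ R) (∣∣≤n (K ∩ B R)) ⟩
          h ^ R * n ≡⟨ *-comm _ n ⟩
          n * h ^ R ∎)))
        where
        open ≤-Reasoning
        R = h * suc L
        rearr : ∀ a b c → a * b * c ≡ b * (a * c)
        rearr = solve-∀
        fast : ∀ r → r ≤ R → suc h ^ r * c 0 ≤ h ^ r * c r
        fast zero _ = ≤-refl
        fast (suc r) le = begin
          suc h * suc h ^ r * c 0 ≡⟨ *-assoc (suc h) (suc h ^ r) (c 0) ⟩
          suc h * (suc h ^ r * c 0) ≤⟨ *-monoʳ-≤ (suc h) (fast r (<⇒≤ le)) ⟩
          suc h * (h ^ r * c r) ≡⟨ x∙yz≈y∙xz (suc h) (h ^ r) (c r) ⟩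
          h ^ r * (suc h * c r) ≤⟨ *-monoʳ-≤ (h ^ r) (<⇒≤ (≰⇒> λ s → none (fromℕ< le , subst (λ k → h * c (suc k) ≤ suc h * c k) (≡sym (toℕ-fromℕ< le)) s))) ⟩
          h ^ r * (h * c (suc r)) ≡⟨ rearr h (h ^ r) (c (suc r)) ⟨
          h * h ^ r * c (suc r) ∎

    -- Stop growing the ball at the first radius r where it grows by a factor at most 1 + 1 / h, which happens after
    -- O(h log n) steps; then average over all windows of m + 1 consecutive layers. Only the fraction 1 / (m + 1) of the
    -- edges between consecutive layers is missed by a random window.
    window : ∀ h L m p′ → 1 ≤ h → n < 2 ^ suc L → p′ * (suc h * suc m) ≤ p * (h * m) →
      Window q p′ K (h * suc L + suc m) m
    window h L m p′ 1≤h lt ratio with slow-growth h L 1≤h lt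
    ... | r , r< , slow = conclude
      where
      open ≤-Reasoning
      M = suc m
      X = suc r + M
      Q = K ∩ B (suc r)
      -- Nothing is cut off while `a < M`; truncated subtraction would give `B 0` and lose the
      -- centre.
      before : Fin X → VSet n
      before a u = if toℕ a <ᵇ M then false else B (toℕ a ∸ M) u
      W : Fin X → VSet n
      W a u = Q u ∧ (B (toℕ a) u ∧ not (before a u))

      W-elim : ∀ a u → u ∈ W a → u ∈ Q × u ∈ B (toℕ a) × u ∉ before a
      W-elim a u s = let x , y = ∧-elim (Q u) _ s ; v , w = ∧-elim (B (toℕ a) u) _ y in x , v , not-elim w

      before-intro : ∀ a u i → i + M ≤ toℕ a → u ∈ B i → u ∈ before a
      before-intro a u i le s with toℕ a <ᵇ M in eq
      ... | true = contradiction (<ᵇ-elim {toℕ a} eq) (≤⇒≯ (≤-trans (m≤n+m M i) le))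
      ... | false = ball-≤ G H ⁅ z ⁆ (m+n≤o⇒m≤o∸n i le) u s

      before-elim : ∀ a u l → u ∈ before a → (∀ j → u ∈ B j → l ≤ j) → l + M ≤ toℕ a
      before-elim a u l s mn with toℕ a <ᵇ M in eq
      ... | false = m≤o∸n⇒m+n≤o l (≮⇒≥ λ lt → case trans (≡sym (<ᵇ-intro lt)) eq of λ ()) (mn _ s)

      W-bounds : ∀ u l → u ∈ B l → (∀ j → u ∈ B j → l ≤ j) → ∀ a → u ∈ W a → l ≤ toℕ a × toℕ a < l + M
      W-bounds u l s mn a t = let x , y , w = W-elim a u t in mn _ y , ≰⇒> λ le → w (before-intro a u l le s)

      W-intro : ∀ u l → u ∈ Q → u ∈ B l → (∀ j → u ∈ B j → l ≤ j) → ∀ a → l ≤ toℕ a → toℕ a < l + M → u ∈ W a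
      W-intro u l uQ s mn a le lt = ∧-intro uQ (∧-intro (ball-≤ G H ⁅ z ⁆ le u s) (not-intro λ t → <⇒≱ lt (before-elim a u l t mn)))

      leastQ : ∀ u → u ∈ Q → ∃[ l ] l ≤ suc r × u ∈ B l × (∀ j → u ∈ B j → l ≤ j)
      leastQ u s = least (suc r) u (∧ʳ (K u) s)

      total-size : ∣∣₂ W ≤ M * ∣ Q ∣
      total-size = begin
        ∣∣₂ W ≡⟨ ∣∣₂-swap W ⟩
        ∣∣₂ (λ u a → W a u) ≤⟨ ∣∣₂-mono (λ u a → W a u) (λ u a → Q u ∧ W a u) (λ u a s → ∧-intro (proj₁ (W-elim a u s)) s) ⟩
        ∣∣₂ (λ u a → Q u ∧ W a u) ≤⟨ ∣∣₂-rows Q (λ u a → W a u) M (λ u s → let l , _ , b , mn = leastQ u s in interval-≤ (λ a → W a u) l M (W-bounds u l b mn)) ⟩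
        M * ∣ Q ∣ ∎

      -- The distances `l` and `l′` of adjacent vertices differ by at most one, so of the `M`
      -- windows around one end at least `m` contain the other.
      pair-count : ∀ u v → m * b2n (Q u ∧ (Q v ∧ adj G u v)) ≤ ∣ (λ a → W a u ∧ (W a v ∧ adj G u v)) ∣
      pair-count u v with Q u ∧ (Q v ∧ adj G u v) in eq
      ... | false = ≤-trans (≤-reflexive (*-zeroʳ m)) z≤n
      ... | true with E-elim G Q u v eq
      ... | uQ , vQ , e with leastQ u uQ | leastQ v vQ
      ... | l , l≤ , lB , lmin | l′ , l′≤ , l′B , l′min = ≤-trans (≤-reflexive (*-identityʳ m))
          (case ≤-total l l′ of λ
            { (inj₁ le) → interval-≥ _ l′ m (+-mono-≤ l′≤ (n≤1+n m)) (λ a p q → both a (≤-trans le p) (<-≤-trans q (shift u v l l′ lB l′min (adj-sym G e) uQ vQ)) p (<-≤-trans q (+-monoʳ-≤ l′ (n≤1+n m))))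
            ; (inj₂ le) → interval-≥ _ l m (+-mono-≤ l≤ (n≤1+n m)) (λ a p q → both a p (<-≤-trans q (+-monoʳ-≤ l (n≤1+n m))) (≤-trans le p) (<-≤-trans q (shift v u l′ l l′B lmin e vQ uQ))) })
        where
        shift : ∀ u v l l′ → u ∈ B l → (∀ j → v ∈ B j → l′ ≤ j) → adj G v u ≡ true → u ∈ Q → v ∈ Q → l′ + m ≤ l + M
        shift u v l l′ s mn e uQ vQ = ≤-trans (+-monoˡ-≤ m (mn (suc l) (ball-step G H ⁅ z ⁆ l u v s (adj-sym G e) (K⊆H v (∧ˡ (K v) vQ))))) (≤-reflexive (≡sym (+-suc l m)))
        both : ∀ a → l ≤ toℕ a → toℕ a < l + M → l′ ≤ toℕ a → toℕ a < l′ + M → W a u ∧ (W a v ∧ adj G u v) ≡ true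
        both a p₁ p₂ p₃ p₄ = E-intro G {W a} (W-intro u l uQ lB lmin a p₁ p₂) (W-intro v l′ vQ l′B l′min a p₃ p₄) e

      total-edges : m * E G Q ≤ sum (λ a → E G (W a))
      total-edges = begin
        m * E G Q ≡⟨ *-distribˡ-sum m (λ u → sum (λ v → b2n (Q u ∧ (Q v ∧ adj G u v)))) ⟩
        sum (λ u → m * sum (λ v → b2n (Q u ∧ (Q v ∧ adj G u v)))) ≡⟨ sum-cong-≗ (λ u → *-distribˡ-sum m (λ v → b2n (Q u ∧ (Q v ∧ adj G u v)))) ⟩
        sum (λ u → sum (λ v → m * b2n (Q u ∧ (Q v ∧ adj G u v)))) ≤⟨ sum-mono _ _ (λ u → sum-mono _ _ (λ v → pair-count u v)) ⟩
        sum (λ u → sum (λ v → sum (λ a → f a u v))) ≡⟨ sum-cong-≗ (λ u → ∑-comm (λ v a → f a u v)) ⟩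
        sum (λ u → sum (λ a → sum (λ v → f a u v))) ≡⟨ ∑-comm (λ u a → sum (λ v → f a u v)) ⟩
        sum (λ a → E G (W a)) ∎
        where
        f : Fin X → Fin n → Fin n → ℕ
        f a u v = b2n (W a u ∧ (W a v ∧ adj G u v))

      dense-Q : p * (h * ∣ Q ∣) ≤ suc h * (q * E G Q)
      dense-Q = begin
        p * (h * ∣ Q ∣) ≤⟨ *-monoʳ-≤ p slow ⟩
        p * (suc h * c r) ≡⟨ x∙yz≈y∙xz p (suc h) (c r) ⟩
        suc h * (p * c r) ≤⟨ *-monoʳ-≤ (suc h) (c-step r) ⟩
        suc h * (q * E G Q) ∎

      average : p′ * (M * ∣ Q ∣) ≤ q * (m * E G Q)
      average = *-cancelˡ-≤ (suc h) (begin
        suc h * (p′ * (M * ∣ Q ∣)) ≡⟨ eq₁ (suc h) p′ M ∣ Q ∣ ⟩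
        p′ * (suc h * M) * ∣ Q ∣ ≤⟨ *-monoˡ-≤ ∣ Q ∣ ratio ⟩
        p * (h * m) * ∣ Q ∣ ≡⟨ eq₂ p h m ∣ Q ∣ ⟩
        m * (p * (h * ∣ Q ∣)) ≤⟨ *-monoʳ-≤ m dense-Q ⟩
        m * (suc h * (q * E G Q)) ≡⟨ eq₃ m (suc h) q (E G Q) ⟩
        suc h * (q * (m * E G Q)) ∎)
        where
        eq₁ : ∀ a b c d → a * (b * (c * d)) ≡ b * (a * c) * d
        eq₁ = solve-∀
        eq₂ : ∀ p h m x → p * (h * m) * x ≡ m * (p * (h * x))
        eq₂ = solve-∀
        eq₃ : ∀ m a q x → m * (a * (q * x)) ≡ a * (q * (m * x))
        eq₃ = solve-∀

      -- The window numbered 0 contains `z`. Being nonempty, it makes the final comparison of sums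
      -- strict.
      a₀ : Fin X
      a₀ = zero

      z∈W : z ∈ W a₀
      z∈W = W-intro z 0 (∧-intro z∈K (z∈B (suc r))) (z∈B 0) (λ _ _ → z≤n) a₀ z≤n z<s

      conclude : Window q p′ K (h * suc L + suc m) m
      conclude with any? (λ a → (1 ≤? ∣ W a ∣) ×-dec (p′ * ∣ W a ∣ ≤? q * E G (W a)))
      ... | yes (a , d) = toℕ a , W a , ≤-trans (<⇒≤ (toℕ<n a)) (+-monoˡ-≤ M r<) ,
          (λ u s → ∧ˡ (K u) (proj₁ (W-elim a u s))) , d , (λ u s → proj₁ (proj₂ (W-elim a u s))) ,
          λ i u le s t → proj₂ (proj₂ (W-elim a u s)) (before-intro a u i le t)
      ... | no none = contradiction average (<⇒≱ (begin-strict
          q * (m * E G Q) ≤⟨ *-monoʳ-≤ q total-edges ⟩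
          q * sum (λ a → E G (W a)) ≡⟨ *-distribˡ-sum q (λ a → E G (W a)) ⟩
          sum (λ a → q * E G (W a)) <⟨ sum-mono-< _ (λ a → p′ * ∣ W a ∣) (λ a → notDense G q p′ (W a) (λ d → none (a , d))) a₀
               (≰⇒> λ le → none (a₀ , ∈⇒∣∣>0 (W a₀) z z∈W , le)) ⟩
          sum (λ a → p′ * ∣ W a ∣) ≡⟨ *-distribˡ-sum p′ (λ a → ∣ W a ∣) ⟨
          p′ * ∣∣₂ W ≤⟨ *-monoʳ-≤ p′ total-size ⟩
          p′ * (M * ∣ Q ∣) ∎))

-- Graphs of large average degree

∣∣₂-split : (f : Fin (suc n) → Fin (suc n) → Bool) → ∣∣₂ f ≡
  (b2n (f zero zero) + ∣ f zero ∘ suc ∣) + (∣ (λ u → f (suc u) zero) ∣ + ∣∣₂ (λ u v → f (suc u) (suc v)))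
∣∣₂-split f = cong (b2n (f zero zero) + ∣ f zero ∘ suc ∣ +_) (∑-distrib-+ (λ u → b2n (f (suc u) zero)) (λ u → ∣ f (suc u) ∘ suc ∣))

-- A new vertex joins the side on which at least half of its edges to the vertices already placed
-- are cut.
maxcut : (f : Fin n → Fin n → Bool) → (∀ u v → f u v ≡ f v u) → (∀ u → f u u ≡ false) →
  Σ (Fin n → Bool) λ σ → ∣∣₂ f ≤ 2 * ∣∣₂ (λ u v → f u v ∧ (σ u xor σ v))
maxcut {zero} f s r = (λ ()) , z≤n
maxcut {suc n} f s r = with-side (≤-total (cross true) (cross false))
  where
  open ≤-Reasoning
  f′ : Fin n → Fin n → Bool
  f′ u v = f (suc u) (suc v)
  IH = maxcut f′ (λ u v → s _ _) (λ u → r _)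
  σ′ = proj₁ IH
  row = f zero ∘ suc
  cross : Bool → ℕ
  cross b = ∣ (λ v → row v ∧ (b xor σ′ v)) ∣
  σ : Bool → Fin (suc n) → Bool
  σ b zero = b
  σ b (suc v) = σ′ v
  row≤ : ∣ row ∣ ≤ cross true + cross false
  row≤ = ∣∣-cover row _ _ λ v p → case-xor v (σ′ v) p
    where
    case-xor : ∀ v c → row v ≡ true → row v ∧ (true xor c) ≡ true ⊎ row v ∧ (false xor c) ≡ true
    case-xor v true p = inj₂ (∧-intro p refl)
    case-xor v false p = inj₁ (∧-intro p refl)
  xor-sym : ∀ b u → f zero (suc u) ∧ (b xor σ′ u) ≡ true → f (suc u) zero ∧ (σ′ u xor b) ≡ true
  xor-sym b u p = let x , y = ∧-elim (row u) _ p in ∧-intro (trans (s _ _) x) (trans (xor-comm (σ′ u) b) y)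
  bound : ∀ b → ∣ row ∣ ≤ 2 * cross b → ∣∣₂ f ≤ 2 * ∣∣₂ (λ u v → f u v ∧ (σ b u xor σ b v))
  bound b le = begin
    ∣∣₂ f ≡⟨ ∣∣₂-split f ⟩
    (b2n (f zero zero) + ∣ row ∣) + (∣ (λ u → f (suc u) zero) ∣ + ∣∣₂ f′) ≡⟨ cong₂ (λ c d → (b2n c + ∣ row ∣) + (d + ∣∣₂ f′)) (r zero) (∣∣-cong (λ u → s (suc u) zero)) ⟩
    ∣ row ∣ + (∣ row ∣ + ∣∣₂ f′) ≤⟨ +-mono-≤ le (+-mono-≤ le (proj₂ IH)) ⟩
    2 * cross b + (2 * cross b + 2 * ∣∣₂ g′) ≡⟨ eq (cross b) (∣∣₂ g′) ⟩
    2 * (cross b + (cross b + ∣∣₂ g′)) ≤⟨ *-monoʳ-≤ 2 (+-mono-≤ (m≤n+m (cross b) (b2n (f zero zero ∧ (b xor b)))) (+-monoˡ-≤ (∣∣₂ g′)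
         (∣∣-mono (λ v → row v ∧ (b xor σ′ v)) (λ v → f (suc v) zero ∧ (σ′ v xor b)) (xor-sym b)))) ⟩
    2 * ((b2n (f zero zero ∧ (b xor b)) + cross b) + (∣ (λ u → f (suc u) zero ∧ (σ′ u xor b)) ∣ + ∣∣₂ g′)) ≡⟨ cong (2 *_) (∣∣₂-split (λ u v → f u v ∧ (σ b u xor σ b v))) ⟨
    2 * ∣∣₂ (λ u v → f u v ∧ (σ b u xor σ b v)) ∎
    where
    g′ : Fin n → Fin n → Bool
    g′ u v = f′ u v ∧ (σ′ u xor σ′ v)
    eq : ∀ a c → 2 * a + (2 * a + 2 * c) ≡ 2 * (a + (a + c))
    eq = solve-∀
  with-side : cross true ≤ cross false ⊎ cross false ≤ cross true → Σ (Fin (suc n) → Bool) λ σ → ∣∣₂ f ≤ 2 * ∣∣₂ (λ u v → f u v ∧ (σ u xor σ v))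
  with-side (inj₁ le) = σ false , bound false (≤-trans row≤ (≤-trans (+-monoˡ-≤ _ le) (≤-reflexive (cong (cross false +_) (≡sym (+-identityʳ _))))))
  with-side (inj₂ le) = σ true , bound true (≤-trans row≤ (≤-trans (+-monoʳ-≤ (cross true) le) (≤-reflexive (cong (cross true +_) (≡sym (+-identityʳ _))))))

cut : Graph n → (Fin n → Bool) → Graph n
cut G σ = record
  { adj = λ u v → adj G u v ∧ (σ u xor σ v)
  ; sym = λ u v → cong₂ _∧_ (sym G u v) (xor-comm (σ u) (σ v))
  ; irref = λ v → cong (_∧ (σ v xor σ v)) (irref G v) }

Bipartite : Graph n → (Fin n → Bool) → Set
Bipartite G σ = ∀ u v → adj G u v ≡ true → σ u ≡ not (σ v)

cut-bipartite : (G : Graph n) (σ : Fin n → Bool) → Bipartite (cut G σ) σ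
cut-bipartite G σ u v p = xor⇒≡not (σ u) (σ v) (∧ʳ (adj G u v) p)
  where
  xor⇒≡not : ∀ a b → a xor b ≡ true → a ≡ not b
  xor⇒≡not true false _ = refl
  xor⇒≡not false true _ = refl

dense-cut : (G : Graph n) (K : VSet n) → Σ (Fin n → Bool) λ σ → E G K ≤ 2 * E (cut G σ) K
dense-cut G K with maxcut (λ u v → K u ∧ (K v ∧ adj G u v))
    (λ u v → trans (∧-rot (K u) (K v) _) (cong (λ c → K v ∧ (K u ∧ c)) (sym G u v)))
    (λ u → trans (cong (λ c → K u ∧ (K u ∧ c)) (irref G u)) (∧-false (K u)))
  where
  ∧-rot : ∀ a b c → a ∧ (b ∧ c) ≡ b ∧ (a ∧ c)
  ∧-rot true true c = refl
  ∧-rot true false c = refl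
  ∧-rot false true c = refl
  ∧-rot false false c = refl
  ∧-false : ∀ a → a ∧ (a ∧ false) ≡ false
  ∧-false true = refl
  ∧-false false = refl
... | σ , le = σ , ≤-trans le (*-monoʳ-≤ 2 (∣∣₂-mono _ _ λ u v p →
    let x , y = ∧-elim (K u ∧ (K v ∧ adj G u v)) _ p ; a , b , c = E-elim G K u v x in E-intro (cut G σ) {K} a b (∧-intro c y)))

walk-map : ∀ {G G′ : Graph n} {A u i v} → (∀ u v → adj G u v ≡ true → adj G′ u v ≡ true) → Walk G A u i v → Walk G′ A u i v
walk-map f stop = stop
walk-map f (go e p w) = go (f _ _ e) p (walk-map f w)

linkage-map : ∀ {G G′ : Graph n} {t ℓ ℓ′} → (∀ u v → adj G u v ≡ true → adj G′ u v ≡ true) → ℓ ≤ ℓ′ → Linkage G t ℓ → Linkage G′ t ℓ′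
linkage-map {G′ = G′} f le Λ = record { b = b ; Q = Q ; b-inj = b-inj ; avoid = avoid ; disj = disj
  ; path = λ i j p → walk-≤ G′ le (walk-map f (path i j p)) }
  where open Linkage Λ

takeWeb : ∀ {G : Graph n} {K H W R k k′} → k′ ≤ k → Web G K H W R k → Web G K H W R k′
takeWeb le w = record { S = λ c → S (inject≤ c le) ; S-disj = λ c d x p q → inject≤-injective le le c d (S-disj _ _ x p q)
  ; S-out = λ c → S-out _ ; centre = λ c → centre _ ; near = λ c → near _ }
  where open Web w

dense-weaken : (G : Graph n) (q : ℕ) (A : VSet n) {p p′ : ℕ} → p′ ≤ p → Dense G q p A → Dense G q p′ A
dense-weaken G q A le (o , d) = o , ≤-trans (*-monoˡ-≤ ∣ A ∣ le) d

alternate : Bool → ℕ → Bool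
alternate s zero = s
alternate s (suc i) = not (alternate s i)

module _ (G : Graph n) (σ : Fin n → Bool) (bip : Bipartite G σ) (L : ℕ) (n<2^L+1 : n < 2 ^ suc L) where

  side : Bool → VSet n
  side s x = ⌊ σ x ≟ᵇ s ⌋

  private
    R : ℕ
    R = 1 * suc L + 2

    layer-side : ∀ H z i x → x ∈ ball G H ⁅ z ⁆ i → (∀ j → j < i → x ∉ ball G H ⁅ z ⁆ j) → σ x ≡ alternate (σ z) i
    layer-side H z zero x p h = cong σ (≡sym (∈⁅⁆-elim z x p))
    layer-side H z (suc i) x p h with ball-elim G H ⁅ z ⁆ i x p
    ... | inj₁ q = contradiction q (h i ≤-refl)
    ... | inj₂ (a , y , q , e) = trans (bip x y (adj-sym G e)) (cong not (layer-side H z i y q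
        λ j lt r → h (suc j) (s≤s lt) (ball-step G H ⁅ z ⁆ j y x r e a)))

    -- In a bipartite graph the neighbours of `z` are pairwise non-adjacent, so the ball of radius 1
    -- spans a star. This excludes windows too close to the centre to leave room for a hub.
    star-sparse : ∀ H z W → W ⊆ ball G H ⁅ z ⁆ 1 → E G W ≤ 2 * ∣ W ∣
    star-sparse H z W s = begin
      E G W ≤⟨ ∣∣₂-cover _ (λ u v → ⌊ z ≟ u ⌋ ∧ W v) (λ u v → ⌊ z ≟ v ⌋ ∧ W u) f ⟩
      ∣∣₂ (λ u v → ⌊ z ≟ u ⌋ ∧ W v) + ∣∣₂ (λ u v → ⌊ z ≟ v ⌋ ∧ W u) ≤⟨ +-mono-≤ (∣∣₂-row z W) (≤-trans (≤-reflexive (∣∣₂-swap (λ u v → ⌊ z ≟ v ⌋ ∧ W u))) (∣∣₂-row z W)) ⟩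
      ∣ W ∣ + ∣ W ∣ ≡⟨ cong (∣ W ∣ +_) (≡sym (+-identityʳ _)) ⟩
      2 * ∣ W ∣ ∎
      where
      open ≤-Reasoning
      away : ∀ x → x ∈ W → z ≢ x → σ x ≡ not (σ z)
      away x p ne = layer-side H z 1 x (s x p) λ { zero _ q → ne (∈⁅⁆-elim z x q) ; (suc j) (s≤s ()) }
      f : ∀ u v → W u ∧ (W v ∧ adj G u v) ≡ true → _
      f u v p with E-elim G W u v p
      ... | a , b , e with z ≟ u | z ≟ v
      ... | yes refl | _ = inj₁ (∧-intro {⌊ z ≟ z ⌋} (⌊⌋-intro refl) b)
      ... | no _ | yes refl = inj₂ (∧-intro {⌊ z ≟ z ⌋} (⌊⌋-intro refl) a)
      ... | no x | no y = contradiction (bip u v e) (not-¬ (trans (away u a x) (≡sym (away v b y))))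

  Built : ℕ → ℕ → Set
  Built T c = ∃[ s ] ∃[ K′ ] Dense G 1 c K′ × Web G (K′ ∩ side s) K′ 0 R T

  -- Here `x` and `y` count the hubs obtained for the two sides, `a` and `b` those still wanted. A
  -- round serves the side of the inner layer of its window and, as `h = m = 1`, costs a factor 4 of
  -- the density. Which side is served cannot be chosen, so the rounds go on until one of them has
  -- its `T` hubs.
  build : ∀ T c → 3 ≤ c → ∀ a b x y K → Dense G 1 (4 ^ (a + b) * c) K →
    Web G (K ∩ side true) K 0 R x → Web G (K ∩ side false) K 0 R y → T ≤ x + a → T ≤ y + b →
    Built T c
  build T c 3≤c zero b x y K d w₁ w₂ l₁ l₂ = true , K , dense-weaken G 1 K (m≤n*m c (4 ^ b) {{>-nonZero (m^n>0 4 b)}}) d ,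
    takeWeb (≤-trans l₁ (≤-reflexive (+-identityʳ x))) w₁
  build T c 3≤c (suc a) zero x y K d w₁ w₂ l₁ l₂ = false , K , dense-weaken G 1 K (m≤n*m c (4 ^ (suc a + 0)) {{>-nonZero (m^n>0 4 (suc a + 0))}}) d ,
    takeWeb (≤-trans l₂ (≤-reflexive (+-identityʳ y))) w₂
  build T c 3≤c (suc a) (suc b) x y K d w₁ w₂ l₁ l₂ with shrink G 1 (4 ^ (suc a + suc b) * c) n K (∣∣≤n K) d
  ... | K₀ , K₀⊆K , md with ∣∣>0⇒∈ K₀ (proj₁ (MinDense.dense md))
  ... | z , z∈ = advance (Layers.window G K₀ z md (λ _ r → r) z∈ 1 L 1 p′ (s≤s z≤n) n<2^L+1 (≤-reflexive (eq p′₀ c)))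
    where
    p′₀ = 4 ^ (a + suc b)
    p′ = p′₀ * c
    eq : ∀ a c → a * c * (2 * 2) ≡ 4 * a * c * (1 * 1)
    eq = solve-∀
    B = ball G K₀ ⁅ z ⁆
    advance : Layers.Window G K₀ z 1 p′ K₀ R 1 → Built T c
    advance (i , W , i≤R , W⊆ , dW , W⊆B , out) with i <? 2
    ... | yes (s≤s lt) = contradiction (begin-strict
        E G W ≤⟨ star-sparse K₀ z W (λ x r → ball-≤ G K₀ ⁅ z ⁆ lt x (W⊆B x r)) ⟩
        2 * ∣ W ∣ <⟨ *-monoˡ-< ∣ W ∣ {{>-nonZero (proj₁ dW)}} 3≤c ⟩
        c * ∣ W ∣ ≤⟨ *-monoˡ-≤ ∣ W ∣ (m≤n*m c p′₀ {{>-nonZero (m^n>0 4 (a + suc b))}}) ⟩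
        p′ * ∣ W ∣ ≤⟨ proj₂ dW ⟩
        1 * E G W ≡⟨ *-identityˡ _ ⟩
        E G W ∎) (<-irrefl refl)
      where open ≤-Reasoning
    advance (zero , _) | no ge = contradiction z<s ge
    advance (suc zero , _) | no ge = contradiction (s≤s (s≤s z≤n)) ge
    advance (suc (suc i) , W , i≤R , W⊆ , dW , W⊆B , out) | no _ = recurse (alternate (σ z) (suc i)) refl
      where
      S₀ = B i
      outW : ∀ x → x ∈ S₀ → x ∉ W
      outW x p q = out i x (≤-reflexive (+-comm i 2)) q p
      -- A window vertex on this side lies in layer `i + 1`, since layer `i + 2` is on the other
      -- side; so it has a neighbour in `B i`.
      near₀ : ∀ u → u ∈ W → σ u ≡ alternate (σ z) (suc i) → ∃[ y ] y ∈ S₀ × adj G u y ≡ true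
      near₀ u p su with u ∈? B (suc i)
      ... | no q = contradiction (layer-side K₀ z (suc (suc i)) u (W⊆B u p) λ j lt r →
              q (ball-≤ G K₀ ⁅ z ⁆ (s≤s⁻¹ lt) u r)) (not-¬ su)
      ... | yes q with ball-elim G K₀ ⁅ z ⁆ i u q
      ... | inj₁ r = contradiction p (outW u r)
      ... | inj₂ (_ , y , r , e) = y , r , adj-sym G e
      W⊆K : W ⊆ K
      W⊆K x r = K₀⊆K x (W⊆ x r)
      ∩-mono : ∀ {s} → W ∩ side s ⊆ K ∩ side s
      ∩-mono {s} x r = let g , h = ∧-elim (W x) _ r in ∧-intro (W⊆K x g) h
      still : ∀ {A : VSet n} u x → u ∈ A → Walk G K u 0 x → Walk G W u 0 x
      still u x _ stop = stop
      extend : ∀ {s k} → alternate (σ z) (suc i) ≡ s → Web G (K ∩ side s) K 0 R k → Web G (W ∩ side s) W 0 R (suc k)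
      extend {s} eq′ w = extendWeb G ∩-mono W⊆K (still {W ∩ side s}) w z S₀
        (λ x r → K₀⊆K x (ball⊆ G (λ _ r → r) (λ x r → subst (_∈ K₀) (∈⁅⁆-elim z x r) z∈) i x r)) outW
        (Layers.z∈B G K₀ z i)
        (λ x r → walk-≤ G (≤-trans (≤-trans (n≤1+n i) (n≤1+n _)) i≤R) (Layers.radius G K₀ z i x r))
        (λ u r → let g , h = ∧-elim (W u) _ r ; y′ , f , e = near₀ u g (trans (⌊⌋-elim (σ u ≟ᵇ s) h) (≡sym eq′)) in u , y′ , stop , f , e)
      restrict : ∀ {s k} → Web G (K ∩ side s) K 0 R k → Web G (W ∩ side s) W 0 R k
      restrict {s} = restrictWeb G ∩-mono W⊆K (still {W ∩ side s})
      recurse : ∀ s → alternate (σ z) (suc i) ≡ s → Built T c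
      recurse true eq′ = build T c 3≤c a (suc b) (suc x) y W dW (extend eq′ w₁) (restrict w₂) (≤-trans l₁ (≤-reflexive (+-suc x a))) l₂
      recurse false eq′ = build T c 3≤c (suc a) b x (suc y) W (subst (λ k → Dense G 1 (4 ^ k * c) W) (+-suc a b) dW) (restrict w₁) (extend eq′ w₂) l₁ (≤-trans l₂ (≤-reflexive (+-suc y b)))

  -- The branch vertices are `t` neighbours of one vertex on the side opposite to `s`. They are
  -- adjacent to all hubs themselves, so legs of length 0 suffice.
  bipartite-linkage : ∀ t K → Dense G 1 (4 ^ (t * t + t * t) * (3 + (t + t))) K → Linkage G t (2 + (R + R) + 1)
  bipartite-linkage t K d with build (t * t) (3 + (t + t)) (s≤s (s≤s (s≤s z≤n))) (t * t) (t * t) 0 0 K d (emptyWeb G) (emptyWeb G) ≤-refl ≤-refl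
  ... | s , K₁ , d₁ , w₁ with shrink G 1 (3 + (t + t)) n K₁ (∣∣≤n K₁) d₁
  ... | K₂ , K₂⊆K₁ , md with ∣∣>0⇒∈ K₂ (proj₁ (MinDense.dense md))
  ... | z , z∈ = legs⇒linkage G w₂ legs
    where
    w₂ : Web G (K₂ ∩ side s) K₂ 0 R (t * t)
    w₂ = restrictWeb G (λ x r → let g , h = ∧-elim (K₂ x) _ r in ∧-intro (K₂⊆K₁ x g) h) K₂⊆K₁ (λ { u x _ stop → stop }) w₁
    deg≥ : ∀ v → v ∈ K₂ → suc t ≤ deg G K₂ v
    deg≥ v p = ≮⇒≥ λ lt → contradiction (deg-lower G md v p) (<⇒≱ (begin-strict
        1 * (deg G K₂ v + deg G K₂ v) ≡⟨ *-identityˡ _ ⟩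
        deg G K₂ v + deg G K₂ v ≤⟨ +-mono-≤ (s≤s⁻¹ lt) (s≤s⁻¹ lt) ⟩
        t + t <⟨ m<n+m (t + t) {3} z<s ⟩
        3 + (t + t) ∎))
      where open ≤-Reasoning
    opposite : ∃[ u ] u ∈ K₂ × σ u ≡ not s
    opposite with σ z ≟ᵇ s
    ... | no ne = z , z∈ , ¬-not ne
    ... | yes eq with ∣∣>0⇒∈ (λ w → K₂ w ∧ adj G z w) (≤-trans (s≤s z≤n) (deg≥ z z∈))
    ... | w , p = let a , e = ∧-elim (K₂ w) _ p in w , a , trans (bip w z (adj-sym G e)) (cong not eq)
    u = proj₁ opposite
    N : VSet n
    N w = K₂ w ∧ adj G u w
    chosen = choose N t (≤-trans (n≤1+n t) (deg≥ u (proj₁ (proj₂ opposite))))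
    v = proj₁ chosen
    v∈K₂ : ∀ i → v i ∈ K₂
    v∈K₂ i = ∧ˡ (K₂ (v i)) (proj₁ (proj₂ chosen) i)
    not-not : ∀ a b → not a ≡ not b → a ≡ b
    not-not true true _ = refl
    not-not false false _ = refl
    v∈side : ∀ i → v i ∈ side s
    v∈side i = ⌊⌋-intro (not-not _ _ (trans (≡sym (bip u (v i) (∧ʳ (K₂ (v i)) (proj₁ (proj₂ chosen) i)))) (proj₂ (proj₂ opposite))))
    open Web w₂
    legs : Legs G w₂ v 0
    legs = record { v∈H = v∈K₂ ; v-inj = proj₂ (proj₂ chosen) ; P = λ _ _ _ → false ; P⊆H = λ _ _ _ () ; v∉P = λ _ _ _ ()
                  ; P-disj = λ _ _ _ _ _ () ; reach = λ i j c _ → at i (near c (v i) (∧-intro (v∈K₂ i) (v∈side i))) }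
      where
      at : ∀ i {c} → ∃[ x ] ∃[ y ] Walk G K₂ (v i) 0 x × y ∈ S c × adj G x y ≡ true →
        ∃[ x ] ∃[ y ] Walk G (λ _ → false) (v i) 0 x × y ∈ S c × adj G x y ≡ true
      at i (x , y , stop , p , e) = x , y , stop , p , e

opaque
  -- The leading 2 pays for passing to a cut, the power of 4 for `2 t ^ 2` rounds, and `3 + 2 t`
  -- leaves minimum degree above `t`.
  cliqueDensity : ℕ → ℕ
  cliqueDensity t = 2 * (4 ^ (t * t + t * t) * (3 + (t + t)))

cliqueLength : ℕ → ℕ
cliqueLength L = 2 + ((1 * suc L + 2) + (1 * suc L + 2)) + 1

opaque
  unfolding cliqueDensity

  dense⇒linkage : (G : Graph n) (L : ℕ) → n < 2 ^ suc L → ∀ t K → Dense G 1 (cliqueDensity t) K → Linkage G t (cliqueLength L)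
  dense⇒linkage G L lt t K (o , d) with dense-cut G K
  ... | σ , le = linkage-map (λ u v p → ∧ˡ (adj G u v) p) ≤-refl
      (bipartite-linkage (cut G σ) σ (cut-bipartite G σ) L lt t K (o , *-cancelˡ-≤ 2 (begin
        2 * (D * ∣ K ∣) ≡⟨ *-assoc 2 D ∣ K ∣ ⟨
        2 * D * ∣ K ∣ ≤⟨ d ⟩
        1 * E G K ≡⟨ *-identityˡ _ ⟩
        E G K ≤⟨ le ⟩
        2 * E (cut G σ) K ≡⟨ cong (2 *_) (*-identityˡ (E (cut G σ) K)) ⟨
        2 * (1 * E (cut G σ) K) ∎)))
    where
    open ≤-Reasoning
    D : ℕ
    D = 4 ^ (t * t + t * t) * (3 + (t + t))

  cliqueDensity>0 : ∀ t → 1 ≤ cliqueDensity t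
  cliqueDensity>0 t = ≤-trans (s≤s z≤n) (*-mono-≤ {1} {2} (s≤s z≤n) (*-mono-≤ (m^n>0 4 (t * t + t * t)) (m≤m+n 1 (2 + (t + t)))))

-- Vertices of large degree

∣∣₂-disjoint : (f g h : Fin n → Fin n → Bool) → (∀ u v → f u v ≡ true → g u v ≡ true → ⊥) →
  (∀ u v → f u v ≡ true → h u v ≡ true) → (∀ u v → g u v ≡ true → h u v ≡ true) → ∣∣₂ f + ∣∣₂ g ≤ ∣∣₂ h
∣∣₂-disjoint f g h d p q = ≤-trans (≤-reflexive (≡sym (∑-distrib-+ (λ u → ∣ f u ∣) (λ u → ∣ g u ∣))))
  (sum-mono _ _ λ u → ∣∣-disjoint (f u) (g u) (h u) (d u) (p u) (q u))

∣∣₂>0 : (f : Fin n → Fin n → Bool) → ∀ u v → f u v ≡ true → 1 ≤ ∣∣₂ f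
∣∣₂>0 f u v p = ≤-trans (∈⇒∣∣>0 (f u) v p) (term≤sum (λ u → ∣ f u ∣) u)

full : VSet n
full _ = true

linkage-≤ : ∀ {G : Graph n} {t ℓ ℓ′} → ℓ ≤ ℓ′ → Linkage G t ℓ → Linkage G t ℓ′
linkage-≤ = linkage-map (λ _ _ e → e)

walk-last : (G : Graph n) → ∀ {A u i v} → Walk G A u i v → u ≢ v → ∃[ y ] adj G y v ≡ true
walk-last G stop ne = contradiction refl ne
walk-last G (go {w = w} {v = v} e p wk) ne with w ≟ v
... | yes refl = _ , e
... | no ne′ = walk-last G wk ne′

walk-first : (G : Graph n) → ∀ {A u i v} → Walk G A u i v → u ≢ v → ∃[ y ] adj G u y ≡ true
walk-first G stop ne = contradiction refl ne
walk-first G (go e p wk) ne = _ , e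

module _ (G : Graph n) (X : VSet n) where

  -- The edge u v of P stands for the path u, mid u v, v of G.
  record Subdivided : Set where
    field
      P : Graph n
      mid : Fin n → Fin n → Fin n
      mid-sym : ∀ u v → mid u v ≡ mid v u
      end∈X : ∀ u v → adj P u v ≡ true → u ∈ X
      mid∉X : ∀ u v → adj P u v ≡ true → mid u v ∉ X
      mid-adj : ∀ u v → adj P u v ≡ true → adj G u (mid u v) ≡ true
      mid-inj : ∀ u v u′ v′ → adj P u v ≡ true → adj P u′ v′ ≡ true → mid u v ≡ mid u′ v′ →
        (u ≡ u′ × v ≡ v′) ⊎ (u ≡ v′ × v ≡ u′)

  module _ (Sub : Subdivided) where
    open Subdivided Sub

    module _ {t ℓ : ℕ} (Λ : Linkage P (2 + t) ℓ) where
      open Linkage Λ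

      private
        other : ∀ {t} (k : Fin (2 + t)) → ∃[ j ] k <F j ⊎ ∃[ j ] j <F k
        other zero = inj₁ (suc zero , s≤s z≤n)
        other (suc k) = inj₂ (zero , s≤s z≤n)

        -- With at least two branch vertices, each of them is the end of a path and so has an edge
        -- of `P`, whose ends lie in `X`.
        b∈X : ∀ k → b k ∈ X
        b∈X zero = let y , e = walk-first P (path zero (suc zero) (s≤s z≤n)) (λ eq → case b-inj _ _ eq of λ ()) in end∈X _ _ e
        b∈X (suc k) = let y , e = walk-last P (path zero (suc k) (s≤s z≤n)) (λ eq → case b-inj _ _ eq of λ ()) in end∈X _ y (adj-sym P e)

        R : Fin (2 + t) → Fin (2 + t) → VSet n
        R i j = Q i j ∪ (⁅ b i ⁆ ∪ ⁅ b j ⁆)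

        mids : Fin (2 + t) → Fin (2 + t) → VSet n
        mids i j x = some λ u → some λ v → R i j u ∧ (R i j v ∧ (adj P u v ∧ ⌊ mid u v ≟ x ⌋))

        mids-intro : ∀ i j u v → u ∈ R i j → v ∈ R i j → adj P u v ≡ true → mid u v ∈ mids i j
        mids-intro i j u v p q e = some-intro _ u (some-intro _ v (∧-intro p (∧-intro q (∧-intro e (⌊⌋-intro refl)))))

        mids-elim : ∀ i j x → x ∈ mids i j → ∃[ u ] ∃[ v ] u ∈ R i j × v ∈ R i j × adj P u v ≡ true × mid u v ≡ x
        mids-elim i j x p with some-elim _ p
        ... | u , q with some-elim _ q
        ... | v , r with ∧-elim (R i j u) _ r
        ... | a , r₁ with ∧-elim (R i j v) _ r₁
        ... | c , r₂ with ∧-elim (adj P u v) _ r₂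
        ... | e , m = u , v , a , c , e , ⌊⌋-elim (mid u v ≟ x) m

        Q′ : Fin (2 + t) → Fin (2 + t) → VSet n
        Q′ i j = (X ∩ Q i j) ∪ mids i j

        R-elim : ∀ i j w → w ∈ R i j → w ∈ Q i j ⊎ ∃[ k ] w ≡ b k × (k ≡ i ⊎ k ≡ j)
        R-elim i j w p with ∨-elim (Q i j w) _ p
        ... | inj₁ q = inj₁ q
        ... | inj₂ q with ∨-elim (⁅ b i ⁆ w) _ q
        ... | inj₁ r = inj₂ (i , ≡sym (∈⁅⁆-elim (b i) w r) , inj₁ refl)
        ... | inj₂ r = inj₂ (j , ≡sym (∈⁅⁆-elim (b j) w r) , inj₂ refl)

        R-meet : ∀ i j i′ j′ w → i <F j → i′ <F j′ → w ∈ R i j → w ∈ R i′ j′ →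
          (i ≡ i′ × j ≡ j′) ⊎ ∃[ k ] w ≡ b k × (k ≡ i ⊎ k ≡ j) × (k ≡ i′ ⊎ k ≡ j′)
        R-meet i j i′ j′ w p p′ q q′ with R-elim i j w q | R-elim i′ j′ w q′
        ... | inj₁ r | inj₁ r′ = inj₁ (disj i j i′ j′ w p p′ r r′)
        ... | inj₁ r | inj₂ (k , refl , _) = contradiction r (avoid i j k p)
        ... | inj₂ (k , refl , _) | inj₁ r′ = contradiction r′ (avoid i′ j′ k p′)
        ... | inj₂ (k , refl , s) | inj₂ (k′ , eq , s′) with b-inj k k′ eq
        ... | refl = inj₂ (k , refl , s , s′)

        two-ends : ∀ {i j i′ j′ k l : Fin (2 + t)} → i <F j → i′ <F j′ → k ≢ l → (k ≡ i ⊎ k ≡ j) → (k ≡ i′ ⊎ k ≡ j′) →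
          (l ≡ i ⊎ l ≡ j) → (l ≡ i′ ⊎ l ≡ j′) → i ≡ i′ × j ≡ j′
        two-ends p p′ ne (inj₁ refl) (inj₁ refl) (inj₂ refl) (inj₂ refl) = refl , refl
        two-ends p p′ ne (inj₂ refl) (inj₂ refl) (inj₁ refl) (inj₁ refl) = refl , refl
        two-ends p p′ ne (inj₁ refl) (inj₂ refl) (inj₂ refl) (inj₁ refl) = ⊥-elim (<-asym p p′)
        two-ends p p′ ne (inj₂ refl) (inj₁ refl) (inj₁ refl) (inj₂ refl) = ⊥-elim (<-asym p p′)
        two-ends p p′ ne (inj₁ refl) _ (inj₁ refl) _ = contradiction refl ne
        two-ends p p′ ne (inj₂ refl) _ (inj₂ refl) _ = contradiction refl ne
        two-ends p p′ ne _ (inj₁ refl) _ (inj₁ refl) = contradiction refl ne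
        two-ends p p′ ne _ (inj₂ refl) _ (inj₂ refl) = contradiction refl ne

        mid∉Q : ∀ i j i′ j′ x → x ∈ X ∩ Q i j → x ∉ mids i′ j′
        mid∉Q i j i′ j′ x p q = let u , v , _ , _ , e , eq = mids-elim i′ j′ x q in
          mid∉X u v e (subst (_∈ X) (≡sym eq) (∧ˡ (X x) p))

        -- A midpoint determines its edge, so both ends of that edge belong to `R i j` and to
        -- `R i′ j′`. An end interior to a path fixes the pair of indices; otherwise the ends are
        -- two distinct branch vertices, which fix it together.
        mids-disj : ∀ i j i′ j′ x → i <F j → i′ <F j′ → x ∈ mids i j → x ∈ mids i′ j′ → i ≡ i′ × j ≡ j′
        mids-disj i j i′ j′ x p p′ r r′ = meet (mid-inj u v u′ v′ e e′ (trans eq (≡sym eq′)))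
          where
          found = mids-elim i j x r
          u = proj₁ found
          v = proj₁ (proj₂ found)
          uR = proj₁ (proj₂ (proj₂ found))
          vR = proj₁ (proj₂ (proj₂ (proj₂ found)))
          e = proj₁ (proj₂ (proj₂ (proj₂ (proj₂ found))))
          eq = proj₂ (proj₂ (proj₂ (proj₂ (proj₂ found))))
          found′ = mids-elim i′ j′ x r′
          u′ = proj₁ found′
          v′ = proj₁ (proj₂ found′)
          e′ = proj₁ (proj₂ (proj₂ (proj₂ (proj₂ found′))))
          eq′ = proj₂ (proj₂ (proj₂ (proj₂ (proj₂ found′))))
          same : u ∈ R i′ j′ → v ∈ R i′ j′ → i ≡ i′ × j ≡ j′
          same a c with R-meet i j i′ j′ u p p′ uR a | R-meet i j i′ j′ v p p′ vR c
          ... | inj₁ z | _ = z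
          ... | inj₂ _ | inj₁ z = z
          ... | inj₂ (k , eqk , s , s′) | inj₂ (l , eql , z , z′) = two-ends p p′
            (λ k≡l → adj-irr P (subst (λ w → adj P u w ≡ true) (trans eql (trans (cong b (≡sym k≡l)) (≡sym eqk))) e)) s s′ z z′
          meet : (u ≡ u′ × v ≡ v′) ⊎ (u ≡ v′ × v ≡ u′) → i ≡ i′ × j ≡ j′
          meet (inj₁ (f , g)) = same (subst (_∈ R i′ j′) (≡sym f) (proj₁ (proj₂ (proj₂ found′)))) (subst (_∈ R i′ j′) (≡sym g) (proj₁ (proj₂ (proj₂ (proj₂ found′)))))
          meet (inj₂ (f , g)) = same (subst (_∈ R i′ j′) (≡sym f) (proj₁ (proj₂ (proj₂ (proj₂ found′))))) (subst (_∈ R i′ j′) (≡sym g) (proj₁ (proj₂ (proj₂ found′))))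

        disj′ : ∀ i j i′ j′ x → i <F j → i′ <F j′ → x ∈ Q′ i j → x ∈ Q′ i′ j′ → i ≡ i′ × j ≡ j′
        disj′ i j i′ j′ x p p′ q q′ with ∨-elim ((X ∩ Q i j) x) _ q | ∨-elim ((X ∩ Q i′ j′) x) _ q′
        ... | inj₁ r | inj₁ r′ = disj i j i′ j′ x p p′ (∧ʳ (X x) r) (∧ʳ (X x) r′)
        ... | inj₁ r | inj₂ r′ = contradiction r′ (mid∉Q i j i′ j′ x r)
        ... | inj₂ r | inj₁ r′ = contradiction r (mid∉Q i′ j′ i j x r′)
        ... | inj₂ r | inj₂ r′ = mids-disj i j i′ j′ x p p′ r r′

        path′ : ∀ i j {u k} → u ∈ R i j → Walk P (Q i j ∪ ⁅ b j ⁆) u k (b j) → Walk G (Q′ i j ∪ ⁅ b j ⁆) u (k * 2) (b j)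
        path′ i j p stop = stop
        path′ i j {u} p (go {w = w} e q wk) = go (mid-adj u w e) (∨-introˡ _ (∨-introʳ ((X ∩ Q i j) (mid u w)) (mids-intro i j u w p w∈R e)))
          (go (adj-sym G (subst (λ m → adj G w m ≡ true) (mid-sym w u) (mid-adj w u (adj-sym P e)))) w∈Q′ (path′ i j w∈R wk))
          where
          w∈X : w ∈ X
          w∈X = end∈X w u (adj-sym P e)
          w∈R : w ∈ R i j
          w∈R with ∨-elim (Q i j w) _ q
          ... | inj₁ r = ∨-introˡ _ r
          ... | inj₂ r = ∨-introʳ (Q i j w) (∨-introʳ (⁅ b i ⁆ w) r)
          w∈Q′ : w ∈ Q′ i j ∪ ⁅ b j ⁆
          w∈Q′ with ∨-elim (Q i j w) _ q
          ... | inj₁ r = ∨-introˡ _ (∨-introˡ _ (∧-intro w∈X r))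
          ... | inj₂ r = ∨-introʳ (Q′ i j w) r

      unsubdivide : Linkage G (2 + t) (ℓ * 2)
      unsubdivide = record { b = b ; Q = Q′ ; b-inj = b-inj ; disj = disj′
        ; avoid = λ i j k p q → [ (λ r → avoid i j k p (∧ʳ (X (b k)) r))
                                , (λ r → let u , v , _ , _ , e , eq = mids-elim i j (b k) r in mid∉X u v e (subst (_∈ X) (≡sym eq) (b∈X k))) ]′
                                (∨-elim ((X ∩ Q i j) (b k)) _ q)
        ; path = λ i j p → path′ i j (∨-introʳ (Q i j (b i)) (∨-introˡ _ (∈⁅⁆ (b i)))) (path i j p) }

  module Greedy (t : ℕ) where

    neighbours : Fin n → VSet n
    neighbours y x = X x ∧ adj G y x

    -- The situation after `c` assignments. All midpoints so far are in `used`, so a fresh `y` keeps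
    -- midpoints distinct; each edge of `P` counts twice in `E`.
    record State (used : VSet n) (c : ℕ) : Set where
      field
        sub : Subdivided
      open Subdivided sub public
      field
        mid-used : ∀ u v → adj P u v ≡ true → mid u v ∈ used
        count-edges : c + c ≤ E P X

    initial : Fin n → State (λ _ → false) 0
    initial y = record { sub = record
        { P = record { adj = λ _ _ → false ; sym = λ _ _ → refl ; irref = λ _ → refl }
        ; mid = λ _ _ → y ; mid-sym = λ _ _ → refl ; end∈X = λ _ _ () ; mid∉X = λ _ _ () ; mid-adj = λ _ _ () ; mid-inj = λ _ _ _ _ () }
      ; mid-used = λ _ _ () ; count-edges = z≤n }

    add : ∀ {used c} (s : State used c) y → y ∉ used → y ∉ X → ∀ a b → a ∈ neighbours y → b ∈ neighbours y → a ≢ b →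
      ¬ adj (State.P s) a b ≡ true → State (used ∪ ⁅ y ⁆) (suc c)
    add {used} {c} s y y∉used y∉X a b aN bN a≢b a≁b = record
      { sub = record
        { P = record { adj = λ u v → adj P u v ∨ new u v ; sym = λ u v → cong₂ _∨_ (sym P u v) (new-sym u v)
                     ; irref = λ v → ¬-not λ p → [ adj-irr P , new-irr v ]′ (∨-elim (adj P v v) _ p) }
        ; mid = mid⁺
        ; mid-sym = λ u v → cong₂ (λ c d → if c then y else d) (new-sym u v) (mid-sym u v)
        ; end∈X = λ u v p → case old-or-new u v p of λ
            { (inj₁ (q , e , _)) → end∈X u v e
            ; (inj₂ (q , r)) → case q of λ { (inj₁ (refl , _)) → ∧ˡ (X a) aN ; (inj₂ (refl , _)) → ∧ˡ (X b) bN } }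
        ; mid∉X = λ u v p → case old-or-new u v p of λ
            { (inj₁ (q , e , _)) → subst (_∉ X) (≡sym q) (mid∉X u v e)
            ; (inj₂ (q , r)) → subst (_∉ X) (≡sym r) y∉X }
        ; mid-adj = λ u v p → case old-or-new u v p of λ
            { (inj₁ (q , e , _)) → subst (λ m → adj G u m ≡ true) (≡sym q) (mid-adj u v e)
            ; (inj₂ (q , r)) → subst (λ m → adj G u m ≡ true) (≡sym r) (case q of λ
                { (inj₁ (refl , _)) → adj-sym G (∧ʳ (X a) aN) ; (inj₂ (refl , _)) → adj-sym G (∧ʳ (X b) bN) }) }
        ; mid-inj = inj }
      ; mid-used = λ u v p → case old-or-new u v p of λ
            { (inj₁ (q , e , _)) → ∨-introˡ _ (subst (_∈ used) (≡sym q) (mid-used u v e))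
            ; (inj₂ (q , r)) → ∨-introʳ (used (mid⁺ u v)) (subst (_∈ ⁅ y ⁆) (≡sym r) (∈⁅⁆ y)) }
      ; count-edges = edge-count }
      where
      open State s
      is : Fin n → Fin n → Fin n → Fin n → Bool
      is a b u v = ⌊ a ≟ u ⌋ ∧ ⌊ b ≟ v ⌋
      new : Fin n → Fin n → Bool
      new u v = is a b u v ∨ is b a u v
      new-sym : ∀ u v → new u v ≡ new v u
      new-sym u v = trans (∨-comm (is a b u v) (is b a u v)) (cong₂ _∨_ (∧-comm ⌊ b ≟ u ⌋ ⌊ a ≟ v ⌋) (∧-comm ⌊ a ≟ u ⌋ ⌊ b ≟ v ⌋))
      is-elim : ∀ a b u v → is a b u v ≡ true → a ≡ u × b ≡ v
      is-elim a b u v p = let x , z = ∧-elim ⌊ a ≟ u ⌋ _ p in ⌊⌋-elim (a ≟ u) x , ⌊⌋-elim (b ≟ v) z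
      new-elim : ∀ u v → new u v ≡ true → (a ≡ u × b ≡ v) ⊎ (b ≡ u × a ≡ v)
      new-elim u v p = [ (λ q → inj₁ (is-elim a b u v q)) , (λ q → inj₂ (is-elim b a u v q)) ]′ (∨-elim (is a b u v) _ p)
      new-irr : ∀ v → ¬ new v v ≡ true
      new-irr v p = case new-elim v v p of λ { (inj₁ (refl , q)) → a≢b (≡sym q) ; (inj₂ (refl , q)) → a≢b q }
      mid⁺ : Fin n → Fin n → Fin n
      mid⁺ u v = if new u v then y else mid u v
      old-or-new : ∀ u v → adj P u v ∨ new u v ≡ true →
        (mid⁺ u v ≡ mid u v × adj P u v ≡ true × new u v ≡ false) ⊎ (((a ≡ u × b ≡ v) ⊎ (b ≡ u × a ≡ v)) × mid⁺ u v ≡ y)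
      old-or-new u v p with new u v in eq
      ... | true = inj₂ (new-elim u v eq , refl)
      ... | false with ∨-elim (adj P u v) _ p
      ... | inj₁ e = inj₁ (refl , e , refl)
      inj : ∀ u v u′ v′ → adj P u v ∨ new u v ≡ true → adj P u′ v′ ∨ new u′ v′ ≡ true → mid⁺ u v ≡ mid⁺ u′ v′ →
        (u ≡ u′ × v ≡ v′) ⊎ (u ≡ v′ × v ≡ u′)
      inj u v u′ v′ p p′ eq with old-or-new u v p | old-or-new u′ v′ p′
      ... | inj₁ (q , e , _) | inj₁ (q′ , e′ , _) = mid-inj u v u′ v′ e e′ (trans (≡sym q) (trans eq q′))
      ... | inj₁ (q , e , _) | inj₂ (_ , r) = contradiction (subst (_∈ used) (trans (≡sym q) (trans eq r)) (mid-used u v e)) y∉used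
      ... | inj₂ (_ , r) | inj₁ (q , e , _) = contradiction (subst (_∈ used) (trans (≡sym q) (trans (≡sym eq) r)) (mid-used u′ v′ e)) y∉used
      ... | inj₂ (inj₁ (refl , refl) , _) | inj₂ (inj₁ (refl , refl) , _) = inj₁ (refl , refl)
      ... | inj₂ (inj₁ (refl , refl) , _) | inj₂ (inj₂ (refl , refl) , _) = inj₂ (refl , refl)
      ... | inj₂ (inj₂ (refl , refl) , _) | inj₂ (inj₁ (refl , refl) , _) = inj₂ (refl , refl)
      ... | inj₂ (inj₂ (refl , refl) , _) | inj₂ (inj₂ (refl , refl) , _) = inj₁ (refl , refl)
      aX = ∧ˡ (X a) aN
      bX = ∧ˡ (X b) bN
      edge-count : suc c + suc c ≤ ∣∣₂ (λ u v → X u ∧ (X v ∧ (adj P u v ∨ new u v)))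
      edge-count = begin
        suc c + suc c ≡⟨ eq c ⟩
        (c + c) + (1 + 1) ≤⟨ +-mono-≤ count-edges (+-mono-≤ (∣∣₂>0 (is a b) a b (∧-intro {⌊ a ≟ a ⌋} (⌊⌋-intro refl) (⌊⌋-intro refl)))
                                                           (∣∣₂>0 (is b a) b a (∧-intro {⌊ b ≟ b ⌋} (⌊⌋-intro refl) (⌊⌋-intro refl)))) ⟩
        E P X + (∣∣₂ (is a b) + ∣∣₂ (is b a)) ≤⟨ +-monoʳ-≤ (E P X) (∣∣₂-disjoint (is a b) (is b a) new
              (λ u v p q → a≢b (trans (proj₁ (is-elim a b u v p)) (≡sym (proj₁ (is-elim b a u v q))))) (λ u v p → ∨-introˡ _ p) (λ u v p → ∨-introʳ (is a b u v) p)) ⟩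
        E P X + ∣∣₂ new ≤⟨ ∣∣₂-disjoint _ _ _ disjoint (λ u v p → let x , z , e = E-elim P X u v p in ∧-intro x (∧-intro z (∨-introˡ _ e))) incl ⟩
        ∣∣₂ (λ u v → X u ∧ (X v ∧ (adj P u v ∨ new u v))) ∎
        where
        open ≤-Reasoning
        eq : ∀ c → suc c + suc c ≡ (c + c) + (1 + 1)
        eq = solve-∀
        disjoint : ∀ u v → X u ∧ (X v ∧ adj P u v) ≡ true → new u v ≡ true → ⊥
        disjoint u v p q with E-elim P X u v p | new-elim u v q
        ... | _ , _ , e | inj₁ (refl , refl) = a≁b e
        ... | _ , _ , e | inj₂ (refl , refl) = a≁b (adj-sym P e)
        incl : ∀ u v → new u v ≡ true → X u ∧ (X v ∧ (adj P u v ∨ new u v)) ≡ true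
        incl u v q with new-elim u v q
        ... | inj₁ (refl , refl) = ∧-intro aX (∧-intro bX (∨-introʳ (adj P a b) q))
        ... | inj₂ (refl , refl) = ∧-intro bX (∧-intro aX (∨-introʳ (adj P b a) q))

    -- The case in which `y` finds no free pair: its neighbours in `X` then form a complete graph in
    -- `P`.
    clique : ∀ {used c} (s : State used c) y → t ≤ ∣ neighbours y ∣ →
      (∀ a b → a ∈ neighbours y → b ∈ neighbours y → a ≢ b → adj (State.P s) a b ≡ true) → Linkage (State.P s) t 1
    clique s y le all-adj with choose (neighbours y) t le
    ... | b , b∈ , b-inj = record { b = b ; Q = λ _ _ _ → false ; b-inj = b-inj ; avoid = λ _ _ _ _ () ; disj = λ _ _ _ _ _ _ _ ()
      ; path = λ i j p → go (all-adj _ _ (b∈ i) (b∈ j) λ eq → <⇒≢ p (cong toℕ (b-inj i j eq))) (∈⁅⁆ (b j)) stop }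

    -- The number `f` bounds the recursion. Since `c + f` stays at least `∣ Y ∣`, running out of it
    -- means that `∣ Y ∣` edges have been assigned.
    exhaust : ∀ Y → (∀ y → y ∈ Y → y ∉ X × t ≤ ∣ neighbours y ∣) → ∀ f {used c} → State used c → used ⊆ Y → ∣ used ∣ ≤ c → ∣ Y ∣ ≤ c + f →
      (Σ Subdivided λ s → Linkage (Subdivided.P s) t 1) ⊎ (Σ Subdivided λ s → ∣ Y ∣ + ∣ Y ∣ ≤ E (Subdivided.P s) X)
    exhaust Y h zero {c = c} s _ _ le = inj₂ (State.sub s , ≤-trans (+-mono-≤ le′ le′) (State.count-edges s))
      where
      le′ : ∣ Y ∣ ≤ c
      le′ = ≤-trans le (≤-reflexive (+-identityʳ c))
    exhaust Y h (suc f) {used} {c} s us uc le with ∣ used ∣ <? ∣ Y ∣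
    ... | no ge = inj₂ (State.sub s , ≤-trans (+-mono-≤ le′ le′) (State.count-edges s))
      where
      le′ : ∣ Y ∣ ≤ c
      le′ = ≤-trans (≮⇒≥ ge) uc
    ... | yes lt with ∣∣<⇒∈∖ Y used lt
    ... | y , y∈ , y∉ with any? (λ a → any? (λ b → (a ∈? neighbours y) ×-dec ((b ∈? neighbours y) ×-dec ((¬? (a ≟ b)) ×-dec ¬? (adj (State.P s) a b ≟ᵇ true)))))
    ... | no none = inj₁ (State.sub s , clique s y (proj₂ (h y y∈)) λ a b p q ne → decidable-stable (adj (State.P s) a b ≟ᵇ true) λ e → none (a , b , p , q , ne , e))
    ... | yes (a , b , p , q , ne , e) = exhaust Y h f (add s y y∉ (proj₁ (h y y∈)) a b p q ne e)
        (λ x r → [ us x , (λ z → subst (_∈ Y) (∈⁅⁆-elim y x z) y∈) ]′ (∨-elim (used x) _ r))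
        (≤-trans (∣∣-cover _ used ⁅ y ⁆ (λ x → ∨-elim (used x) _)) (≤-trans (+-mono-≤ uc (∣⁅⁆∣≤1 y)) (≤-reflexive (+-comm c 1))))
        (≤-trans le (≤-reflexive (+-suc c f)))

-- With `D = cliqueDensity t`, a graph of density at most `D` has at most `D n / maxDegree t`
-- vertices of this degree. If moreover `∣ Y ∣ ≤ D ∣ X ∣`, then `E` of the union of `X` and `Y` is
-- at most `(D + D ^ 2) ∣ X ∣`, hence at most `n`.
maxDegree : ℕ → ℕ
maxDegree t = cliqueDensity t * (cliqueDensity t + cliqueDensity t * cliqueDensity t)

-- X is the set of vertices of large degree, Y the set of those outside X with at least t neighbours in X. Assign to the
-- vertices of Y distinct pairs of their neighbours in X: if this gets stuck there is a subdivided clique, and if Y is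
-- large the assigned pairs form a dense graph on X. Hence Y is small and X is incident with few edges.
bounded-degree : (G : Graph n) (L : ℕ) → n < 2 ^ suc L → ∀ t′ → let t = 2 + t′ in
  (∀ K → E G K ≤ cliqueDensity t * ∣ K ∣) → ∀ d → 1 ≤ d → 1 ≤ n → (d + (t + t + 1)) * n ≤ E G full →
  Linkage G t (cliqueLength L * 2) ⊎ ∃[ H ] Dense G 1 d H × (∀ x → x ∈ H → deg G H x ≤ maxDegree t)
bounded-degree {n} G L lt t′ sparse d 1≤d 1≤n many = outcome
    (exhaust Y (λ y p → let a , b = ∧-elim (not (X y)) _ p in not-elim a , ⌊⌋-elim (t ≤? ∣ neighbours y ∣) b) ∣ Y ∣ (initial v₀) (λ _ ()) (≤-reflexive (sum-zero {n} (λ _ → 0) (λ _ → refl))) ≤-refl)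
  where
  open ≤-Reasoning
  t = 2 + t′
  D = cliqueDensity t
  Δ = maxDegree t
  v₀ : Fin n
  v₀ = fromℕ< 1≤n
  X Y XY H : VSet n
  X u = ⌊ Δ ≤? deg G full u ⌋
  open Greedy G X t
  Y y = not (X y) ∧ ⌊ t ≤? ∣ neighbours y ∣ ⌋
  XY = X ∪ Y
  H u = not (X u)

  hubs-few : D * (D + D * D) * ∣ X ∣ ≤ D * n
  hubs-few = begin
    Δ * ∣ X ∣ ≡⟨ *-distribˡ-sum Δ (b2n ∘ X) ⟩
    sum (λ u → Δ * b2n (X u)) ≤⟨ sum-mono _ _ (λ u → aux u (Δ ≤? deg G full u)) ⟩
    E G full ≤⟨ sparse full ⟩
    D * ∣ full {n} ∣ ≤⟨ *-monoʳ-≤ D (∣∣≤n (full {n})) ⟩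
    D * n ∎
    where
    aux : ∀ u (p : Dec (Δ ≤ deg G full u)) → Δ * b2n ⌊ p ⌋ ≤ deg G full u
    aux u (yes p) = ≤-trans (≤-reflexive (*-identityʳ Δ)) p
    aux u (no p) = ≤-trans (≤-reflexive (*-zeroʳ Δ)) z≤n

  degree : ∀ x → x ∈ H → deg G H x ≤ Δ
  degree x p = ≤-trans (∣∣-mono (λ w → H w ∧ adj G x w) (λ w → full w ∧ adj G x w) (λ w q → ∧ʳ (H w) q))
    (<⇒≤ (≰⇒> λ le → not-elim {X x} p (⌊⌋-intro le)))

  -- An edge not inside `H` has an end in `X`. Its other end is in `X ∪ Y` or has fewer than `t`
  -- neighbours in `X`; edges of the latter kind give at most `t n` pairs in each direction.
  cover : E G full ≤ E G H + (E G XY + (t * n + t * n))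
  cover = begin
    E G full ≤⟨ ∣∣₂-cover _ (λ u v → H u ∧ (H v ∧ adj G u v)) (λ u v → (XY u ∧ (XY v ∧ adj G u v)) ∨ (f u v ∨ f v u)) pairs ⟩
    E G H + ∣∣₂ (λ u v → (XY u ∧ (XY v ∧ adj G u v)) ∨ (f u v ∨ f v u)) ≤⟨ +-monoʳ-≤ (E G H) (∣∣₂-cover _ (λ u v → XY u ∧ (XY v ∧ adj G u v)) (λ u v → f u v ∨ f v u) (λ u v → ∨-elim _ _)) ⟩
    E G H + (E G XY + ∣∣₂ (λ u v → f u v ∨ f v u)) ≤⟨ +-monoʳ-≤ (E G H) (+-monoʳ-≤ (E G XY) (∣∣₂-cover _ f (λ u v → f v u) (λ u v → ∨-elim _ _))) ⟩
    E G H + (E G XY + (∣∣₂ f + ∣∣₂ (λ u v → f v u))) ≤⟨ +-monoʳ-≤ (E G H) (+-monoʳ-≤ (E G XY) (+-mono-≤ rows (≤-trans (≤-reflexive (≡sym (∣∣₂-swap f))) rows))) ⟩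
    E G H + (E G XY + (t * n + t * n)) ∎
    where
    f : Fin n → Fin n → Bool
    f u v = not (XY u) ∧ neighbours u v
    rows : ∣∣₂ f ≤ t * n
    rows = ≤-trans (∣∣₂-rows (λ u → not (XY u)) neighbours t λ u p → <⇒≤ (≰⇒> λ le → not-elim {XY u} p
        (case X u ≟ᵇ true of λ { (yes q) → ∨-introˡ _ q ; (no q) → ∨-introʳ (X u) (∧-intro (not-intro q) (⌊⌋-intro le)) })))
      (*-monoʳ-≤ t (∣∣≤n (λ u → not (XY u))))
    pairs : ∀ u v → full u ∧ (full v ∧ adj G u v) ≡ true →
      H u ∧ (H v ∧ adj G u v) ≡ true ⊎ (XY u ∧ (XY v ∧ adj G u v)) ∨ (f u v ∨ f v u) ≡ true
    pairs u v e with u ∈? X | v ∈? X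
    ... | no p | no q = inj₁ (E-intro G {H} (not-intro p) (not-intro q) e)
    ... | yes p | _ with v ∈? XY
    ... | yes q = inj₂ (∨-introˡ _ (E-intro G {XY} (∨-introˡ _ p) q e))
    ... | no q = inj₂ (∨-introʳ (XY u ∧ (XY v ∧ adj G u v)) (∨-introʳ (f u v) (∧-intro (not-intro q) (∧-intro p (adj-sym G e)))))
    pairs u v e | no p | yes q with u ∈? XY
    ... | yes r = inj₂ (∨-introˡ _ (E-intro G {XY} r (∨-introˡ _ q) e))
    ... | no r = inj₂ (∨-introʳ (XY u ∧ (XY v ∧ adj G u v)) (∨-introˡ _ (∧-intro (not-intro r) (∧-intro q e))))

  finish : ∣ Y ∣ ≤ D * ∣ X ∣ → Dense G 1 d H
  finish Y-few = nonempty , ≤-trans (*-monoʳ-≤ d (∣∣≤n H)) (≤-trans dense (≤-reflexive (≡sym (*-identityˡ _))))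
    where
    XY-edges : E G XY ≤ n
    XY-edges = *-cancelˡ-≤ D {{>-nonZero (cliqueDensity>0 t)}} (begin
      D * E G XY ≤⟨ *-monoʳ-≤ D (sparse XY) ⟩
      D * (D * ∣ XY ∣) ≤⟨ *-monoʳ-≤ D (*-monoʳ-≤ D (∣∣-cover XY X Y (λ x → ∨-elim (X x) _))) ⟩
      D * (D * (∣ X ∣ + ∣ Y ∣)) ≤⟨ *-monoʳ-≤ D (*-monoʳ-≤ D (+-monoʳ-≤ ∣ X ∣ Y-few)) ⟩
      D * (D * (∣ X ∣ + D * ∣ X ∣)) ≡⟨ eq D ∣ X ∣ ⟩
      D * (D + D * D) * ∣ X ∣ ≤⟨ hubs-few ⟩
      D * n ∎)
      where
      eq : ∀ D x → D * (D * (x + D * x)) ≡ D * (D + D * D) * x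
      eq = solve-∀
    dense : d * n ≤ E G H
    dense = +-cancelʳ-≤ ((t + t + 1) * n) _ _ (begin
      d * n + (t + t + 1) * n ≡⟨ *-distribʳ-+ n d (t + t + 1) ⟨
      (d + (t + t + 1)) * n ≤⟨ many ⟩
      E G full ≤⟨ cover ⟩
      E G H + (E G XY + (t * n + t * n)) ≤⟨ +-monoʳ-≤ (E G H) (+-monoˡ-≤ _ XY-edges) ⟩
      E G H + (n + (t * n + t * n)) ≡⟨ eq (E G H) t n ⟩
      E G H + (t + t + 1) * n ∎)
      where
      eq : ∀ e t n → e + (n + (t * n + t * n)) ≡ e + (t + t + 1) * n
      eq = solve-∀
    nonempty : 1 ≤ ∣ H ∣
    nonempty = ≮⇒≥ λ lt → contradiction (≤-trans (*-mono-≤ 1≤d 1≤n) dense) (<⇒≱ (≤-reflexive (cong suc (E-empty G H (n<1⇒n≡0 lt)))))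

  Result = Linkage G t (cliqueLength L * 2) ⊎ ∃[ H ] Dense G 1 d H × (∀ x → x ∈ H → deg G H x ≤ maxDegree t)

  outcome : (Σ (Subdivided G X) λ s → Linkage (Subdivided.P s) t 1) ⊎ (Σ (Subdivided G X) λ s → ∣ Y ∣ + ∣ Y ∣ ≤ E (Subdivided.P s) X) → Result
  outcome (inj₁ (s , Λ)) = inj₁ (linkage-≤ (*-monoˡ-≤ 2 {1} {cliqueLength L} (s≤s z≤n)) (unsubdivide G X s Λ))
  outcome (inj₂ (s , le)) with (1 ≤? ∣ X ∣) ×-dec (D * ∣ X ∣ ≤? 1 * E (Subdivided.P s) X)
  ... | yes dX = inj₁ (unsubdivide G X s (dense⇒linkage (Subdivided.P s) L lt t X dX))
  ... | no ¬dX = inj₂ (H , finish (begin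
      ∣ Y ∣ ≤⟨ m≤m+n _ _ ⟩
      ∣ Y ∣ + ∣ Y ∣ ≤⟨ le ⟩
      E (Subdivided.P s) X ≡⟨ *-identityˡ _ ⟨
      1 * E (Subdivided.P s) X ≤⟨ notDense (Subdivided.P s) 1 D X ¬dX ⟩
      D * ∣ X ∣ ∎) , degree)

-- Locally sparse graphs of bounded degree

deg-mono : (G : Graph n) (A B : VSet n) → A ⊆ B → ∀ x → deg G A x ≤ deg G B x
deg-mono G A B s x = ∣∣-mono (λ w → A w ∧ adj G x w) (λ w → B w ∧ adj G x w) λ w p → let a , e = ∧-elim (A w) _ p in ∧-intro (s w a) e

-- A step lowers the distance to `U` by at most one, so `w` steps are too few to enter the ball.
-- This saves the walks to earlier hubs when a ball is cut out.
avoiding : (G : Graph n) (H U : VSet n) → ∀ i {w u x} → u ∈ H → u ∉ ball G H U (i + w) → Walk G H u w x → Walk G (H ∖ ball G H U i) u w x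
avoiding G H U i u∈H far stop = stop
avoiding G H U i {suc w} {u} u∈H far (go {w = v} e p wk) =
  go e (∈∖-intro H (ball G H U i) p (λ q → far′ (ball-≤ G H U (m≤m+n i w) v q))) (avoiding G H U i p far′ wk)
  where
  far′ : v ∉ ball G H U (i + w)
  far′ q = far (subst (λ k → u ∈ ball G H U k) (≡sym (+-suc i w)) (ball-step G H U (i + w) v u q (adj-sym G e) u∈H))

descend : (G : Graph n) (H U : VSet n) → U ⊆ H → ∀ i w u → u ∈ ball G H U (i + w) → u ∉ ball G H U i →
  ∃[ x ] ∃[ y ] Walk G (H ∖ ball G H U i) u w x × y ∈ ball G H U i × adj G x y ≡ true
descend G H U U⊆H i zero u p q = contradiction (subst (λ k → u ∈ ball G H U k) (+-identityʳ i) p) q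
descend G H U U⊆H i (suc w) u p q with ball-elim G H U (i + w) u (subst (λ k → u ∈ ball G H U k) (+-suc i w) p)
... | inj₁ r = let x , y , a , b , e = descend G H U U⊆H i w u r q in x , y , walk-≤ G (n≤1+n w) a , b , e
... | inj₂ (_ , y , r , e) with y ∈? ball G H U i
... | yes s = u , y , stop , s , adj-sym G e
... | no s = let x , y′ , a , b , e′ = descend G H U U⊆H i w y r s in
  x , y′ , go (adj-sym G e) (∈∖-intro H (ball G H U i) (ball⊆ G (λ _ z → z) U⊆H (i + w) y r) s) a , b , e′

-- A window with `h = m = N` keeps the fraction `(N / (N + 1)) ^ 2` of the density. Measured in
-- units of `D / (N + 1)`, a density of at most `N + 1` units thus loses at most two.
window-ratio : ∀ N i D → 2 + i ≤ suc N → i * D * (suc N * suc N) ≤ (2 + i) * D * (N * N)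
window-ratio N i D le = begin
  i * D * (suc N * suc N) ≤⟨ m≤m+n _ (D * (2 + i + 2 * e * e + 4 * e + 2 * i * e)) ⟩
  i * D * (suc N * suc N) + D * (2 + i + 2 * e * e + 4 * e + 2 * i * e) ≡⟨ cong (λ N → i * D * (suc N * suc N) + D * (2 + i + 2 * e * e + 4 * e + 2 * i * e)) N≡ ⟩
  i * D * (suc (suc i + e) * suc (suc i + e)) + D * (2 + i + 2 * e * e + 4 * e + 2 * i * e) ≡⟨ eq i D e ⟩
  (2 + i) * D * ((suc i + e) * (suc i + e)) ≡⟨ cong (λ N → (2 + i) * D * (N * N)) N≡ ⟨
  (2 + i) * D * (N * N) ∎
  where
  open ≤-Reasoning
  e = N ∸ suc i
  N≡ : N ≡ suc i + e
  N≡ = ≡sym (m+[n∸m]≡n (s≤s⁻¹ le))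
  eq : ∀ i D e → i * D * (suc (suc i + e) * suc (suc i + e)) + D * (2 + i + 2 * e * e + 4 * e + 2 * i * e) ≡ (2 + i) * D * ((suc i + e) * (suc i + e))
  eq = solve-∀

module Rounds (G : Graph n) (H₀ : VSet n) (Δ : ℕ) (deg≤ : ∀ x → x ∈ H₀ → deg G H₀ x ≤ Δ)
  (L : ℕ) (n<2^L+1 : n < 2 ^ suc L) (C d : ℕ) (sparse : ∀ A → ∣ A ∣ ≤ C → E G A ≤ d * ∣ A ∣)
  (N : ℕ) (1≤N : 1 ≤ N) (D f : ℕ) (above : suc N * d < f * D) (Wmax : ℕ) (C-large : suc Δ ^ Wmax ≤ C) where

  R : ℕ
  R = N * suc L + suc N

  Outcome : ℕ → ℕ → Set
  Outcome W k = ∃[ H′ ] ∃[ K′ ] K′ ⊆ H′ × H′ ⊆ H₀ × Dense G (suc N) (f * D) K′ × Web G K′ H′ W R k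

  -- A round spends two units of density and adds `N + 1` to the distance from the hubs. The last
  -- `f` units still exceed the local bound `d`, so no window can fit into a ball of radius
  -- `N + 1 + W`, which has at most `C` vertices.
  rounds : ∀ r W k H K → K ⊆ H → H ⊆ H₀ → Dense G (suc N) ((r * 2 + f) * D) K → Web G K H W R k →
    r * 2 + f ≤ suc N → r * suc N + W ≤ Wmax →
    Outcome (r * suc N + W) (r + k)
  rounds zero W k H K K⊆H H⊆ d w _ _ = H , K , K⊆H , H⊆ , d , w
  rounds (suc r) W k H K K⊆H H⊆ dK w few le with shrink G (suc N) ((suc r * 2 + f) * D) n K (∣∣≤n K) dK
  ... | K₀ , K₀⊆K , md with ∣∣>0⇒∈ K₀ (proj₁ (MinDense.dense md))
  ... | z , z∈ = advance (Layers.window G H z md (λ x p → K⊆H x (K₀⊆K x p)) z∈ N L N p′ 1≤N n<2^L+1 (window-ratio N (r * 2 + f) D few))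
    where
    open ≤-Reasoning
    p′ = (r * 2 + f) * D
    B = ball G H ⁅ z ⁆
    z⊆ : ⁅ z ⁆ ⊆ H
    z⊆ x p = subst (_∈ H) (∈⁅⁆-elim z x p) (K⊆H z (K₀⊆K z z∈))
    reorder : ∀ r N W → r * N + (N + W) ≡ N + r * N + W
    reorder = solve-∀
    N+W≤ : suc N + W ≤ Wmax
    N+W≤ = ≤-trans (+-monoˡ-≤ W (m≤m+n (suc N) (r * suc N))) le
    advance : Layers.Window G H z (suc N) p′ K₀ R N → Outcome (suc r * suc N + W) (suc r + k)
    advance (a , A , a≤R , A⊆ , dA , A⊆B , out) with a <? suc N + W
    ... | yes lt = contradiction (begin-strict
        suc N * E G A ≤⟨ *-monoʳ-≤ (suc N) (sparse A small) ⟩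
        suc N * (d * ∣ A ∣) ≡⟨ *-assoc (suc N) d ∣ A ∣ ⟨
        suc N * d * ∣ A ∣ <⟨ *-monoˡ-< ∣ A ∣ {{>-nonZero (proj₁ dA)}} above ⟩
        f * D * ∣ A ∣ ≤⟨ *-monoˡ-≤ ∣ A ∣ (*-monoˡ-≤ D (m≤n+m f (r * 2))) ⟩
        p′ * ∣ A ∣ ≤⟨ proj₂ dA ⟩
        suc N * E G A ∎) (<-irrefl refl)
      where
      small : ∣ A ∣ ≤ C
      small = begin
        ∣ A ∣ ≤⟨ ∣∣-mono A (B a) A⊆B ⟩
        ∣ B a ∣ ≤⟨ ball-size G H ⁅ z ⁆ Δ z⊆ (λ x p → ≤-trans (deg-mono G H H₀ H⊆ x) (deg≤ x (H⊆ x p))) a ⟩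
        ∣ ⁅ z ⁆ ∣ * suc Δ ^ a ≤⟨ *-mono-≤ (∣⁅⁆∣≤1 z) (^-monoʳ-≤ (suc Δ) (≤-trans (<⇒≤ lt) N+W≤)) ⟩
        1 * suc Δ ^ Wmax ≡⟨ *-identityˡ _ ⟩
        suc Δ ^ Wmax ≤⟨ C-large ⟩
        C ∎
    ... | no ge with rounds r (suc N + W) (suc k) H′ A A⊆H′ (λ x p → H⊆ x (∖ˡ H p)) dA w′
            (≤-trans (≤-trans (n≤1+n _) (n≤1+n _)) few) (≤-trans (≤-reflexive (reorder r (suc N) W)) le)
      where
      -- The window takes up `N + 1` layers; the other `W` keep the walks of length `W` to earlier
      -- hubs out of `S₀`.
      a₀ = a ∸ (suc N + W)
      a≡ : a₀ + (suc N + W) ≡ a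
      a≡ = m∸n+n≡m (≮⇒≥ ge)
      S₀ = B a₀
      H′ = H ∖ S₀
      shuffle : ∀ a N W → a + W + N ≡ a + (N + W)
      shuffle = solve-∀
      A⊆H : A ⊆ H
      A⊆H x p = K⊆H x (K₀⊆K x (A⊆ x p))
      far : ∀ u → u ∈ A → u ∉ B (a₀ + W)
      far u p = out (a₀ + W) u (≤-reflexive (trans (shuffle a₀ (suc N) W) a≡)) p
      outside : ∀ u → u ∈ A → u ∉ S₀
      outside u p q = far u p (ball-≤ G H ⁅ z ⁆ (m≤m+n a₀ W) u q)
      A⊆H′ : A ⊆ H′
      A⊆H′ x p = ∈∖-intro H S₀ (A⊆H x p) (outside x p)
      w′ : Web G A H′ (suc N + W) R (suc k)
      w′ = extendWeb G (λ x p → K₀⊆K x (A⊆ x p)) (λ x p → ∖ˡ H p)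
        (λ u x p wk → walk-≤ G (m≤n+m W (suc N)) (avoiding G H ⁅ z ⁆ a₀ (A⊆H u p) (far u p) wk)) w z S₀
        (ball⊆ G (λ _ p → p) z⊆ a₀) (λ x p q → proj₂ (∈∖-elim H S₀ q) p) (Layers.z∈B G H z a₀)
        (λ x p → walk-≤ G (≤-trans (m∸n≤m a (suc N + W)) a≤R) (Layers.radius G H z a₀ x p))
        (λ u p → descend G H ⁅ z ⁆ z⊆ a₀ (suc N + W) u (subst (λ k → u ∈ B k) (≡sym a≡) (A⊆B u p)) (outside u p))
    ... | H′ , K′ , s , s′ , dK′ , w″ = H′ , K′ , s , s′ , dK′ ,
        subst₂ (λ W k → Web G K′ H′ W R k) (reorder r (suc N) W) (+-suc r k) w″

-- Legs

nbr-mono : (G : Graph n) (A B : VSet n) → A ⊆ B → nbr G A ⊆ nbr G B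
nbr-mono G A B s x p = let y , q , e = nbr-elim G A x p in nbr-intro G B y x (s y q) e

-- The last property is what keeps earlier legs from stopping the growth of balls around v.
geodesic : (G : Graph n) (A : VSet n) (v : Fin n) → ∀ m x → x ∈ ball G A ⁅ v ⁆ m →
  ∃[ P ] P ⊆ A × v ∉ P × Walk G P v m x × ∣ P ∣ ≤ m × P ⊆ ball G A ⁅ v ⁆ m × (∀ i → ∣ P ∩ ball G A ⁅ v ⁆ i ∣ ≤ i)
geodesic {n} G A v zero x p rewrite ∈⁅⁆-elim v x p = (λ _ → false) , (λ _ ()) , (λ ()) , stop ,
  ≤-reflexive none , (λ _ ()) , λ i → ≤-trans (≤-reflexive none) z≤n
  where
  none : sum {n} (λ _ → 0) ≡ 0
  none = sum-zero {n} (λ _ → 0) (λ _ → refl)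
geodesic G A v (suc m) x p with x ∈? ball G A ⁅ v ⁆ m
... | yes q = let P , a , b , c , d , e , f = geodesic G A v m x q in
  P , a , b , walk-≤ G (n≤1+n m) c , m≤n⇒m≤1+n d , (λ y r → ball-suc G A ⁅ v ⁆ m y (e y r)) , f
... | no q with ball-elim G A ⁅ v ⁆ m x p
... | inj₁ r = contradiction r q
... | inj₂ (x∈A , y , y∈ , yx) with geodesic G A v m y y∈
... | P′ , P′⊆ , v∉ , wk , size , near , thin = P ,
    (λ z r → [ P′⊆ z , (λ s → subst (_∈ A) (∈⁅⁆-elim x z s) x∈A) ]′ (∨-elim (P′ z) _ r)) ,
    (λ r → [ v∉ , (λ s → q (subst (_∈ ball G A ⁅ v ⁆ m) (≡sym (∈⁅⁆-elim x v s)) (ball-≤ G A ⁅ v ⁆ {0} {m} z≤n v (∈⁅⁆ v)))) ]′ (∨-elim (P′ v) _ r)) ,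
    walk-snoc G (walk-mono G (λ z r → ∨-introˡ _ r) wk) yx (∨-introʳ (P′ x) (∈⁅⁆ x)) , size⁺ ,
    (λ z r → [ (λ s → ball-suc G A ⁅ v ⁆ m z (near z s)) , (λ s → subst (_∈ ball G A ⁅ v ⁆ (suc m)) (∈⁅⁆-elim x z s) p) ]′ (∨-elim (P′ z) _ r)) ,
    thin⁺
  where
  P = P′ ∪ ⁅ x ⁆
  size⁺ : ∣ P ∣ ≤ suc m
  size⁺ = ≤-trans (∣∣-cover P P′ ⁅ x ⁆ (λ z → ∨-elim (P′ z) _)) (≤-trans (+-mono-≤ size (∣⁅⁆∣≤1 x)) (≤-reflexive (+-comm m 1)))
  -- The new end `x` is outside the ball of radius `m`, so it counts only for `i > m`, where the
  -- bound on the size of `P` is enough.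
  thin⁺ : ∀ i → ∣ P ∩ ball G A ⁅ v ⁆ i ∣ ≤ i
  thin⁺ i with i ≤? m
  ... | no gt = ≤-trans (∣∣-mono (P ∩ ball G A ⁅ v ⁆ i) P (λ z r → ∧ˡ (P z) r)) (≤-trans size⁺ (≰⇒> gt))
  ... | yes le = ≤-trans (∣∣-mono (P ∩ ball G A ⁅ v ⁆ i) (P′ ∩ ball G A ⁅ v ⁆ i) λ z r → let a , b = ∧-elim (P z) _ r in
    [ (λ s → ∧-intro s b) , (λ s → contradiction (ball-≤ G A ⁅ v ⁆ le x (subst (_∈ ball G A ⁅ v ⁆ i) (≡sym (∈⁅⁆-elim x z s)) b)) q) ]′ (∨-elim (P′ z) _ a)) (thin i)

-- A bound for the total number of vertices of k legs.
legLength : ℕ → ℕ → ℕ → ℕ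
legLength Δ W zero = 0
legLength Δ W (suc k) = legLength Δ W k + (suc (suc (legLength Δ W k * suc Δ ^ W)) + W)

legLength-mono : ∀ Δ W {k l} → k ≤ l → legLength Δ W k ≤ legLength Δ W l
legLength-mono Δ W {zero} le = z≤n
legLength-mono Δ W {suc k} (s≤s le) = +-mono-≤ m (+-monoˡ-≤ W (s≤s (s≤s (*-monoˡ-≤ (suc Δ ^ W) m))))
  where m = legLength-mono Δ W le

-- The last `t` makes up for the neighbours of a branch vertex that its earlier legs may block; the
-- rest is the start `e₀` of the induction in `grow`.
branchDegree : ℕ → ℕ → ℕ
branchDegree h t = (2 * (h * h) + 2 * h) * t + t

module LegSearch (G : Graph n) (H K : VSet n) (K⊆H : K ⊆ H) {q p : ℕ} (md : MinDense G q p K)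
  (Δ : ℕ) (deg≤ : ∀ x → x ∈ H → deg G H x ≤ Δ) (C d : ℕ) (sparse : ∀ A → ∣ A ∣ ≤ C → E G A ≤ d * ∣ A ∣)
  (h t : ℕ) (1≤h : 1 ≤ h) (1≤t : 1 ≤ t) (1≤q : 1 ≤ q) (gap : suc h * (q * d) ≤ h * p)
  (large : 2 * branchDegree h t ≤ d) {W R : ℕ} (web : Web G K H W R (t * t))
  (C-large : suc Δ * suc (legLength Δ W t * suc Δ ^ W) ≤ C) where

  open Web web
  open ≤-Reasoning

  private
    ℓ = legLength Δ W

    1≤d : 1 ≤ d
    1≤d = ≤-trans 1≤t (≤-trans (≤-trans (m≤n+m t _) (m≤m+n (branchDegree h t) _)) large)

    instance
      nz-h : NonZero h
      nz-h = >-nonZero 1≤h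
      nz-qd : NonZero (q * d)
      nz-qd = >-nonZero (*-mono-≤ {1} {q} {1} {d} 1≤q 1≤d)
      nz-q : NonZero q
      nz-q = >-nonZero 1≤q

    expand : ∀ S S′ → S ⊆ K → S ⊆ S′ → (∀ x y → x ∈ S → y ∈ K → adj G x y ≡ true → y ∈ S′) → ∣ S′ ∣ ≤ C →
      suc h * ∣ S ∣ ≤ h * ∣ S′ ∣
    expand S S′ s s′ cl small = *-cancelˡ-≤ (q * d) (begin
      q * d * (suc h * ∣ S ∣) ≡⟨ eq₁ q d (suc h) ∣ S ∣ ⟩
      suc h * (q * d) * ∣ S ∣ ≤⟨ *-monoˡ-≤ ∣ S ∣ gap ⟩
      h * p * ∣ S ∣ ≡⟨ *-assoc h p ∣ S ∣ ⟩
      h * (p * ∣ S ∣) ≤⟨ *-monoʳ-≤ h (closed-dense G md S S′ s s′ cl) ⟩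
      h * (q * E G S′) ≤⟨ *-monoʳ-≤ h (*-monoʳ-≤ q (sparse S′ small)) ⟩
      h * (q * (d * ∣ S′ ∣)) ≡⟨ eq₂ h q d ∣ S′ ∣ ⟩
      q * d * (h * ∣ S′ ∣) ∎)
      where
      eq₁ : ∀ q d h x → q * d * (h * x) ≡ h * (q * d) * x
      eq₁ = solve-∀
      eq₂ : ∀ h q d x → h * (q * (d * x)) ≡ q * d * (h * x)
      eq₂ = solve-∀

    degree : ∀ v → v ∈ K → branchDegree h t ≤ deg G K v
    degree v v∈ = *-cancelˡ-≤ 2 (≤-trans large (*-cancelˡ-≤ q (*-cancelˡ-≤ h (begin
      h * (q * d) ≤⟨ *-monoˡ-≤ (q * d) (n≤1+n h) ⟩
      suc h * (q * d) ≤⟨ gap ⟩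
      h * p ≤⟨ *-monoʳ-≤ h (deg-lower G md v v∈) ⟩
      h * (q * (deg G K v + deg G K v)) ≡⟨ cong (λ x → h * (q * x)) (eq (deg G K v)) ⟩
      h * (q * (2 * deg G K v)) ∎))))
      where
      eq : ∀ x → x + x ≡ 2 * x
      eq = solve-∀

  K-large : C < ∣ K ∣
  K-large = ≰⇒> λ le → contradiction (begin-strict
      q * E G K ≤⟨ *-monoʳ-≤ q (sparse K le) ⟩
      q * (d * ∣ K ∣) ≡⟨ *-assoc q d ∣ K ∣ ⟨
      q * d * ∣ K ∣ <⟨ *-monoˡ-< ∣ K ∣ {{>-nonZero (proj₁ (MinDense.dense md))}} qd<p ⟩
      p * ∣ K ∣ ≤⟨ proj₂ (MinDense.dense md) ⟩
      q * E G K ∎) (<-irrefl refl)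
    where
    qd<p : q * d < p
    qd<p = *-cancelˡ-< h _ _ (<-≤-trans (m<n+m (h * (q * d)) {q * d} (*-mono-≤ {1} {q} {1} {d} 1≤q 1≤d)) gap)

  free : Fin n → VSet n → ℕ → VSet n
  free v O = ball G (H ∖ O) ⁅ v ⁆

  -- O is the union of the first k legs of v.
  record Obstacle (v : Fin n) (k : ℕ) (O : VSet n) : Set where
    field
      O⊆H : O ⊆ H
      v∉O : v ∉ O
      size : ∣ O ∣ ≤ ℓ k
      thin : ∀ i → ∣ O ∩ nbr G (free v O i) ∣ ≤ k * suc i

  module _ {v : Fin n} (v∈K : v ∈ K) {k : ℕ} (k<t : k < t) {O : VSet n} (obs : Obstacle v k O) where
    open Obstacle obs

    private
      b : ℕ → VSet n
      b = ball G (K ∖ O) ⁅ v ⁆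

      v⊆K : ⁅ v ⁆ ⊆ K
      v⊆K x r = subst (_∈ K) (∈⁅⁆-elim v x r) v∈K

      b⊆K : ∀ i → b i ⊆ K
      b⊆K = ball⊆ G (λ x r → ∖ˡ K r) v⊆K

      -- A step of the ball misses only vertices on earlier legs. Their number is linear in the
      -- radius, whereas expansion gains a fixed fraction of the ball.
      next : ∀ i → ∣ ball G K (b i) 1 ∣ ≤ ∣ b (suc i) ∣ + t * suc i
      next i = begin
        ∣ ball G K (b i) 1 ∣ ≤⟨ ∣∣-cover _ (b (suc i)) (O ∩ nbr G (free v O i)) split ⟩
        ∣ b (suc i) ∣ + ∣ O ∩ nbr G (free v O i) ∣ ≤⟨ +-monoʳ-≤ _ (≤-trans (thin i) (*-monoˡ-≤ (suc i) (<⇒≤ k<t))) ⟩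
        ∣ b (suc i) ∣ + t * suc i ∎
        where
        split : ∀ x → x ∈ ball G K (b i) 1 → x ∈ b (suc i) ⊎ x ∈ O ∩ nbr G (free v O i)
        split x r with ∨-elim (b i x) _ r
        ... | inj₁ s = inj₁ (ball-suc G (K ∖ O) ⁅ v ⁆ i x s)
        ... | inj₂ s with ∧-elim (K x) _ s | x ∈? O
        ... | x∈K , x∈N | yes x∈O = inj₂ (∧-intro x∈O (nbr-mono G (b i) (free v O i)
                (ball-mono G ⁅ v ⁆ (λ y z → let a , c = ∈∖-elim K O z in ∈∖-intro H O (K⊆H y a) c) i) x x∈N))
        ... | x∈K , x∈N | no x∉O = let y , y∈ , e = nbr-elim G (b i) x x∈N in
                inj₁ (ball-step G (K ∖ O) ⁅ v ⁆ i y x y∈ e (∈∖-intro K O x∈K x∉O))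

      e₀ : ℕ
      e₀ = (2 * (h * h) + 2 * h) * t

      -- Expansion of a ball of size `x` gains `x / h` and the legs block at most `t (i + 2)`. For
      -- `x ≥ 2 h t i + e₀` the difference is at least `2 h t`, so the linear lower bound persists.
      -- Stopping at `s` keeps the sets small enough for sparsity.
      grow : ∀ s → suc Δ * s ≤ C → ∀ i → s ≤ ∣ b (suc i) ∣ ⊎ 2 * h * t * i + e₀ ≤ ∣ b (suc i) ∣
      grow s le zero = inj₂ (+-cancelʳ-≤ t _ _ (begin
        2 * h * t * 0 + e₀ + t ≡⟨ cong (λ x → x + e₀ + t) (*-zeroʳ (2 * h * t)) ⟩
        branchDegree h t ≤⟨ degree v v∈K ⟩
        deg G K v ≤⟨ ∣∣-mono (λ w → K w ∧ adj G v w) (ball G K (b 0) 1) (λ x r → let a , e = ∧-elim (K x) _ r in ball-step G K (b 0) 0 v x (∈⁅⁆ v) e a) ⟩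
        ∣ ball G K (b 0) 1 ∣ ≤⟨ next 0 ⟩
        ∣ b 1 ∣ + t * 1 ≡⟨ cong (∣ b 1 ∣ +_) (*-identityʳ t) ⟩
        ∣ b 1 ∣ + t ∎))
      grow s le (suc i) with grow s le i
      ... | inj₁ r = inj₁ (≤-trans r (∣∣-mono (b (suc i)) (b (suc (suc i))) (ball-suc G (K ∖ O) ⁅ v ⁆ (suc i))))
      ... | inj₂ r with s ≤? ∣ b (suc i) ∣
      ... | yes z = inj₁ (≤-trans z (∣∣-mono (b (suc i)) (b (suc (suc i))) (ball-suc G (K ∖ O) ⁅ v ⁆ (suc i))))
      ... | no z = inj₂ (≤-trans (≤-reflexive (eq₁ h t i)) (≤-trans (+-monoˡ-≤ (2 * h * t) r) (*-cancelˡ-≤ h (+-cancelʳ-≤ (h * (t * suc (suc i))) _ _ (begin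
          h * (x + 2 * h * t) + h * (t * suc (suc i)) ≤⟨ m≤m+n _ (h * t * i) ⟩
          h * (x + 2 * h * t) + h * (t * suc (suc i)) + h * t * i ≡⟨ eq₂ h t i x ⟩
          h * x + (2 * h * t * i + e₀) ≤⟨ +-monoʳ-≤ (h * x) r ⟩
          h * x + x ≡⟨ +-comm (h * x) x ⟩
          suc h * x ≤⟨ expand (b (suc i)) S′ (b⊆K (suc i)) (λ y → ∨-introˡ _) (λ a c p q e → ball-step G K (b (suc i)) 0 a c p e q) small ⟩
          h * ∣ S′ ∣ ≤⟨ *-monoʳ-≤ h (next (suc i)) ⟩
          h * (∣ b (suc (suc i)) ∣ + t * suc (suc i)) ≡⟨ *-distribˡ-+ h _ _ ⟩
          h * ∣ b (suc (suc i)) ∣ + h * (t * suc (suc i)) ∎)))))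
        where
        x = ∣ b (suc i) ∣
        S′ = ball G K (b (suc i)) 1
        eq₁ : ∀ h t i → 2 * h * t * suc i + (2 * (h * h) + 2 * h) * t ≡ 2 * h * t * i + (2 * (h * h) + 2 * h) * t + 2 * h * t
        eq₁ = solve-∀
        eq₂ : ∀ h t i x → h * (x + 2 * h * t) + h * (t * suc (suc i)) + h * t * i ≡ h * x + (2 * h * t * i + (2 * (h * h) + 2 * h) * t)
        eq₂ = solve-∀
        small : ∣ S′ ∣ ≤ C
        small = begin
          ∣ S′ ∣ ≤⟨ ball-size G K (b (suc i)) Δ (b⊆K (suc i)) (λ y y∈ → ≤-trans (deg-mono G K H K⊆H y) (deg≤ y (K⊆H y y∈))) 1 ⟩
          x * (suc Δ * 1) ≡⟨ cong (x *_) (*-identityʳ (suc Δ)) ⟩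
          x * suc Δ ≡⟨ *-comm x (suc Δ) ⟩
          suc Δ * x ≤⟨ *-monoʳ-≤ (suc Δ) (<⇒≤ (≰⇒> z)) ⟩
          suc Δ * s ≤⟨ le ⟩
          C ∎

      -- One more than the bound for the number of vertices within distance `W` of the earlier legs.
      s₀ : ℕ
      s₀ = suc (ℓ k * suc Δ ^ W)

      s₀-small : suc Δ * s₀ ≤ C
      s₀-small = ≤-trans (*-monoʳ-≤ (suc Δ) (s≤s (*-monoˡ-≤ (suc Δ ^ W) (legLength-mono Δ W (<⇒≤ k<t))))) C-large

      grown : s₀ ≤ ∣ b (suc s₀) ∣
      grown with grow s₀ s₀-small s₀
      ... | inj₁ r = r
      ... | inj₂ r = ≤-trans (≤-trans (m≤n*m s₀ (2 * h * t) {{>-nonZero (*-mono-≤ {1} {2 * h} {1} {t} (*-mono-≤ {1} {2} {1} {h} (s≤s z≤n) 1≤h) 1≤t)}}) (m≤m+n _ e₀)) r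

    private
      escape : ∃[ u ] u ∈ b (suc s₀) × u ∉ ball G H O W
      escape = ∣∣<⇒∈∖ (b (suc s₀)) (ball G H O W) (<-≤-trans (s≤s (≤-trans (ball-size G H O Δ O⊆H deg≤ W) (*-monoˡ-≤ (suc Δ ^ W) size))) grown)

      u : Fin n
      u = proj₁ escape

      u∈K : u ∈ K
      u∈K = b⊆K (suc s₀) u (proj₁ (proj₂ escape))

      walk-to-u : Walk G (H ∖ O) v (suc s₀) u
      walk-to-u = let v′ , v′∈ , wk = ball⇒walk G (K ∖ O) ⁅ v ⁆ (suc s₀) u (proj₁ (proj₂ escape)) in
        walk-mono G (λ z r → let a , c = ∈∖-elim K O r in ∈∖-intro H O (K⊆H z a) c)
          (subst (λ w → Walk G (K ∖ O) w (suc s₀) u) (≡sym (∈⁅⁆-elim v v′ v′∈)) wk)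

      walk-on : ∀ x → Walk G H u W x → x ∈ free v O (suc s₀ + W)
      walk-on x wk = walk⇒ball G (H ∖ O) ⁅ v ⁆ (∈⁅⁆ v) (walk-++ G walk-to-u (avoiding G H O 0 (K⊆H u u∈K) (proj₂ (proj₂ escape)) wk))

      Leg : Fin (t * t) → Set
      Leg c = ∃[ P ] Obstacle v (suc k) (O ∪ P) × P ⊆ H × (∀ x → x ∈ P → x ∉ O) × P ⊆ ball G H ⁅ v ⁆ (ℓ (suc k)) ×
        ∃[ y ] ∃[ s ] Walk G P v (ℓ (suc k)) y × s ∈ S c × adj G y s ≡ true

    -- The walk by way of `u` only shows that `x` is reachable without meeting `O`. The leg itself
    -- is a geodesic in the complement of `O`, as `thin` demands.
    newLeg : ∀ c → Leg c
    newLeg c = let x , y , wk , y∈ , xy = near c u u∈K in along x y y∈ xy (geodesic G (H ∖ O) v (suc s₀ + W) x (walk-on x wk))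
      where
      along : ∀ x y → y ∈ S c → adj G x y ≡ true → ∃[ P ] P ⊆ H ∖ O × v ∉ P × Walk G P v (suc s₀ + W) x × ∣ P ∣ ≤ suc s₀ + W ×
        P ⊆ free v O (suc s₀ + W) × (∀ i → ∣ P ∩ free v O i ∣ ≤ i) → Leg c
      along x y y∈ xy (P , P⊆ , v∉P , wkP , sizeP , P-near , P-thin) = P , obs′ , (λ z r → ∖ˡ H (P⊆ z r)) , (λ z r → proj₂ (∈∖-elim H O (P⊆ z r))) ,
        (λ z r → ball-≤ G H ⁅ v ⁆ len z (ball-mono G ⁅ v ⁆ (λ w q → ∖ˡ H q) (suc s₀ + W) z (P-near z r))) ,
        x , y , walk-≤ G len wkP , y∈ , xy
        where
        len : suc s₀ + W ≤ ℓ (suc k)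
        len = m≤n+m _ (ℓ k)
        obs′ : Obstacle v (suc k) (O ∪ P)
        obs′ = record
          { O⊆H = λ z r → [ O⊆H z , (λ q → ∖ˡ H (P⊆ z q)) ]′ (∨-elim (O z) _ r)
          ; v∉O = λ r → [ v∉O , v∉P ]′ (∨-elim (O v) _ r)
          ; size = ≤-trans (∣∣-cover (O ∪ P) O P (λ z → ∨-elim (O z) _)) (+-mono-≤ size sizeP)
          ; thin = λ i → begin
              ∣ (O ∪ P) ∩ nbr G (free v (O ∪ P) i) ∣ ≤⟨ ∣∣-cover _ (O ∩ nbr G (free v O i)) (P ∩ free v O (suc i)) (cover i) ⟩
              ∣ O ∩ nbr G (free v O i) ∣ + ∣ P ∩ free v O (suc i) ∣ ≤⟨ +-mono-≤ (thin i) (P-thin (suc i)) ⟩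
              k * suc i + suc i ≡⟨ +-comm (k * suc i) (suc i) ⟩
              suc k * suc i ∎ }
          where
          -- Enlarging the obstacle shrinks the free ball, so the old bound still holds for `O`. A
          -- vertex of `P` next to the ball of radius `i` lies in the ball of radius `i + 1`, where
          -- `P` is thin.
          cover : ∀ i z → z ∈ (O ∪ P) ∩ nbr G (free v (O ∪ P) i) →
            z ∈ O ∩ nbr G (free v O i) ⊎ z ∈ P ∩ free v O (suc i)
          cover i z r with ∧-elim ((O ∪ P) z) _ r
          ... | a , m with nbr-mono G (free v (O ∪ P) i) (free v O i)
                (ball-mono G ⁅ v ⁆ (λ w q → let f , g = ∈∖-elim H (O ∪ P) q in ∈∖-intro H O f (λ o → g (∨-introˡ _ o))) i) z m
          ... | m′ with ∨-elim (O z) _ a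
          ... | inj₁ o = inj₁ (∧-intro o m′)
          ... | inj₂ o = let w , w∈ , e = nbr-elim G (free v O i) z m′ in inj₂ (∧-intro o (ball-step G (H ∖ O) ⁅ v ⁆ i w z w∈ e (P⊆ z o)))

  record LegsAt (v : Fin n) (k : ℕ) (target : Fin k → Fin (t * t)) : Set where
    field
      O : VSet n
      obstacle : Obstacle v k O
      leg : Fin k → VSet n
      leg⊆O : ∀ j → leg j ⊆ O
      leg-disj : ∀ i j x → x ∈ leg i → x ∈ leg j → i ≡ j
      O-near : O ⊆ ball G H ⁅ v ⁆ (ℓ k)
      leg-reach : ∀ j → ∃[ y ] ∃[ s ] Walk G (leg j) v (ℓ k) y × s ∈ S (target j) × adj G y s ≡ true

  legsAt : ∀ v → v ∈ K → ∀ k → k ≤ t → (target : Fin k → Fin (t * t)) → LegsAt v k target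
  legsAt v v∈K zero _ target = record
    { O = λ _ → false
    ; obstacle = record { O⊆H = λ _ () ; v∉O = λ () ; size = ≤-reflexive none ; thin = λ i → ≤-reflexive none }
    ; leg = λ () ; leg⊆O = λ () ; leg-disj = λ () ; O-near = λ _ () ; leg-reach = λ () }
    where
    none : sum {n} (λ _ → 0) ≡ 0
    none = sum-zero {n} (λ _ → 0) (λ _ → refl)
  legsAt v v∈K (suc k) k<t target = addLeg (legsAt v v∈K k (<⇒≤ k<t) (target ∘ suc))
    where
    addLeg : LegsAt v k (target ∘ suc) → LegsAt v (suc k) target
    addLeg rest = let P , obs , P⊆H , P∉O , P-near , y , s , wk , s∈ , e = newLeg v∈K k<t obstacle (target zero) in record
      { O = O ∪ P ; obstacle = obs
      ; leg = λ { zero → P ; (suc j) → leg j }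
      ; leg⊆O = λ { zero x r → ∨-introʳ (O x) r ; (suc j) x r → ∨-introˡ _ (leg⊆O j x r) }
      ; leg-disj = λ { zero zero x p q → refl ; zero (suc j) x p q → contradiction (leg⊆O j x q) (P∉O x p)
                     ; (suc i) zero x p q → contradiction (leg⊆O i x p) (P∉O x q) ; (suc i) (suc j) x p q → cong suc (leg-disj i j x p q) }
      ; O-near = λ x r → [ (λ o → ball-≤ G H ⁅ v ⁆ longer x (O-near x o)) , P-near x ]′ (∨-elim (O x) _ r)
      ; leg-reach = λ { zero → y , s , wk , s∈ , e
                      ; (suc j) → let y , s , wk , s∈ , e = leg-reach j in y , s , walk-≤ G longer wk , s∈ , e } }
      where
      open LegsAt rest
      longer : ℓ k ≤ ℓ (suc k)
      longer = m≤m+n (ℓ k) _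

  image-size : ∀ k (v : Fin k → Fin n) → ∣ (λ x → some (λ i → ⌊ v i ≟ x ⌋)) ∣ ≤ k
  image-size zero v = ≤-reflexive (sum-zero {n} (λ _ → 0) (λ _ → refl))
  image-size (suc k) v = ≤-trans (∣∣-cover (λ x → some (λ i → ⌊ v i ≟ x ⌋)) ⁅ v zero ⁆ (λ x → some (λ i → ⌊ v (suc i) ≟ x ⌋)) λ x r →
      case some-elim (λ i → ⌊ v i ≟ x ⌋) r of λ { (zero , e) → inj₁ e ; (suc i , e) → inj₂ (some-intro (λ i → ⌊ v (suc i) ≟ x ⌋) i e) })
    (+-mono-≤ (∣⁅⁆∣≤1 (v zero)) (image-size k (v ∘ suc)))

  Spread : ℕ → ℕ → Set
  Spread ρ k = Σ (Fin k → Fin n) λ v → (∀ i → v i ∈ K) × (∀ i j → i ≢ j → v j ∉ ball G H ⁅ v i ⁆ ρ)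

  -- By `K-large`, the balls around the vertices chosen so far cannot cover `K`.
  spread : ∀ ρ k → k * suc Δ ^ ρ ≤ C → Spread ρ k
  spread ρ zero le = (λ ()) , (λ ()) , λ ()
  spread ρ (suc k) le = addVertex (spread ρ k (≤-trans (*-monoˡ-≤ (suc Δ ^ ρ) (n≤1+n k)) le))
    where
    addVertex : Spread ρ k → Spread ρ (suc k)
    addVertex (v , v∈ , far) = extend (∣∣<⇒∈∖ K (ball G H U ρ) (≤-<-trans (≤-trans (ball-size G H U Δ U⊆H deg≤ ρ)
        (*-monoˡ-≤ (suc Δ ^ ρ) (≤-trans (image-size k v) (n≤1+n k)))) (≤-<-trans le K-large)))
      where
      U : VSet n
      U x = some (λ i → ⌊ v i ≟ x ⌋)
      U⊆H : U ⊆ H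
      U⊆H x r = let i , e = some-elim (λ i → ⌊ v i ≟ x ⌋) r in subst (_∈ H) (⌊⌋-elim (v i ≟ x) e) (K⊆H (v i) (v∈ i))
      extend : ∃[ v₀ ] v₀ ∈ K × v₀ ∉ ball G H U ρ → Spread ρ (suc k)
      extend (v₀ , v₀∈ , v₀∉) = v⁺ , (λ { zero → v₀∈ ; (suc i) → v∈ i }) , far⁺
        where
        v⁺ : Fin (suc k) → Fin n
        v⁺ zero = v₀
        v⁺ (suc i) = v i
        outside : ∀ i → v₀ ∉ ball G H ⁅ v i ⁆ ρ
        outside i r = let u , u∈ , wk = ball⇒walk G H ⁅ v i ⁆ ρ v₀ r in
          v₀∉ (walk⇒ball G H U (some-intro (λ i → ⌊ v i ≟ u ⌋) i u∈) wk)
        far⁺ : ∀ i j → i ≢ j → v⁺ j ∉ ball G H ⁅ v⁺ i ⁆ ρ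
        far⁺ zero zero ne r = ne refl
        far⁺ (suc i) zero ne r = outside i r
        far⁺ (suc i) (suc j) ne r = far i j (λ e → ne (cong suc e)) r
        far⁺ zero (suc j) ne r = let u , u∈ , wk = ball⇒walk G H ⁅ v₀ ⁆ ρ (v j) r in
          outside j (walk⇒ball G H ⁅ v j ⁆ (∈⁅⁆ (v j)) (walk-rev G (K⊆H v₀ v₀∈) (subst (λ w → Walk G H w ρ (v j)) (≡sym (∈⁅⁆-elim v₀ u u∈)) wk)))

  -- All legs of `v i` stay within distance `ℓ t` of it. Hence branch vertices more than twice as
  -- far apart have disjoint legs, and each vertex can build its legs independently.
  legs : t * suc Δ ^ (ℓ t + ℓ t) ≤ C → Σ (Fin t → Fin n) λ v → Legs G web v (ℓ t)
  legs le = assemble (spread (ρ + ρ) t le)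
    where
    ρ = ℓ t
    assemble : Spread (ρ + ρ) t → Σ (Fin t → Fin n) λ v → Legs G web v ρ
    assemble (v , v∈ , far) = v , record
      { v∈H = λ i → K⊆H (v i) (v∈ i)
      ; v-inj = λ i j eq → decidable-stable (i ≟ j) λ ne → far i j ne (subst (λ w → w ∈ ball G H ⁅ v i ⁆ (ρ + ρ)) eq (centred i (ρ + ρ)))
      ; P = λ i j → LegsAt.leg (at i) j
      ; P⊆H = λ i j x r → Obstacle.O⊆H (LegsAt.obstacle (at i)) x (LegsAt.leg⊆O (at i) j x r)
      ; v∉P = v∉
      ; P-disj = disj
      ; reach = λ { i j c refl → LegsAt.leg-reach (at i) j } }
      where
      target : Fin t → Fin t → Fin (t * t)
      target i j = if toℕ i <ᵇ toℕ j then combine i j else combine j i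
      at : ∀ i → LegsAt (v i) t (target i)
      at i = legsAt (v i) (v∈ i) t ≤-refl (target i)
      centred : ∀ i m → v i ∈ ball G H ⁅ v i ⁆ m
      centred i m = ball-≤ G H ⁅ v i ⁆ {0} {m} z≤n (v i) (∈⁅⁆ (v i))
      inBall : ∀ i j x → x ∈ LegsAt.leg (at i) j → x ∈ ball G H ⁅ v i ⁆ ρ
      inBall i j x r = LegsAt.O-near (at i) x (LegsAt.leg⊆O (at i) j x r)
      v∉ : ∀ k i j → v k ∉ LegsAt.leg (at i) j
      v∉ k i j r = case i ≟ k of λ
        { (yes eq) → Obstacle.v∉O (LegsAt.obstacle (at i)) (LegsAt.leg⊆O (at i) j (v i) (subst (λ l → v l ∈ LegsAt.leg (at i) j) (≡sym eq) r))
        ; (no ne) → far i k ne (ball-≤ G H ⁅ v i ⁆ (m≤m+n ρ ρ) (v k) (inBall i j (v k) r)) }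
      disj : ∀ i j i′ j′ x → x ∈ LegsAt.leg (at i) j → x ∈ LegsAt.leg (at i′) j′ → i ≡ i′ × j ≡ j′
      disj i j i′ j′ x r r′ with i ≟ i′
      ... | yes refl = refl , LegsAt.leg-disj (at i) j j′ x r r′
      ... | no ne = let u , u∈ , wk = ball⇒walk G H ⁅ v i ⁆ ρ x (inBall i j x r) ; u′ , u′∈ , wk′ = ball⇒walk G H ⁅ v i′ ⁆ ρ x (inBall i′ j′ x r′) in
        contradiction (walk⇒ball G H ⁅ v i ⁆ u∈ (walk-++ G wk (walk-rev G (K⊆H (v i′) (v∈ i′)) (subst (λ w → Walk G H w ρ x) (≡sym (∈⁅⁆-elim (v i′) u′ u′∈)) wk′))))
          (far i i′ ne)

-- Constants

-- `margin k` becomes the expansion parameter `h`. `rounding k` is the coefficient of `t` in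
-- `4 * branchDegree h t + h * t`: the first term gives branch vertices their degree, the second
-- absorbs the additive losses.
margin rounding : ℕ → ℕ
margin k = 8 * suc k
rounding k = 4 * (2 * (margin k * margin k) + 2 * margin k + 1) + margin k

opaque
  -- The window width `N + 1`, chosen so that `t ^ 2` rounds at two units each spend the fraction
  -- `1 / margin k` of the density.
  steps : ℕ → ℕ → ℕ
  steps k t = 2 * (t * t) * margin k

  steps-def : ∀ k t → steps k t ≡ 2 * (t * t) * margin k
  steps-def k t = refl

-- The summands of `localSize` make sparsity available for windows near a centre, for balls growing
-- past legs, and for the spreading of the branch vertices.
reachLength legBound localSize : ℕ → ℕ → ℕ
reachLength k t = (t * t) * steps k t + 0
legBound k t = legLength (maxDegree t) (reachLength k t) t
localSize k t = suc (maxDegree t) ^ reachLength k t + (suc (maxDegree t) * suc (legBound k t * suc (maxDegree t) ^ reachLength k t)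
  + t * suc (maxDegree t) ^ (legBound k t + legBound k t))

localSize-reach : ∀ k t → suc (maxDegree t) ^ reachLength k t ≤ localSize k t
localSize-reach k t = m≤m+n _ _

localSize-grow : ∀ k t → suc (maxDegree t) * suc (legBound k t * suc (maxDegree t) ^ reachLength k t) ≤ localSize k t
localSize-grow k t = ≤-trans (m≤m+n _ (t * suc (maxDegree t) ^ (legBound k t + legBound k t))) (m≤n+m _ (suc (maxDegree t) ^ reachLength k t))

localSize-spread : ∀ k t → t * suc (maxDegree t) ^ (legBound k t + legBound k t) ≤ localSize k t
localSize-spread k t = ≤-trans (m≤n+m _ (suc (maxDegree t) * suc (legBound k t * suc (maxDegree t) ^ reachLength k t)))
  (m≤n+m _ (suc (maxDegree t) ^ reachLength k t))

t≤branchDegree : ∀ h t → t ≤ branchDegree h t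
t≤branchDegree h t = m≤n+m t _

pathLength : ℕ → ℕ → ℕ
pathLength k t = 22 + ((legBound k t + legBound k t + 3) + 6 * steps k t)

module _ (L : ℕ) (1≤L : 1 ≤ L) (k t : ℕ) where

  private
    ≤L : ∀ c → c ≤ c * L
    ≤L c = m≤m*n c L {{>-nonZero 1≤L}}

  clique-short : cliqueLength L * 2 ≤ pathLength k t * L
  clique-short = ≤-trans (begin
    cliqueLength L * 2 ≡⟨ eq L ⟩
    18 + 4 * L ≤⟨ +-monoˡ-≤ (4 * L) (≤L 18) ⟩
    18 * L + 4 * L ≡⟨ *-distribʳ-+ L 18 4 ⟨
    22 * L ∎) (*-monoˡ-≤ L (m≤m+n 22 ((legBound k t + legBound k t + 3) + 6 * steps k t)))
    where
    open ≤-Reasoning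
    eq : ∀ L → (2 + ((1 * suc L + 2) + (1 * suc L + 2)) + 1) * 2 ≡ 18 + 4 * L
    eq = solve-∀

  legs-short : ∀ N → suc N ≡ steps k t → let R = N * suc L + suc N ; Λ = legBound k t in
    Λ + (2 + (R + R)) + suc Λ ≤ pathLength k t * L
  legs-short N sN = begin
    Λ + (2 + (R + R)) + suc Λ ≤⟨ +-monoˡ-≤ (suc Λ) (+-monoʳ-≤ Λ (+-monoʳ-≤ 2 (+-mono-≤ R≤ R≤))) ⟩
    Λ + (2 + (3 * S * L + 3 * S * L)) + suc Λ ≡⟨ eq Λ S L ⟩
    (Λ + Λ + 3) + 6 * S * L ≤⟨ +-monoˡ-≤ (6 * S * L) (≤L (Λ + Λ + 3)) ⟩
    (Λ + Λ + 3) * L + 6 * S * L ≡⟨ *-distribʳ-+ L (Λ + Λ + 3) (6 * S) ⟨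
    (Λ + Λ + 3 + 6 * S) * L ≤⟨ *-monoˡ-≤ L (m≤n+m (Λ + Λ + 3 + 6 * S) 22) ⟩
    pathLength k t * L ∎
    where
    open ≤-Reasoning
    Λ = legBound k t
    S = steps k t
    R = N * suc L + suc N
    eq : ∀ Λ S L → Λ + (2 + (3 * S * L + 3 * S * L)) + suc Λ ≡ (Λ + Λ + 3) + 6 * S * L
    eq = solve-∀
    eq′ : ∀ S L → S * (L + L) + S * L ≡ 3 * S * L
    eq′ = solve-∀
    R≤ : R ≤ 3 * S * L
    R≤ = begin
      N * suc L + suc N ≤⟨ +-monoˡ-≤ (suc N) (*-monoˡ-≤ (suc L) (n≤1+n N)) ⟩
      suc N * suc L + suc N ≡⟨ cong (λ x → x * suc L + x) sN ⟩
      S * suc L + S ≤⟨ +-mono-≤ (*-monoʳ-≤ S (+-monoˡ-≤ L 1≤L)) (≤L S) ⟩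
      S * (L + L) + S * L ≡⟨ eq′ S L ⟩
      3 * S * L ∎

module _ (G : Graph n) (L : ℕ) (n<2^L+1 : n < 2 ^ suc L) (1≤L : 1 ≤ L) (1≤n : 1 ≤ n) (k t′ : ℕ) where

  private
    t h C : ℕ
    t = 2 + t′
    h = margin k
    C = localSize k t

  module _ (d d₀ : ℕ) (sparse : ∀ A → ∣ A ∣ ≤ C → E G A ≤ d * ∣ A ∣) (1≤d₀ : 1 ≤ d₀)
    (many : (d₀ + (t + t + 1)) * n ≤ E G full) (gap : suc h * d ≤ (7 + 8 * k) * d₀) (large : 2 * branchDegree h t ≤ d) where

    private
      t² = t * t
      1≤d : 1 ≤ d
      1≤d = ≤-trans (s≤s z≤n) (≤-trans (≤-trans (t≤branchDegree h t) (m≤m+n (branchDegree h t) _)) large)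

    -- Exactly t ^ 2 rounds lower the density from steps * d₀ to (steps - 2 t ^ 2) * d₀.
    fromBounded : ∀ H → Dense G 1 d₀ H → (∀ x → x ∈ H → deg G H x ≤ maxDegree t) → ∀ N → suc N ≡ steps k t → Linkage G t (pathLength k t * L)
    fromBounded H dH deg≤ N sN = finish (rounds t² 0 0 H H (λ _ p → p) (λ _ p → p) dense₀ (emptyWeb G) (≤-reflexive f-def) fits)
      where
      open ≤-Reasoning
      f = 2 * t² * (7 + 8 * k)
      S-def : suc N ≡ 2 * t² * h
      S-def = trans sN (steps-def k t)
      f-def : t² * 2 + f ≡ suc N
      f-def = trans (eq t² k) (≡sym S-def)
        where
        eq : ∀ t² k → t² * 2 + 2 * t² * (7 + 8 * k) ≡ 2 * t² * (8 * suc k)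
        eq = solve-∀
      gap′ : suc h * (suc N * d) ≤ h * (f * d₀)
      gap′ = begin
        suc h * (suc N * d) ≡⟨ cong (λ S → suc h * (S * d)) S-def ⟩
        suc h * (2 * t² * h * d) ≡⟨ eq₁ (suc h) (2 * t²) h d ⟩
        2 * t² * h * (suc h * d) ≤⟨ *-monoʳ-≤ (2 * t² * h) gap ⟩
        2 * t² * h * ((7 + 8 * k) * d₀) ≡⟨ eq₂ (2 * t²) h (7 + 8 * k) d₀ ⟩
        h * (f * d₀) ∎
        where
        eq₁ : ∀ a b c d → a * (b * c * d) ≡ b * c * (a * d)
        eq₁ = solve-∀
        eq₂ : ∀ a b c d → a * b * (c * d) ≡ b * (a * c * d)
        eq₂ = solve-∀
      above : suc N * d < f * d₀
      above = *-cancelˡ-< h _ _ (<-≤-trans (m<n+m (h * (suc N * d)) {suc N * d} (*-mono-≤ {1} {suc N} {1} {d} (s≤s z≤n) 1≤d)) gap′)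
      1≤N : 1 ≤ N
      1≤N = s≤s⁻¹ (≤-trans {2} (*-mono-≤ {2} {2 * t²} {1} {h} (*-mono-≤ {2} {2} {1} {t²} ≤-refl (s≤s z≤n)) (s≤s z≤n)) (≤-reflexive (≡sym S-def)))
      W≡ : t² * suc N + 0 ≡ reachLength k t
      W≡ = cong (λ S → t² * S + 0) sN
      dense₀ : Dense G (suc N) ((t² * 2 + f) * d₀) H
      dense₀ = proj₁ dH , (begin
        (t² * 2 + f) * d₀ * ∣ H ∣ ≡⟨ cong (λ S → S * d₀ * ∣ H ∣) f-def ⟩
        suc N * d₀ * ∣ H ∣ ≡⟨ *-assoc (suc N) d₀ ∣ H ∣ ⟩
        suc N * (d₀ * ∣ H ∣) ≤⟨ *-monoʳ-≤ (suc N) (proj₂ dH) ⟩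
        suc N * (1 * E G H) ≡⟨ cong (suc N *_) (*-identityˡ (E G H)) ⟩
        suc N * E G H ∎)
      fits : t² * suc N + 0 ≤ reachLength k t
      fits = ≤-reflexive W≡
      open Rounds G H (maxDegree t) deg≤ L n<2^L+1 C d sparse N 1≤N d₀ f above (reachLength k t) (localSize-reach k t)
      finish : Outcome (t² * suc N + 0) (t² + 0) → Linkage G t (pathLength k t * L)
      finish (H′ , K′ , K′⊆H′ , H′⊆H , dK′ , w) = inner (shrink G (suc N) (f * d₀) n K′ (∣∣≤n K′) dK′)
        where
        inner : ∃[ K ] K ⊆ K′ × MinDense G (suc N) (f * d₀) K → Linkage G t (pathLength k t * L)
        inner (K , K⊆K′ , md) = linkage-≤ (legs-short L 1≤L k t N sN) (legs⇒linkage G web (proj₂ found))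
          where
          web : Web G K H′ (reachLength k t) R (t * t)
          web = subst₂ (λ W t² → Web G K H′ W R t²) W≡ (+-identityʳ t²) (restrictWeb G K⊆K′ (λ _ p → p) (λ _ _ _ wk → wk) w)
          found : Σ (Fin t → Fin n) λ v → Legs G web v (legBound k t)
          found = LegSearch.legs G H′ K (λ x p → K′⊆H′ x (K⊆K′ x p)) md (maxDegree t)
            (λ x p → ≤-trans (deg-mono G H′ H H′⊆H x) (deg≤ x (H′⊆H x p))) C d sparse h t (s≤s z≤n) (s≤s z≤n) (s≤s z≤n) gap′ large web
            (localSize-grow k t) (localSize-spread k t)

    sparse⇒linkage : Linkage G t (pathLength k t * L)
    sparse⇒linkage = case findDense G 1 (cliqueDensity t) n full of λ
      { (yes (K , _ , _ , dK)) → linkage-≤ (≤-trans (m≤m*n (cliqueLength L) 2) (clique-short L 1≤L k t)) (dense⇒linkage G L n<2^L+1 t K dK)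
      ; (no none) → [ linkage-≤ (clique-short L 1≤L k t) , (λ { (H , dH , deg≤) → fromBounded H dH deg≤ (steps k t ∸ 1) steps-suc }) ]′
          (bounded-degree G L n<2^L+1 t′ (λ K → ≤-trans (≤-reflexive (≡sym (*-identityˡ (E G K))))
            (notDense G 1 (cliqueDensity t) K (λ dK → none (K , (λ _ _ → refl) , ∣∣≤n K , dK)))) d₀ 1≤d₀ 1≤n many) }
      where
      steps-suc : suc (steps k t ∸ 1) ≡ steps k t
      steps-suc = m+[n∸m]≡n (subst (1 ≤_) (≡sym (steps-def k t)) (*-mono-≤ {1} {2 * (t * t)} {1} {h} (s≤s z≤n) (s≤s z≤n)))

sizeConstant : ℕ → ℕ → ℕ
sizeConstant k t = t + t * (t * pathLength k t)

ShortSubdivision : ℕ → ℕ → Graph n → Set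
ShortSubdivision {n} t C G = ∃[ s ] (KtSubdivOfSize t s G × 2 ^ s ≤ n ^ C)

no-loops : (G : Graph 1) → E G full ≡ 0
no-loops G rewrite irref G zero = refl

-- D is (the floor of) the average degree; the threshold D′ lies below it by the factor k / (k + 1) up to rounding.
dense-part-or-subdivision : ∀ k t′ → 1 ≤ k → (G : Graph n) → 1 ≤ n → ∀ D → rounding k * (2 + t′) ≤ D → D * n ≤ E G full →
  ∃[ D′ ] k * suc D ≤ suc k * D′ × ((∃[ A ] ∣ A ∣ ≤ localSize k (2 + t′) × Dense G 1 D′ A) ⊎
    ShortSubdivision (2 + t′) (sizeConstant k (2 + t′)) G)
dense-part-or-subdivision {n} k t′ 1≤k G 1≤n D D-large many = D′ , rounded , split
  where
  open ≤-Reasoning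
  t = 2 + t′
  h = margin k
  b = branchDegree h t
  -- Dividing `D - k` instead of `D` makes `D′` at least the fraction `k / (k + 1)` of `D + 1`, and
  -- the true average degree may be anything below `D + 1`.
  r = (D ∸ k) % suc k
  y = (D ∸ k) / suc k
  D′ = k + r + y * k

  bounds : 4 * b + h * t ≤ D
  bounds = ≤-trans (≤-reflexive (eq h t)) D-large
    where
    eq : ∀ h t → 4 * ((2 * (h * h) + 2 * h) * t + t) + h * t ≡ (4 * (2 * (h * h) + 2 * h + 1) + h) * t
    eq = solve-∀

  r≤k : r ≤ k
  r≤k = s≤s⁻¹ (m%n<n (D ∸ k) (suc k))

  k≤D : k ≤ D
  k≤D = begin
    k ≤⟨ n≤1+n k ⟩
    suc k ≤⟨ m≤n*m (suc k) 8 ⟩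
    h ≤⟨ m≤m*n h t ⟩
    h * t ≤⟨ m≤n+m _ (4 * b) ⟩
    4 * b + h * t ≤⟨ bounds ⟩
    D ∎

  D-def : D ≡ k + (r + y * suc k)
  D-def = trans (≡sym (m+[n∸m]≡n k≤D)) (cong (k +_) (m≡m%n+[m/n]*n (D ∸ k) (suc k)))

  rounded : k * suc D ≤ suc k * D′
  rounded = begin
    k * suc D ≡⟨ cong (λ D → k * suc D) D-def ⟩
    k * suc (k + (r + y * suc k)) ≤⟨ m≤m+n _ r ⟩
    k * suc (k + (r + y * suc k)) + r ≡⟨ eq k r y ⟩
    suc k * D′ ∎
    where
    eq : ∀ k r y → k * suc (k + (r + y * suc k)) + r ≡ suc k * (k + r + y * k)
    eq = solve-∀

  -- As `y = D - D′`, this lets the gap to `D′` outweigh the loss of `2 t + 1` that deleting the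
  -- vertices of large degree causes in `d₀`.
  y-large : 4 * t + 3 ≤ y
  y-large = ≮⇒≥ λ lt → contradiction (begin-strict
      D ≡⟨ D-def ⟩
      k + (r + y * suc k) ≤⟨ +-monoʳ-≤ k (+-mono-≤ r≤k (*-monoˡ-≤ (suc k) (s≤s⁻¹ (≤-trans lt (≤-reflexive (+-suc (4 * t) 2)))))) ⟩
      k + (k + (4 * t + 2) * suc k) <⟨ m<m+n _ {2 + 4 * t′ * suc k + (2 * suc k)} (s≤s z≤n) ⟩
      k + (k + (4 * t + 2) * suc k) + (2 + 4 * t′ * suc k + (2 * suc k)) ≤⟨ m≤m+n _ (2 * suc k) ⟩
      k + (k + (4 * t + 2) * suc k) + (2 + 4 * t′ * suc k + (2 * suc k)) + 2 * suc k ≡⟨ eq k t′ ⟩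
      h * t ≤⟨ m≤n+m _ (4 * b) ⟩
      4 * b + h * t ≤⟨ bounds ⟩
      D ∎) (<-irrefl refl)
    where
    eq : ∀ k t′ → k + (k + (4 * (2 + t′) + 2) * suc k) + (2 + 4 * t′ * suc k + (2 * suc k)) + 2 * suc k ≡ 8 * suc k * (2 + t′)
    eq = solve-∀

  large : 2 * b ≤ D′
  large = *-cancelˡ-≤ 2 (begin
    2 * (2 * b) ≡⟨ *-assoc 2 2 b ⟨
    4 * b ≤⟨ m≤m+n (4 * b) (h * t) ⟩
    4 * b + h * t ≤⟨ bounds ⟩
    D ≡⟨ D-def ⟩
    k + (r + y * suc k) ≡⟨ eq₁ k r y ⟩
    (k + r + y * k) + y ≤⟨ +-monoʳ-≤ (k + r + y * k) (≤-trans (m≤m*n y k {{>-nonZero 1≤k}}) (m≤n+m (y * k) (k + r))) ⟩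
    D′ + D′ ≡⟨ eq₂ D′ ⟩
    2 * D′ ∎)
    where
    eq₁ : ∀ k r y → k + (r + y * suc k) ≡ (k + r + y * k) + y
    eq₁ = solve-∀
    eq₂ : ∀ x → x + x ≡ 2 * x
    eq₂ = solve-∀

  d₀ : ℕ
  d₀ = D ∸ (t + t + 1)

  d₀-def : d₀ + (t + t + 1) ≡ D
  d₀-def = m∸n+n≡m (begin
    t + t + 1 ≤⟨ m≤m+n _ (t + t + 2) ⟩
    t + t + 1 + (t + t + 2) ≡⟨ eq t ⟩
    4 * t + 3 ≤⟨ y-large ⟩
    y ≤⟨ m≤m*n y (suc k) ⟩
    y * suc k ≤⟨ ≤-trans (m≤n+m _ r) (m≤n+m _ k) ⟩
    k + (r + y * suc k) ≡⟨ D-def ⟨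
    D ∎)
    where
    eq : ∀ t → t + t + 1 + (t + t + 2) ≡ 4 * t + 3
    eq = solve-∀

  gap : suc h * D′ ≤ (7 + 8 * k) * d₀
  gap = +-cancelʳ-≤ ((7 + 8 * k) * (t + t + 1)) _ _ (begin
    suc h * D′ + (7 + 8 * k) * (t + t + 1) ≡⟨ eq₁ k r y t ⟩
    (7 + 8 * k) * D′ + 2 * y * k + (2 * k + 2 * r + (7 + 8 * k) * (t + t + 1)) ≤⟨ +-monoʳ-≤ ((7 + 8 * k) * D′ + 2 * y * k) (begin
        2 * k + 2 * r + (7 + 8 * k) * (t + t + 1) ≤⟨ +-monoˡ-≤ _ (+-monoʳ-≤ (2 * k) (*-monoʳ-≤ 2 r≤k)) ⟩
        2 * k + 2 * k + (7 + 8 * k) * (t + t + 1) ≤⟨ m≤m+n _ (14 + 7 * (t + t) + 6 * k + 4 * k * (t + t)) ⟩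
        2 * k + 2 * k + (7 + 8 * k) * (t + t + 1) + (14 + 7 * (t + t) + 6 * k + 4 * k * (t + t)) ≡⟨ eq₂ k t ⟩
        (7 + 6 * k) * (4 * t + 3) ≤⟨ *-monoʳ-≤ (7 + 6 * k) y-large ⟩
        (7 + 6 * k) * y ∎) ⟩
    (7 + 8 * k) * D′ + 2 * y * k + (7 + 6 * k) * y ≡⟨ eq₃ k r y ⟩
    (7 + 8 * k) * (k + (r + y * suc k)) ≡⟨ cong ((7 + 8 * k) *_) (trans (≡sym D-def) (≡sym d₀-def)) ⟩
    (7 + 8 * k) * (d₀ + (t + t + 1)) ≡⟨ *-distribˡ-+ (7 + 8 * k) d₀ _ ⟩
    (7 + 8 * k) * d₀ + (7 + 8 * k) * (t + t + 1) ∎)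
    where
    eq₁ : ∀ k r y t → suc (8 * suc k) * (k + r + y * k) + (7 + 8 * k) * (t + t + 1) ≡
      (7 + 8 * k) * (k + r + y * k) + 2 * y * k + (2 * k + 2 * r + (7 + 8 * k) * (t + t + 1))
    eq₁ = solve-∀
    eq₂ : ∀ k t → 2 * k + 2 * k + (7 + 8 * k) * (t + t + 1) + (14 + 7 * (t + t) + 6 * k + 4 * k * (t + t)) ≡ (7 + 6 * k) * (4 * t + 3)
    eq₂ = solve-∀
    eq₃ : ∀ k r y → (7 + 8 * k) * (k + r + y * k) + 2 * y * k + (7 + 6 * k) * y ≡ (7 + 8 * k) * (k + (r + y * suc k))
    eq₃ = solve-∀

  1≤D′ : 1 ≤ D′
  1≤D′ = ≤-trans 1≤k (≤-trans (m≤m+n k r) (m≤m+n (k + r) (y * k)))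

  1≤d₀ : 1 ≤ d₀
  1≤d₀ = *-cancelˡ-< (7 + 8 * k) 0 d₀ (≤-trans (≤-trans (≤-reflexive (cong suc (*-zeroʳ (7 + 8 * k)))) (*-mono-≤ {1} {suc h} {1} {D′} (s≤s z≤n) 1≤D′)) gap)

  1≤D : 1 ≤ D
  1≤D = ≤-trans 1≤k k≤D

  fromLinkage : ∀ L → 2 ^ L ≤ n → 1 ≤ L → Linkage G t (pathLength k t * L) → ShortSubdivision t (sizeConstant k t) G
  fromLinkage L le 1≤L Λ = let s , sub , s≤ = linkage⇒subdivision G Λ in s , sub , (begin
    2 ^ s ≤⟨ ^-monoʳ-≤ 2 (≤-trans s≤ (begin
        t + t * (t * (p * L)) ≤⟨ +-monoˡ-≤ _ (m≤m*n t L {{>-nonZero 1≤L}}) ⟩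
        t * L + t * (t * (p * L)) ≡⟨ eq t L p ⟩
        L * sizeConstant k t ∎)) ⟩
    2 ^ (L * sizeConstant k t) ≡⟨ ^-*-assoc 2 L (sizeConstant k t) ⟨
    (2 ^ L) ^ sizeConstant k t ≤⟨ ^-monoˡ-≤ (sizeConstant k t) le ⟩
    n ^ sizeConstant k t ∎)
    where
    p = pathLength k t
    eq : ∀ t L p → t * L + t * (t * (p * L)) ≡ L * (t + t * (t * p))
    eq = solve-∀

  -- A single vertex spans no edge, so `n ≥ 2`; this allows additive constants to be absorbed into
  -- multiples of `L`.
  L-positive : ∀ {n} (G : Graph n) L → n < 2 ^ suc L → 1 ≤ n → D * n ≤ E G full → 1 ≤ L
  L-positive G (suc L) _ _ _ = s≤s z≤n
  L-positive {suc zero} G zero _ _ m = contradiction (≤-trans 1≤D (≤-trans (≤-reflexive (≡sym (*-identityʳ D))) m))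
    (<⇒≱ (≤-reflexive (cong suc (no-loops G))))
  L-positive {suc (suc n)} G zero (s≤s (s≤s ())) _ _

  split : (∃[ A ] ∣ A ∣ ≤ localSize k t × Dense G 1 D′ A) ⊎ ShortSubdivision t (sizeConstant k t) G
  split = case findDense G 1 D′ (localSize k t) full of λ
    { (yes (A , _ , le , d)) → inj₁ (A , le , d)
    ; (no none) → let L , le , lt = log₂ n 1≤n ; 1≤L = L-positive G L lt 1≤n many in
        inj₂ (fromLinkage L le 1≤L (sparse⇒linkage G L lt 1≤L 1≤n k t′ D′ d₀
          (λ A small → ≤-trans (≤-reflexive (≡sym (*-identityˡ (E G A)))) (notDense G 1 D′ A (λ dA → none (A , (λ _ _ → refl) , small , dA))))
          1≤d₀ (≤-trans (≤-reflexive (cong (_* n) d₀-def)) many) gap large)) }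

-- Method of conditional expectations

prod-mono : (f g : Fin n → ℕ) → (∀ i → f i ≤ g i) → prod f ≤ prod g
prod-mono {zero} f g h = ≤-refl
prod-mono {suc n} f g h = *-mono-≤ (h zero) (prod-mono (f ∘ suc) (g ∘ suc) (h ∘ suc))

prod-cong : (f g : Fin n → ℕ) → (∀ i → f i ≡ g i) → prod f ≡ prod g
prod-cong {zero} f g h = refl
prod-cong {suc n} f g h = cong₂ _*_ (h zero) (prod-cong (f ∘ suc) (g ∘ suc) (h ∘ suc))

prod≡0 : (f : Fin n → ℕ) → prod f ≡ 0 → ∃[ i ] f i ≡ 0
prod≡0 {suc n} f p with m*n≡0⇒m≡0∨n≡0 (f zero) p
... | inj₁ q = zero , q
... | inj₂ q = let i , r = prod≡0 (f ∘ suc) q in suc i , r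

prod-split : (i : Fin n) (f g h : Fin n → ℕ) → (∀ j → i ≢ j → f j ≡ g j × f j ≡ h j) → f i ≡ g i + h i → prod f ≡ prod g + prod h
prod-split zero f g h same eq = begin
  f zero * prod (f ∘ suc) ≡⟨ cong (_* prod (f ∘ suc)) eq ⟩
  (g zero + h zero) * prod (f ∘ suc) ≡⟨ *-distribʳ-+ (prod (f ∘ suc)) (g zero) (h zero) ⟩
  g zero * prod (f ∘ suc) + h zero * prod (f ∘ suc) ≡⟨ cong₂ (λ a b → g zero * a + h zero * b)
     (prod-cong _ _ (λ j → proj₁ (same (suc j) λ ()))) (prod-cong _ _ (λ j → proj₂ (same (suc j) λ ()))) ⟩
  g zero * prod (g ∘ suc) + h zero * prod (h ∘ suc) ∎
  where open ≡-Reasoning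
prod-split (suc i) f g h same eq = begin
  f zero * prod (f ∘ suc) ≡⟨ cong (f zero *_) (prod-split i (f ∘ suc) (g ∘ suc) (h ∘ suc) (λ j ne → same (suc j) λ { refl → ne refl }) eq) ⟩
  f zero * (prod (g ∘ suc) + prod (h ∘ suc)) ≡⟨ *-distribˡ-+ (f zero) _ _ ⟩
  f zero * prod (g ∘ suc) + f zero * prod (h ∘ suc) ≡⟨ cong₂ (λ a b → a * prod (g ∘ suc) + b * prod (h ∘ suc)) (proj₁ (same zero λ ())) (proj₂ (same zero λ ())) ⟩
  g zero * prod (g ∘ suc) + h zero * prod (h ∘ suc) ∎
  where open ≡-Reasoning

prod-2^ : (f : Fin n → ℕ) → prod (λ i → 2 ^ f i) ≡ 2 ^ sum f
prod-2^ {zero} f = refl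
prod-2^ {suc n} f = trans (cong (2 ^ f zero *_) (prod-2^ (f ∘ suc))) (≡sym (^-distribˡ-+-* 2 (f zero) (sum (f ∘ suc))))

prod-indicator : (A : VSet n) (q : ℕ) → prod (λ i → if A i then q else 1) ≡ q ^ ∣ A ∣
prod-indicator {zero} A q = refl
prod-indicator {suc n} A q with A zero
... | true = cong (q *_) (prod-indicator (A ∘ suc) q)
... | false = trans (*-identityˡ _) (prod-indicator (A ∘ suc) q)

-- The variable v belongs to the clause lab v only; a clause is satisfied by an assignment giving one of its variables the
-- value s. The potential is the number of assignments satisfying all clauses c with e c = true.
blockSize : ∀ {M S} → (Fin M → Fin S) → Fin S → ℕ
blockSize lab c = ∣ (λ v → ⌊ lab v ≟ c ⌋) ∣

potential : ∀ {M S} → (Fin M → Fin S) → (Fin S → Bool) → ℕ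
potential lab e = prod (λ c → 2 ^ blockSize lab c ∸ b2n (e c))

reveal : ∀ {S} → Fin S → Bool → (Fin S → Bool) → Bool → Fin S → Bool
reveal l s e b c = e c ∧ not (⌊ l ≟ c ⌋ ∧ ⌊ b ≟ᵇ s ⌋)

-- Only the clause of the first variable changes. If it is still open, its factor `2 ^ (m + 1) - 1`
-- splits into `2 ^ m` for the satisfying value and `2 ^ m - 1` for the other.
potential-split : ∀ {M S} (lab : Fin (suc M) → Fin S) s e →
  potential lab e ≡ potential (lab ∘ suc) (reveal (lab zero) s e true) + potential (lab ∘ suc) (reveal (lab zero) s e false)
potential-split lab s e = prod-split (lab zero) _ _ _ (λ j ne → other j ne true , other j ne false) here₀
  where
  l = lab zero
  factor : (Fin _ → Bool) → Fin _ → ℕ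
  factor e c = 2 ^ blockSize (lab ∘ suc) c ∸ b2n (e c)
  other : ∀ j → l ≢ j → ∀ b → 2 ^ blockSize lab j ∸ b2n (e j) ≡ factor (reveal l s e b) j
  other j ne b with l ≟ j
  ... | yes eq = contradiction eq ne
  ... | no _ = cong (λ x → 2 ^ blockSize (lab ∘ suc) j ∸ b2n x) (≡sym (∧-true (e j)))
    where
    ∧-true : ∀ a → a ∧ true ≡ a
    ∧-true true = refl
    ∧-true false = refl
  here₀ : 2 ^ blockSize lab l ∸ b2n (e l) ≡ factor (reveal l s e true) l + factor (reveal l s e false) l
  here₀ with l ≟ l
  ... | no ne = contradiction refl ne
  ... | yes _ = two s (e l) (2 ^ blockSize (lab ∘ suc) l) (m^n>0 2 (blockSize (lab ∘ suc) l))
    where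
    two : ∀ s a y → 1 ≤ y → 2 * y ∸ b2n a ≡ (y ∸ b2n (a ∧ not (true ∧ ⌊ true ≟ᵇ s ⌋))) + (y ∸ b2n (a ∧ not (true ∧ ⌊ false ≟ᵇ s ⌋)))
    two true false y p = cong (y +_) (+-identityʳ y)
    two false false y p = cong (y +_) (+-identityʳ y)
    two true true (suc y) p = trans (cong (y +_) (+-identityʳ (suc y))) (+-comm y (suc y))
    two false true (suc y) p = cong (y +_) (+-identityʳ (suc y))

-- By averaging, one value of each variable keeps the sum of potentials below the number of
-- remaining assignments. In the end every potential is 0, which exhibits an open clause left
-- unsatisfied.
derandomize : ∀ M {F S} (lab : Fin F → Fin M → Fin S) (s : Fin F → Bool) (e : Fin F → Fin S → Bool) →
  sum (λ f → potential (lab f) (e f)) < 2 ^ M →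
  Σ (Fin M → Bool) λ x → ∀ f → ∃[ c ] e f c ≡ true × (∀ v → lab f v ≡ c → x v ≢ s f)
derandomize zero lab s e lt = (λ ()) , λ f → let c , p = prod≡0 (λ c → 2 ^ 0 ∸ b2n (e f c)) (n<1⇒n≡0 (≤-<-trans (term≤sum (λ f → potential (lab f) (e f)) f) lt)) in
  c , zero-factor (e f c) p , λ ()
  where
  zero-factor : ∀ a → 1 ∸ b2n a ≡ 0 → a ≡ true
  zero-factor true _ = refl
derandomize (suc M) {F} {S} lab s e lt = pick (total true <? 2 ^ M)
  where
  e′ : Bool → Fin F → Fin S → Bool
  e′ b f = reveal (lab f zero) (s f) (e f) b
  total : Bool → ℕ
  total b = sum (λ f → potential (lab f ∘ suc) (e′ b f))
  totals : total true + total false < 2 ^ M + 2 ^ M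
  totals = subst₂ _<_ (trans (sum-cong-≗ (λ f → potential-split (lab f) (s f) (e f)))
      (∑-distrib-+ (λ f → potential (lab f ∘ suc) (e′ true f)) (λ f → potential (lab f ∘ suc) (e′ false f)))) (cong (2 ^ M +_) (+-identityʳ (2 ^ M))) lt
  extend : ∀ b → total b < 2 ^ M → Σ (Fin (suc M) → Bool) λ x → ∀ f → ∃[ c ] e f c ≡ true × (∀ v → lab f v ≡ c → x v ≢ s f)
  extend b lt′ with derandomize M (λ f → lab f ∘ suc) s (e′ b) lt′
  ... | x , h = (λ { zero → b ; (suc v) → x v }) , λ f → let c , p , q = h f ; a , d = ∧-elim (e f c) _ p in c , a ,
    λ { zero eq bs → not-elim d (∧-intro (⌊⌋-intro {d = lab f zero ≟ c} eq) (⌊⌋-intro {d = b ≟ᵇ s f} bs)) ; (suc v) → q v }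
  pick : Dec (total true < 2 ^ M) → Σ (Fin (suc M) → Bool) λ x → ∀ f → ∃[ c ] e f c ≡ true × (∀ v → lab f v ≡ c → x v ≢ s f)
  pick (yes p) = extend true p
  pick (no p) = extend false (+-cancelˡ-< (2 ^ M) _ _ (≤-<-trans (+-monoˡ-≤ (total false) (≮⇒≥ p)) totals))

sum-blocks : ∀ {M S} (lab : Fin M → Fin S) → sum (blockSize lab) ≤ M
sum-blocks {M} {S} lab = begin
  ∣∣₂ (λ c v → ⌊ lab v ≟ c ⌋) ≡⟨ ∣∣₂-swap (λ c v → ⌊ lab v ≟ c ⌋) ⟩
  sum (λ v → ∣ ⁅ lab v ⁆ ∣) ≤⟨ sum-mono _ (λ _ → 1) (λ v → ∣⁅⁆∣≤1 (lab v)) ⟩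
  sum {M} (λ _ → 1) ≡⟨ trans (sum-const M 1) (*-identityʳ M) ⟩
  M ∎
  where open ≤-Reasoning

-- A clause whose block has at most `q + 1` assignments is satisfied with probability at most
-- `q / (q + 1)`. The clauses are independent, as no variable belongs to two of them.
potential-bound : ∀ {M S} (lab : Fin M → Fin S) e q → (∀ c → e c ≡ true → 2 ^ blockSize lab c ≤ suc q) →
  suc q ^ ∣ e ∣ * potential lab e ≤ q ^ ∣ e ∣ * 2 ^ M
potential-bound {M} lab e q small = begin
  suc q ^ ∣ e ∣ * potential lab e ≡⟨ cong (_* potential lab e) (prod-indicator e (suc q)) ⟨
  prod (λ c → if e c then suc q else 1) * potential lab e ≡⟨ prod-distrib-* (λ c → if e c then suc q else 1) (λ c → 2 ^ blockSize lab c ∸ b2n (e c)) ⟨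
  prod (λ c → (if e c then suc q else 1) * (2 ^ blockSize lab c ∸ b2n (e c))) ≤⟨ prod-mono _ _ (λ c → factor (e c) (2 ^ blockSize lab c) (small c)) ⟩
  prod (λ c → (if e c then q else 1) * 2 ^ blockSize lab c) ≡⟨ prod-distrib-* (λ c → if e c then q else 1) (λ c → 2 ^ blockSize lab c) ⟩
  prod (λ c → if e c then q else 1) * prod (λ c → 2 ^ blockSize lab c) ≡⟨ cong₂ _*_ (prod-indicator e q) (prod-2^ (blockSize lab)) ⟩
  q ^ ∣ e ∣ * 2 ^ sum (blockSize lab) ≤⟨ *-monoʳ-≤ (q ^ ∣ e ∣) (^-monoʳ-≤ 2 (sum-blocks lab)) ⟩
  q ^ ∣ e ∣ * 2 ^ M ∎
  where
  open ≤-Reasoning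
  factor : ∀ a y → (a ≡ true → y ≤ suc q) → (if a then suc q else 1) * (y ∸ b2n a) ≤ (if a then q else 1) * y
  factor false y h = ≤-refl
  factor true zero h = ≤-reflexive (trans (*-zeroʳ q) (≡sym (*-zeroʳ q)))
  factor true (suc y) h = begin
    suc q * y ≡⟨⟩
    y + q * y ≤⟨ +-monoˡ-≤ (q * y) (s≤s⁻¹ (h refl)) ⟩
    q + q * y ≡⟨ *-suc q y ⟨
    q * suc y ∎

sum-++ : ∀ m (f : Fin (m + n) → ℕ) → sum f ≡ sum (λ i → f (i ↑ˡ n)) + sum (λ j → f (m ↑ʳ j))
sum-++ zero f = refl
sum-++ (suc m) f = trans (cong (f zero +_) (sum-++ m (f ∘ suc))) (≡sym (+-assoc (f zero) _ _))

sum-combine : ∀ m {n} (f : Fin (m * n) → ℕ) → sum f ≡ sum (λ i → sum (λ j → f (combine {m} {n} i j)))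
sum-combine zero f = refl
sum-combine (suc m) {n} f = trans (sum-++ n f) (cong (sum (λ j → f (j ↑ˡ m * n)) +_) (sum-combine m (λ k → f (n ↑ʳ k))))

∣∣₂-product : (A B : VSet n) → ∣∣₂ (λ u v → A u ∧ B v) ≡ ∣ A ∣ * ∣ B ∣
∣∣₂-product A B = trans (sum-cong-≗ (λ u → row (A u))) (trans (≡sym (*-distribˡ-sum ∣ B ∣ (b2n ∘ A))) (*-comm ∣ B ∣ ∣ A ∣))
  where
  row : ∀ a → sum (λ v → b2n (a ∧ B v)) ≡ ∣ B ∣ * b2n a
  row true = ≡sym (*-identityʳ ∣ B ∣)
  row false = trans (sum-zero (λ v → b2n (false ∧ B v)) (λ _ → refl)) (≡sym (*-zeroʳ ∣ B ∣))

-- Clauses of a vertex colouring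

_<ˢ_ : Fin n → Fin n → Bool
u <ˢ v = toℕ u <ᵇ toℕ v

-- Colour 0 marks unused vertices. The clause of two colours says that some edge joins the two colour classes; only pairs
-- of small classes are counted. The clause zero collects the irrelevant variables.
module Colouring (r t N : ℕ) (β : Fin N → Fin (suc t)) where

  class : Fin (suc t) → VSet N
  class a u = ⌊ β u ≟ a ⌋

  small : VSet (suc t)
  small zero = false
  small a@(suc _) = ⌊ ∣ class a ∣ ≤? 2 * r ⌋

  clause : Fin (suc t) → Fin (suc t) → Fin (suc (suc t * suc t))
  clause a b = suc (if a <ˢ b then combine a b else combine b a)

  label₂ : Fin N → Fin N → Fin (suc (suc t * suc t))
  label₂ u v = if u <ˢ v then clause (β u) (β v) else zero

  label : Fin (N * N) → Fin (suc (suc t * suc t))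
  label k = let u , v = remQuot {N} N k in label₂ u v

  label-combine : ∀ u v → label (combine u v) ≡ label₂ u v
  label-combine u v = cong (λ p → label₂ (proj₁ p) (proj₂ p)) (remQuot-combine {N} {N} u v)

  open₂ : Fin (suc t) → Fin (suc t) → Bool
  open₂ a b = (small a ∧ small b) ∧ (a <ˢ b)

  open′ : Fin (suc (suc t * suc t)) → Bool
  open′ zero = false
  open′ (suc c) = let a , b = remQuot {suc t} (suc t) c in open₂ a b

  open-combine : ∀ a b → open′ (suc (combine a b)) ≡ open₂ a b
  open-combine a b = cong (λ p → open₂ (proj₁ p) (proj₂ p)) (remQuot-combine {suc t} {suc t} a b)

  small-class : ∀ a → small a ≡ true → ∣ class a ∣ ≤ 2 * r
  small-class (suc a) p = ⌊⌋-elim (∣ class (suc a) ∣ ≤? 2 * r) p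

  block-bound : ∀ a b → small a ≡ true → small b ≡ true → blockSize label (suc (combine a b)) ≤ 8 * (r * r)
  block-bound a b sa sb = begin
    blockSize label c ≡⟨ sum-combine N {N} (λ k → b2n ⌊ label k ≟ c ⌋) ⟩
    ∣∣₂ (λ u v → ⌊ label (combine {N} {N} u v) ≟ c ⌋) ≤⟨ ∣∣₂-cover (λ u v → ⌊ label (combine {N} {N} u v) ≟ c ⌋) (λ u v → class a u ∧ class b v) (λ u v → class b u ∧ class a v) classes ⟩
    ∣∣₂ (λ u v → class a u ∧ class b v) + ∣∣₂ (λ u v → class b u ∧ class a v) ≡⟨ cong₂ _+_ (∣∣₂-product (class a) (class b)) (∣∣₂-product (class b) (class a)) ⟩
    ∣ class a ∣ * ∣ class b ∣ + ∣ class b ∣ * ∣ class a ∣ ≤⟨ +-mono-≤ (*-mono-≤ (small-class a sa) (small-class b sb)) (*-mono-≤ (small-class b sb) (small-class a sa)) ⟩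
    2 * r * (2 * r) + 2 * r * (2 * r) ≡⟨ eq r ⟩
    8 * (r * r) ∎
    where
    open ≤-Reasoning
    c = suc (combine a b)
    eq : ∀ r → 2 * r * (2 * r) + 2 * r * (2 * r) ≡ 8 * (r * r)
    eq = solve-∀
    classes₂ : ∀ u v → label₂ u v ≡ c → (β u ≡ a × β v ≡ b) ⊎ (β u ≡ b × β v ≡ a)
    classes₂ u v p with u <ˢ v
    ... | true with β u <ˢ β v
    ... | true = inj₁ (combine-inj _ _ _ _ (suc-injectiveᶠ p))
    ... | false = let x , y = combine-inj (β v) (β u) a b (suc-injectiveᶠ p) in inj₂ (y , x)
    classes : ∀ u v → ⌊ label (combine {N} {N} u v) ≟ c ⌋ ≡ true → (class a u ∧ class b v) ≡ true ⊎ (class b u ∧ class a v) ≡ true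
    classes u v p with classes₂ u v (trans (≡sym (label-combine u v)) (⌊⌋-elim (label (combine {N} {N} u v) ≟ c) p))
    ... | inj₁ (x , y) = inj₁ (∧-intro (⌊⌋-intro {d = β u ≟ a} x) (⌊⌋-intro {d = β v ≟ b} y))
    ... | inj₂ (x , y) = inj₂ (∧-intro (⌊⌋-intro {d = β u ≟ b} x) (⌊⌋-intro {d = β v ≟ a} y))

  open-elim : ∀ c → open′ c ≡ true → ∃[ a ] ∃[ b ] c ≡ suc (combine a b) × small a ≡ true × small b ≡ true × (a <ˢ b) ≡ true
  open-elim (suc c) p = let a , b = remQuot {suc t} (suc t) c
                            ss , lt = ∧-elim (small a ∧ small b) (a <ˢ b) p
                            sa , sb = ∧-elim (small a) (small b) ss in
    a , b , cong suc (≡sym (combine-remQuot {suc t} (suc t) c)) , sa , sb , lt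

  block≤ : ∀ c → open′ c ≡ true → blockSize label c ≤ 8 * (r * r)
  block≤ c p = let a , b , eq , sa , sb , _ = open-elim c p in subst (λ c → blockSize label c ≤ 8 * (r * r)) (≡sym eq) (block-bound a b sa sb)

  -- A big class has more than `2 r` of the at most `r t` vertices, so at most half of the `t`
  -- colours are big.
  many-small : 1 ≤ r → N ≤ r * t → t ≤ 2 * ∣ small ∣
  many-small 1≤r N≤ = +-cancelˡ-≤ (2 * ∣ big ∣) _ _ (begin
    2 * ∣ big ∣ + t ≤⟨ +-monoˡ-≤ t big≤ ⟩
    t + t ≡⟨ cong (t +_) (≡sym (+-identityʳ t)) ⟩
    2 * t ≤⟨ *-monoʳ-≤ 2 (s≤s⁻¹ total) ⟩
    2 * (∣ big ∣ + ∣ small ∣) ≡⟨ *-distribˡ-+ 2 ∣ big ∣ ∣ small ∣ ⟩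
    2 * ∣ big ∣ + 2 * ∣ small ∣ ∎)
    where
    open ≤-Reasoning
    big : VSet (suc t)
    big a = ⌊ suc (2 * r) ≤? ∣ class a ∣ ⌋
    total : suc t ≤ suc (∣ big ∣ + ∣ small ∣)
    total = begin
      suc t ≡⟨ trans (sum-const (suc t) 1) (*-identityʳ (suc t)) ⟨
      ∣ (λ (_ : Fin (suc t)) → true) ∣ ≤⟨ ∣∣-cover (λ (_ : Fin (suc t)) → true) ⁅ zero ⁆ (big ∪ small) (λ { zero _ → inj₁ refl ; (suc a) _ → inj₂ (either a) }) ⟩
      ∣ ⁅ zero {t} ⁆ ∣ + ∣ big ∪ small ∣ ≤⟨ +-mono-≤ (∣⁅⁆∣≤1 (zero {t})) (∣∣-cover (big ∪ small) big small (λ x → ∨-elim (big x) _)) ⟩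
      suc (∣ big ∣ + ∣ small ∣) ∎
      where
      either : ∀ a → (big ∪ small) (suc a) ≡ true
      either a = case ∣ class (suc a) ∣ ≤? 2 * r of λ
        { (yes p) → ∨-introʳ (big (suc a)) (⌊⌋-intro p) ; (no p) → ∨-introˡ (small (suc a)) (⌊⌋-intro (≰⇒> p)) }
    big≤ : 2 * ∣ big ∣ ≤ t
    big≤ = *-cancelˡ-≤ r {{>-nonZero 1≤r}} (begin
      r * (2 * ∣ big ∣) ≡⟨ eq r ∣ big ∣ ⟩
      2 * r * ∣ big ∣ ≡⟨ *-distribˡ-sum (2 * r) (b2n ∘ big) ⟩
      sum (λ a → 2 * r * b2n (big a)) ≤⟨ sum-mono _ (λ a → ∣ class a ∣) (λ a → weight (suc (2 * r) ≤? ∣ class a ∣)) ⟩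
      sum (λ a → ∣ class a ∣) ≤⟨ sum-blocks β ⟩
      N ≤⟨ N≤ ⟩
      r * t ∎)
      where
      eq : ∀ r x → r * (2 * x) ≡ 2 * r * x
      eq = solve-∀
      weight : ∀ {x} (p : Dec (suc (2 * r) ≤ x)) → 2 * r * b2n ⌊ p ⌋ ≤ x
      weight (yes p) = ≤-trans (≤-reflexive (*-identityʳ (2 * r))) (<⇒≤ p)
      weight (no p) = ≤-trans (≤-reflexive (*-zeroʳ (2 * r))) z≤n

  many-open : ∣ small ∣ * ∣ small ∣ ≤ 2 * ∣ open′ ∣ + ∣ small ∣
  many-open = begin
    ∣ small ∣ * ∣ small ∣ ≡⟨ ∣∣₂-product small small ⟨
    ∣∣₂ (λ a b → small a ∧ small b) ≤⟨ ∣∣₂-cover (λ a b → small a ∧ small b) (λ a b → open₂ a b ∨ open₂ b a) (λ a b → small a ∧ ⌊ a ≟ b ⌋) pairs ⟩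
    ∣∣₂ (λ a b → open₂ a b ∨ open₂ b a) + ∣∣₂ (λ a b → small a ∧ ⌊ a ≟ b ⌋) ≤⟨ +-mono-≤ (∣∣₂-cover _ open₂ (λ a b → open₂ b a) (λ a b → ∨-elim (open₂ a b) _))
        (≤-trans (∣∣₂-rows small (λ a b → ⌊ a ≟ b ⌋) 1 (λ a _ → ∣⁅⁆∣≤1 a)) (≤-reflexive (*-identityˡ ∣ small ∣))) ⟩
    ∣∣₂ open₂ + ∣∣₂ (λ a b → open₂ b a) + ∣ small ∣ ≡⟨ cong (λ x → ∣∣₂ open₂ + x + ∣ small ∣) (∣∣₂-swap open₂) ⟨
    ∣∣₂ open₂ + ∣∣₂ open₂ + ∣ small ∣ ≡⟨ cong (λ x → x + ∣ small ∣) (cong (∣∣₂ open₂ +_) (≡sym (+-identityʳ (∣∣₂ open₂)))) ⟩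
    2 * ∣∣₂ open₂ + ∣ small ∣ ≡⟨ cong (λ x → 2 * x + ∣ small ∣) count-open ⟨
    2 * ∣ open′ ∣ + ∣ small ∣ ∎
    where
    open ≤-Reasoning
    count-open : ∣ open′ ∣ ≡ ∣∣₂ open₂
    count-open = trans (sum-combine (suc t) {suc t} (λ c → b2n (open′ (suc c)))) (sum-cong-≗ λ a → sum-cong-≗ λ b → cong b2n (open-combine a b))
    pairs : ∀ a b → small a ∧ small b ≡ true → open₂ a b ∨ open₂ b a ≡ true ⊎ small a ∧ ⌊ a ≟ b ⌋ ≡ true
    pairs a b p with <-cmp (toℕ a) (toℕ b) | ∧-elim (small a) (small b) p
    ... | tri< lt _ _ | _ = inj₁ (∨-introˡ _ (∧-intro p (<ᵇ-intro lt)))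
    ... | tri≈ _ eq _ | sa , _ = inj₂ (∧-intro sa (⌊⌋-intro (toℕ-injective eq)))
    ... | tri> _ _ gt | sa , sb = inj₁ (∨-introʳ (open₂ a b) (∧-intro (∧-intro sb sa) (<ᵇ-intro gt)))

  many-open-clauses : 1 ≤ r → N ≤ r * t → 3 ≤ t → t * t ≤ 16 * ∣ open′ ∣
  many-open-clauses 1≤r N≤ 3≤t = begin
    t * t ≤⟨ *-mono-≤ (many-small 1≤r N≤) (many-small 1≤r N≤) ⟩
    2 * s * (2 * s) ≡⟨ eq₁ s ⟩
    4 * (s * s) ≤⟨ *-monoʳ-≤ 4 (+-cancelʳ-≤ (s * s) _ _ (begin
      s * s + s * s ≡⟨ eq₂ (s * s) ⟩
      2 * (s * s) ≤⟨ *-monoʳ-≤ 2 many-open ⟩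
      2 * (2 * m + s) ≡⟨ eq₃ m s ⟩
      4 * m + 2 * s ≤⟨ +-monoʳ-≤ (4 * m) (*-monoˡ-≤ s 2≤s) ⟩
      4 * m + s * s ∎)) ⟩
    4 * (4 * m) ≡⟨ *-assoc 4 4 m ⟨
    16 * m ∎
    where
    open ≤-Reasoning
    s = ∣ small ∣
    m = ∣ open′ ∣
    eq₁ : ∀ s → 2 * s * (2 * s) ≡ 4 * (s * s)
    eq₁ = solve-∀
    eq₂ : ∀ s → s + s ≡ 2 * s
    eq₂ = solve-∀
    eq₃ : ∀ m s → 2 * (2 * m + s) ≡ 4 * m + 2 * s
    eq₃ = solve-∀
    2≤s : 2 ≤ s
    2≤s = *-cancelˡ-< 2 1 s (≤-trans 3≤t (many-small 1≤r N≤))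

sign : Fin 2 → Bool
sign zero = true
sign (suc _) = false

edges≡ : (G : Graph n) → edges G ≡ ∣∣₂ (λ u v → (u <ˢ v) ∧ adj G u v)
edges≡ {n} G = trans (lsum-allFin (λ u → count (λ v → (u <ˢ v) ∧ adj G u v))) (sum-cong-≗ λ u → lsum-allFin (λ v → b2n ((u <ˢ v) ∧ adj G u v)))

handshake : (G : Graph n) → 2 * edges G ≡ E G full
handshake {n} G = begin
  2 * edges G ≡⟨ cong (2 *_) (edges≡ G) ⟩
  2 * ∣∣₂ up ≡⟨ cong (∣∣₂ up +_) (+-identityʳ (∣∣₂ up)) ⟩
  ∣∣₂ up + ∣∣₂ up ≡⟨ cong (∣∣₂ up +_) (∣∣₂-swap up) ⟩
  ∣∣₂ up + ∣∣₂ down ≡⟨ ≤-antisym (∣∣₂-disjoint up down (adj G) disjoint (λ u v p → ∧ʳ (u <ˢ v) p) (λ u v p → adj-sym G (∧ʳ (v <ˢ u) p)))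
                               (∣∣₂-cover (adj G) up down cover) ⟩
  ∣∣₂ (adj G) ∎
  where
  open ≡-Reasoning
  up down : Fin n → Fin n → Bool
  up u v = (u <ˢ v) ∧ adj G u v
  down u v = (v <ˢ u) ∧ adj G v u
  disjoint : ∀ u v → up u v ≡ true → down u v ≡ true → ⊥
  disjoint u v p q = <-asym (<ᵇ-elim {toℕ u} (∧ˡ (u <ˢ v) p)) (<ᵇ-elim {toℕ v} (∧ˡ (v <ˢ u) q))
  cover : ∀ u v → adj G u v ≡ true → up u v ≡ true ⊎ down u v ≡ true
  cover u v e with <-cmp (toℕ u) (toℕ v)
  ... | tri< lt _ _ = inj₁ (∧-intro (<ᵇ-intro lt) e)
  ... | tri> _ _ gt = inj₂ (∧-intro (<ᵇ-intro gt) (adj-sym G e))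
  ... | tri≈ _ eq _ = contradiction (subst (λ w → adj G u w ≡ true) (≡sym (toℕ-injective eq)) e) (adj-irr G)

-- Rational inequalities reduced to natural numbers

toℚᵘ-ℕ : ∀ a → ℚ.toℚᵘ (ℕ→ℚ a) ℚᵘ.≃ mkℚᵘ (ℤ.+ a) 0
toℚᵘ-ℕ a = ℚ.toℚᵘ-fromℚᵘ (mkℚᵘ (ℤ.+ a) 0)

avgDeg-intro : (G : Graph n) → 1 ≤ n → ∀ a → a * n ≤ E G full → AvgDeg≥ G (ℕ→ℚ a)
avgDeg-intro {n} G 1≤n a le = 1≤n , ℚ.toℚᵘ-cancel-≤ (begin
  ℚ.toℚᵘ (ℕ→ℚ a ℚ.* ℕ→ℚ n) ≃⟨ ℚ.toℚᵘ-homo-* (ℕ→ℚ a) (ℕ→ℚ n) ⟩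
  ℚ.toℚᵘ (ℕ→ℚ a) ℚᵘ.* ℚ.toℚᵘ (ℕ→ℚ n) ≃⟨ ℚᵘ.*-cong (toℚᵘ-ℕ a) (toℚᵘ-ℕ n) ⟩
  mkℚᵘ (ℤ.+ a) 0 ℚᵘ.* mkℚᵘ (ℤ.+ n) 0 ≤⟨ ℚᵘ.*≤* (subst₂ ℤ._≤_ (trans (ℤ.pos-* a n) (≡sym (ℤ.*-identityʳ (ℤ.+ a ℤ.* ℤ.+ n)))) (≡sym (ℤ.*-identityʳ (ℤ.+ (2 * edges G))))
      (ℤ.+≤+ (≤-trans le (≤-reflexive (≡sym (handshake G)))))) ⟩
  mkℚᵘ (ℤ.+ (2 * edges G)) 0 ≃⟨ toℚᵘ-ℕ (2 * edges G) ⟨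
  ℚ.toℚᵘ (ℕ→ℚ (2 * edges G)) ∎)
  where open ℚᵘ.≤-Reasoning

ScaledBound : ℚ → ℕ → Set
ScaledBound ε k = ∀ a e n → k * e < suc k * a * n → ℕ→ℚ e ℚ.< (1ℚ ℚ.+ ε) ℚ.* ℕ→ℚ a ℚ.* ℕ→ℚ n

-- The numerator of ε plays no role: ε ≥ 1 / k for its denominator k.
inverse-bound : ∀ ε → 0ℚ ℚ.< ε → ∃[ k ] 1 ≤ k × ScaledBound ε k
inverse-bound ε pos = fromPositive ε (ℚ.positive pos)
  where
  fromPositive : ∀ ε → ℚ.Positive ε → ∃[ k ] 1 ≤ k × ScaledBound ε k
  fromPositive ε@(mkℚ ℤ.+[1+ p ] d _) _ = suc d , s≤s z≤n , λ a e n lt → ℚ.toℚᵘ-cancel-< (begin-strict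
    ℚ.toℚᵘ (ℕ→ℚ e) ≃⟨ toℚᵘ-ℕ e ⟩
    mkℚᵘ (ℤ.+ e) 0 <⟨ ℚᵘ.*<* (subst₂ ℤ._<_ (ℤ.pos-* e (↧ₙ value a n)) (numerator a n) (ℤ.+<+ (bound a e n lt))) ⟩
    value a n ≃⟨ ℚᵘ.*-cong (ℚᵘ.*-cong (ℚᵘ.≃-refl {1ℚᵘ ℚᵘ.+ ℚ.toℚᵘ ε}) (toℚᵘ-ℕ a)) (toℚᵘ-ℕ n) ⟨
    (1ℚᵘ ℚᵘ.+ ℚ.toℚᵘ ε) ℚᵘ.* ℚ.toℚᵘ (ℕ→ℚ a) ℚᵘ.* ℚ.toℚᵘ (ℕ→ℚ n) ≃⟨ ℚᵘ.*-congʳ {ℚ.toℚᵘ (ℕ→ℚ n)} (ℚᵘ.*-congʳ {ℚ.toℚᵘ (ℕ→ℚ a)} (ℚ.toℚᵘ-homo-+ 1ℚ ε)) ⟨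
    ℚ.toℚᵘ (1ℚ ℚ.+ ε) ℚᵘ.* ℚ.toℚᵘ (ℕ→ℚ a) ℚᵘ.* ℚ.toℚᵘ (ℕ→ℚ n) ≃⟨ ℚᵘ.*-congʳ {ℚ.toℚᵘ (ℕ→ℚ n)} (ℚ.toℚᵘ-homo-* (1ℚ ℚ.+ ε) (ℕ→ℚ a)) ⟨
    ℚ.toℚᵘ ((1ℚ ℚ.+ ε) ℚ.* ℕ→ℚ a) ℚᵘ.* ℚ.toℚᵘ (ℕ→ℚ n) ≃⟨ ℚ.toℚᵘ-homo-* ((1ℚ ℚ.+ ε) ℚ.* ℕ→ℚ a) (ℕ→ℚ n) ⟨
    ℚ.toℚᵘ ((1ℚ ℚ.+ ε) ℚ.* ℕ→ℚ a ℚ.* ℕ→ℚ n) ∎)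
    where
    open ℚᵘ.≤-Reasoning
    value : ℕ → ℕ → ℚᵘ.ℚᵘ
    value a n = (1ℚᵘ ℚᵘ.+ mkℚᵘ ℤ.+[1+ p ] d) ℚᵘ.* mkℚᵘ (ℤ.+ a) 0 ℚᵘ.* mkℚᵘ (ℤ.+ n) 0
    x : ℕ
    x = suc d + suc p
    factor : ℤ.+ x ≡ ℤ.+ 1 ℤ.* ℤ.+[1+ d ] ℤ.+ ℤ.+[1+ p ] ℤ.* ℤ.+ 1
    factor = ≡sym (cong₂ ℤ._+_ (ℤ.*-identityˡ ℤ.+[1+ d ]) (ℤ.*-identityʳ ℤ.+[1+ p ]))
    numerator : ∀ a n → ℤ.+ (x * a * n) ≡ (ℤ.+ 1 ℤ.* ℤ.+[1+ d ] ℤ.+ ℤ.+[1+ p ] ℤ.* ℤ.+ 1) ℤ.* ℤ.+ a ℤ.* ℤ.+ n ℤ.* ℤ.+ 1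
    numerator a n = trans (trans (ℤ.pos-* (x * a) n) (cong (ℤ._* ℤ.+ n) (trans (ℤ.pos-* x a) (cong (ℤ._* ℤ.+ a) factor)))) (≡sym (ℤ.*-identityʳ _))
    bound : ∀ a e n → suc d * e < suc (suc d) * a * n → e * ↧ₙ value a n < x * a * n
    bound a e n lt = <-≤-trans (≤-trans (≤-reflexive (cong suc (eq d e))) lt)
      (*-monoˡ-≤ n (*-monoˡ-≤ a (≤-trans (≤-reflexive (+-comm 1 (suc d))) (+-monoʳ-≤ (suc d) (s≤s z≤n)))))
      where
      eq : ∀ d e → e * (1 * suc d * 1 * 1) ≡ suc d * e
      eq = solve-∀

-- Dense graphs without a K_t minor

coin : ∀ N → (Fin (N * N) → Bool) → Bool → Graph N
coin N x s = record { adj = a ; sym = a-sym ; irref = a-irr }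
  where
  a : Fin N → Fin N → Bool
  a u v = if u <ˢ v then ⌊ x (combine u v) ≟ᵇ s ⌋ else if v <ˢ u then ⌊ x (combine v u) ≟ᵇ s ⌋ else false
  a-sym : ∀ u v → a u v ≡ a v u
  a-sym u v with u <ˢ v in e₁ | v <ˢ u in e₂
  ... | true | true = contradiction (<ᵇ-elim {toℕ v} e₂) (<-asym (<ᵇ-elim {toℕ u} e₁))
  ... | true | false = refl
  ... | false | true = refl
  ... | false | false = refl
  a-irr : ∀ v → a v v ≡ false
  a-irr v with v <ˢ v in e
  ... | true = contradiction (<ᵇ-elim {toℕ v} e) (<-irrefl refl)
  ... | false = refl

coin-up : ∀ {N} x s (u v : Fin N) → toℕ u < toℕ v → adj (coin N x s) u v ≡ ⌊ x (combine u v) ≟ᵇ s ⌋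
coin-up x s u v lt rewrite <ᵇ-intro lt = refl

coinSize : ∀ N → (Fin (N * N) → Bool) → Bool → ℕ
coinSize N x s = E (coin N x s) full

coin-dense : ∀ N x → N * N ≤ coinSize N x true + (coinSize N x false + N)
coin-dense N x = begin
  N * N ≡⟨ cong₂ _*_ (≡sym size) (≡sym size) ⟩
  ∣ full {N} ∣ * ∣ full {N} ∣ ≡⟨ ∣∣₂-product (full {N}) (full {N}) ⟨
  ∣∣₂ {N} {N} (λ u v → full u ∧ full v) ≤⟨ ∣∣₂-cover (λ u v → full {N} u ∧ full {N} v) (adj (coin N x true)) (λ u v → adj (coin N x false) u v ∨ ⌊ u ≟ v ⌋) cover ⟩
  coinSize N x true + ∣∣₂ (λ u v → adj (coin N x false) u v ∨ ⌊ u ≟ v ⌋) ≤⟨ +-monoʳ-≤ (coinSize N x true) (∣∣₂-cover (λ u v → adj (coin N x false) u v ∨ ⌊ u ≟ v ⌋) (adj (coin N x false)) (λ u v → ⌊ u ≟ v ⌋) (λ u v → ∨-elim (adj (coin N x false) u v) _)) ⟩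
  coinSize N x true + (coinSize N x false + ∣∣₂ {N} (λ u v → ⌊ u ≟ v ⌋)) ≤⟨ +-monoʳ-≤ (coinSize N x true) (+-monoʳ-≤ (coinSize N x false) diagonal) ⟩
  coinSize N x true + (coinSize N x false + N) ∎
  where
  open ≤-Reasoning
  size : ∣ full {N} ∣ ≡ N
  size = trans (sum-const N 1) (*-identityʳ N)
  diagonal : ∣∣₂ {N} (λ u v → ⌊ u ≟ v ⌋) ≤ N
  diagonal = ≤-trans (∣∣₂-rows (full {N}) (λ u v → ⌊ u ≟ v ⌋) 1 (λ u _ → ∣⁅⁆∣≤1 u)) (≤-reflexive (trans (*-identityˡ _) size))
  one : ∀ u v → toℕ u < toℕ v → adj (coin N x true) u v ≡ true ⊎ adj (coin N x false) u v ≡ true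
  one u v lt = case x (combine u v) ≟ᵇ true of λ
    { (yes p) → inj₁ (trans (coin-up x true u v lt) (⌊⌋-intro p))
    ; (no p) → inj₂ (trans (coin-up x false u v lt) (⌊⌋-intro (¬-not p))) }
  cover : ∀ u v → full u ∧ full v ≡ true → adj (coin N x true) u v ≡ true ⊎ adj (coin N x false) u v ∨ ⌊ u ≟ v ⌋ ≡ true
  cover u v _ with <-cmp (toℕ u) (toℕ v)
  ... | tri< lt _ _ = [ inj₁ , (λ p → inj₂ (∨-introˡ _ p)) ]′ (one u v lt)
  ... | tri≈ _ eq _ = inj₂ (∨-introʳ (adj (coin N x false) u v) (⌊⌋-intro (toℕ-injective eq)))
  ... | tri> _ _ gt = [ (λ p → inj₁ (adj-sym (coin N x true) {v} {u} p)) , (λ p → inj₂ (∨-introˡ _ (adj-sym (coin N x false) {v} {u} p))) ]′ (one v u gt)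

module _ (r t N : ℕ) where

  decode : Fin (suc t ^ N) → Fin N → Fin (suc t)
  decode = finToFun {suc t} {N}

  Fools : (Fin (N * N) → Bool) → Bool → (Fin N → Fin (suc t)) → Set
  Fools x s β = let open Colouring r t N β in ∃[ c ] open′ c ≡ true × (∀ v → label v ≡ c → x v ≢ s)

  fooled⇒no-minor : ∀ x s → (∀ k → Fools x s (decode k)) → ¬ KtMinorWithin t N (coin N x s)
  fooled⇒no-minor x s fools (β , _ , _ , joined , _) = refute (fools k)
    where
    colour : Maybe (Fin t) → Fin (suc t)
    colour nothing = zero
    colour (just i) = suc i
    k = funToFin (colour ∘ β)
    open Colouring r t N (decode k)
    β≡ : ∀ u → decode k u ≡ colour (β u)
    β≡ = finToFun-funToFin (colour ∘ β)
    nonzero : ∀ a → small a ≡ true → ∃[ i ] a ≡ suc i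
    nonzero (suc i) _ = i , refl
    coloured : ∀ {u i} → β u ≡ just i → decode k u ≡ suc i
    coloured {u} p = trans (β≡ u) (cong colour p)
    refute : Fools x s (decode k) → ⊥
    refute (c , op , unsat) with open-elim c op
    ... | a , b , refl , sa , sb , a<b with nonzero a sa | nonzero b sb
    ... | i , refl | j , refl with joined i j (λ { refl → <-irrefl refl (<ᵇ-elim {toℕ a} a<b) })
    ... | u , v , pu , pv , e = contra (<-cmp (toℕ u) (toℕ v))
      where
      clause-ab : ∀ a b → (a <ˢ b) ≡ true → clause a b ≡ suc (combine a b)
      clause-ab a b lt rewrite lt = refl
      clause-ba : ∀ a b → (a <ˢ b) ≡ true → clause b a ≡ suc (combine a b)
      clause-ba a b lt with b <ˢ a in e
      ... | false = refl
      ... | true = contradiction (<ᵇ-elim {toℕ b} e) (<-asym (<ᵇ-elim {toℕ a} lt))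
      ordered : ∀ u v → toℕ u < toℕ v → label (combine u v) ≡ clause (decode k u) (decode k v)
      ordered u v lt = trans (label-combine u v) (cong (λ z → if z then clause (decode k u) (decode k v) else zero) (<ᵇ-intro lt))
      bit : ∀ u v → toℕ u < toℕ v → adj (coin N x s) u v ≡ true → x (combine u v) ≡ s
      bit u v lt e = ⌊⌋-elim (x (combine u v) ≟ᵇ s) (trans (≡sym (coin-up x s u v lt)) e)
      contra : _ → ⊥
      contra (tri< lt _ _) = unsat (combine u v) (trans (ordered u v lt) (trans (cong₂ clause (coloured pu) (coloured pv)) (clause-ab (suc i) (suc j) a<b))) (bit u v lt e)
      contra (tri≈ _ eq _) = adj-irr (coin N x s) {u} (subst (λ w → adj (coin N x s) u w ≡ true) (≡sym (toℕ-injective eq)) e)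
      contra (tri> _ _ gt) = unsat (combine v u) (trans (ordered v u gt) (trans (cong₂ clause (coloured pv) (coloured pu)) (clause-ba (suc i) (suc j) a<b))) (bit v u gt (adj-sym (coin N x s) {u} {v} e))

  -- With at least `q B` open clauses, all of them hold with probability at most `2 ^ (- B)`, and
  -- fewer than `2 ^ B` pairs of a sign and a colouring compete. Both signs are treated at once so
  -- that the denser of a graph and its complement can be taken.
  fooling : ∀ q B → 1 ≤ q → 1 ≤ r → N ≤ r * t → 3 ≤ t → 2 ^ (8 * (r * r)) ≤ suc q → 16 * (q * B) ≤ t * t → 2 * suc t ^ N < 2 ^ B →
    Σ (Fin (N * N) → Bool) λ x → ∀ s → ¬ KtMinorWithin t N (coin N x s)
  fooling q B 1≤q 1≤r N≤ 3≤t Q-large B-small F-small = proj₁ found , λ s → fooled⇒no-minor (proj₁ found) s (fools s)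
    where
    open ≤-Reasoning
    F = suc t ^ N
    M = N * N
    module Col (k : Fin F) = Colouring r t N (decode k)
    dec : Fin (2 * F) → Fin 2 × Fin F
    dec = remQuot {2} F
    lab : Fin (2 * F) → Fin M → Fin (suc (suc t * suc t))
    lab f = Col.label (proj₂ (dec f))
    e : Fin (2 * F) → Fin (suc (suc t * suc t)) → Bool
    e f = Col.open′ (proj₂ (dec f))
    powers : ∀ m → q * B ≤ m → 2 ^ B * q ^ m ≤ suc q ^ m
    powers m le = begin
      2 ^ B * q ^ m ≡⟨ cong (λ k → 2 ^ B * q ^ k) (m+[n∸m]≡n le) ⟨
      2 ^ B * q ^ (q * B + (m ∸ q * B)) ≡⟨ cong (2 ^ B *_) (^-distribˡ-+-* q (q * B) (m ∸ q * B)) ⟩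
      2 ^ B * (q ^ (q * B) * q ^ (m ∸ q * B)) ≡⟨ *-assoc (2 ^ B) _ _ ⟨
      2 ^ B * q ^ (q * B) * q ^ (m ∸ q * B) ≤⟨ *-mono-≤ (pow-doubling q B 1≤q) (^-monoˡ-≤ (m ∸ q * B) (n≤1+n q)) ⟩
      suc q ^ (q * B) * suc q ^ (m ∸ q * B) ≡⟨ ^-distribˡ-+-* (suc q) (q * B) (m ∸ q * B) ⟨
      suc q ^ (q * B + (m ∸ q * B)) ≡⟨ cong (suc q ^_) (m+[n∸m]≡n le) ⟩
      suc q ^ m ∎
    each : ∀ f → 2 ^ B * potential (lab f) (e f) ≤ 2 ^ M
    each f = *-cancelˡ-≤ (suc q ^ m) {{>-nonZero (m^n>0 (suc q) m)}} (begin
      suc q ^ m * (2 ^ B * pot) ≡⟨ x∙yz≈y∙xz (suc q ^ m) (2 ^ B) pot ⟩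
      2 ^ B * (suc q ^ m * pot) ≤⟨ *-monoʳ-≤ (2 ^ B) (potential-bound (lab f) (e f) q (λ c p → ≤-trans (^-monoʳ-≤ 2 (Col.block≤ (proj₂ (dec f)) c p)) Q-large)) ⟩
      2 ^ B * (q ^ m * 2 ^ M) ≡⟨ *-assoc (2 ^ B) _ _ ⟨
      2 ^ B * q ^ m * 2 ^ M ≤⟨ *-monoˡ-≤ (2 ^ M) (powers m (*-cancelˡ-≤ 16 (≤-trans B-small (Col.many-open-clauses (proj₂ (dec f)) 1≤r N≤ 3≤t)))) ⟩
      suc q ^ m * 2 ^ M ∎)
      where
      m = ∣ e f ∣
      pot = potential (lab f) (e f)
    total : sum (λ f → potential (lab f) (e f)) < 2 ^ M
    total = *-cancelˡ-< (2 ^ B) _ _ (begin-strict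
      2 ^ B * sum (λ f → potential (lab f) (e f)) ≡⟨ *-distribˡ-sum (2 ^ B) (λ f → potential (lab f) (e f)) ⟩
      sum (λ f → 2 ^ B * potential (lab f) (e f)) ≤⟨ sum-mono _ (λ _ → 2 ^ M) each ⟩
      sum {2 * F} (λ _ → 2 ^ M) ≡⟨ sum-const (2 * F) (2 ^ M) ⟩
      2 * F * 2 ^ M <⟨ *-monoˡ-< (2 ^ M) {{>-nonZero (m^n>0 2 M)}} F-small ⟩
      2 ^ B * 2 ^ M ∎)
    found : Σ (Fin M → Bool) λ x → ∀ f → ∃[ c ] e f c ≡ true × (∀ v → lab f v ≡ c → x v ≢ sign (proj₁ (dec f)))
    found = derandomize M lab (λ f → sign (proj₁ (dec f))) e total
    index : Bool → Fin 2
    index true = zero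
    index false = suc zero
    sign-index : ∀ s → sign (index s) ≡ s
    sign-index true = refl
    sign-index false = refl
    fools : ∀ s k → Fools (proj₁ found) s (decode k)
    fools s k = subst (λ s → Fools (proj₁ found) s (decode k)) (sign-index s)
      (subst (λ p → Fools (proj₁ found) (sign (proj₁ p)) (decode (proj₂ p))) (remQuot-combine {2} {F} (index s) k) (proj₂ found (combine (index s) k)))

suc≤2^ : ∀ a → suc a ≤ 2 ^ a
suc≤2^ zero = s≤s z≤n
suc≤2^ (suc a) = begin
  suc (suc a) ≤⟨ s≤s (suc≤2^ a) ⟩
  suc (2 ^ a) ≤⟨ +-monoˡ-≤ (2 ^ a) (m^n>0 2 a) ⟩
  2 ^ a + 2 ^ a ≡⟨ cong (2 ^ a +_) (+-identityʳ (2 ^ a)) ⟨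
  2 * 2 ^ a ∎
  where open ≤-Reasoning

-- The induction starts from `(a + 1) ^ 3 ≤ 2 ^ (3 a)`. It makes `t` outgrow the factor `log t`
-- coming from the number of colourings.
linear≤2^ : ∀ a j → a * suc (3 * a + j) ≤ 2 ^ (3 * a + j)
linear≤2^ a zero = begin
  a * suc (3 * a + 0) ≤⟨ m≤m+n _ (a * a * a + 2 * a + 1) ⟩
  a * suc (3 * a + 0) + (a * a * a + 2 * a + 1) ≡⟨ eq a ⟩
  suc a * (suc a * suc a) ≤⟨ *-mono-≤ (suc≤2^ a) (*-mono-≤ (suc≤2^ a) (suc≤2^ a)) ⟩
  2 ^ a * (2 ^ a * 2 ^ a) ≡⟨ cong (2 ^ a *_) (^-distribˡ-+-* 2 a a) ⟨
  2 ^ a * 2 ^ (a + a) ≡⟨ ^-distribˡ-+-* 2 a (a + a) ⟨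
  2 ^ (a + (a + a)) ≡⟨ cong (2 ^_) (eq₂ a) ⟩
  2 ^ (3 * a + 0) ∎
  where
  open ≤-Reasoning
  eq : ∀ a → a * suc (3 * a + 0) + (a * a * a + 2 * a + 1) ≡ suc a * (suc a * suc a)
  eq = solve-∀
  eq₂ : ∀ a → a + (a + a) ≡ 3 * a + 0
  eq₂ = solve-∀
linear≤2^ a (suc j) = begin
  a * suc (3 * a + suc j) ≡⟨ eq a j ⟩
  a + a * suc (3 * a + j) ≤⟨ +-mono-≤ (≤-trans (m≤m*n a (suc (3 * a + j))) (linear≤2^ a j)) (linear≤2^ a j) ⟩
  2 ^ (3 * a + j) + 2 ^ (3 * a + j) ≡⟨ cong (2 ^ (3 * a + j) +_) (+-identityʳ _) ⟨
  2 * 2 ^ (3 * a + j) ≡⟨ cong (2 ^_) (+-suc (3 * a) j) ⟨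
  2 ^ (3 * a + suc j) ∎
  where
  open ≤-Reasoning
  eq : ∀ a j → a * suc (3 * a + suc j) ≡ a + a * suc (3 * a + j)
  eq = solve-∀

not-forced : ∀ K → ∃[ t₀ ] (∀ t → t₀ ≤ t → ¬ ForcesMinor t (ℕ→ℚ (K * t)))
not-forced K = 3 + 2 ^ (3 * a) , λ t le forced → let x , none = graph t le in
    let s = dense-sign t le x ; H = coin (N t le) x s in
    contradiction (forced (N t le) H (avgDeg-intro H (1≤N t le) (K * t) (dense t le x))) (none s)
  where
  r q a : ℕ
  -- The denser of the two graphs has average degree at least `(N - 1) / 2`, and `N = (2 K + 1) t`
  -- lifts this to `K t`.
  r = suc (2 * K)
  q = 2 ^ (8 * (r * r))
  a = 16 * (q * (2 + r))
  module _ (t : ℕ) (le : 3 + 2 ^ (3 * a) ≤ t) where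
    open ≤-Reasoning
    N : ℕ
    N = r * t
    3≤t : 3 ≤ t
    3≤t = ≤-trans (m≤m+n 3 _) le
    1≤t : 1 ≤ t
    1≤t = ≤-trans (s≤s z≤n) 3≤t
    1≤N : 1 ≤ N
    1≤N = *-mono-≤ {1} {r} {1} {t} (s≤s z≤n) 1≤t
    graph : Σ (Fin (N * N) → Bool) λ x → ∀ s → ¬ KtMinorWithin t N (coin N x s)
    graph = let L , 2^L≤t , t<2^ = log₂ t 1≤t in graphFor L 2^L≤t t<2^
      where
      graphFor : ∀ L → 2 ^ L ≤ t → t < 2 ^ suc L → Σ (Fin (N * N) → Bool) λ x → ∀ s → ¬ KtMinorWithin t N (coin N x s)
      graphFor L 2^L≤t t<2^ = fooling r t N q B (m^n>0 2 (8 * (r * r))) (s≤s z≤n) ≤-refl 3≤t (n≤1+n q) B-small F-small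
        where
        -- There are at most `2 ^ ((L + 1) N)` colourings; the 2 accounts for the two signs and for
        -- strictness.
        B = 2 + suc L * N
        L-large : 3 * a ≤ L
        L-large = ≮⇒≥ λ lt → contradiction (begin-strict
          t <⟨ t<2^ ⟩
          2 ^ suc L ≤⟨ ^-monoʳ-≤ 2 lt ⟩
          2 ^ (3 * a) ≤⟨ m≤n+m _ 3 ⟩
          3 + 2 ^ (3 * a) ≤⟨ le ⟩
          t ∎) (<-irrefl refl)
        a-small : a * suc L ≤ t
        a-small = ≤-trans (subst (λ L → a * suc L ≤ 2 ^ L) (m+[n∸m]≡n L-large) (linear≤2^ a (L ∸ 3 * a))) 2^L≤t
        B-small : 16 * (q * B) ≤ t * t
        B-small = begin
          16 * (q * (2 + suc L * (r * t))) ≤⟨ *-monoʳ-≤ 16 (*-monoʳ-≤ q (+-monoˡ-≤ (suc L * (r * t)) (*-monoʳ-≤ 2 (*-mono-≤ {1} {suc L} {1} {t} (s≤s z≤n) 1≤t)))) ⟩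
          16 * (q * (2 * (suc L * t) + suc L * (r * t))) ≡⟨ eq q L t r ⟩
          16 * (q * (2 + r)) * suc L * t ≤⟨ *-monoˡ-≤ t a-small ⟩
          t * t ∎
          where
          eq : ∀ q L t r → 16 * (q * (2 * (suc L * t) + suc L * (r * t))) ≡ 16 * (q * (2 + r)) * suc L * t
          eq = solve-∀
        F-small : 2 * suc t ^ N < 2 ^ B
        F-small = begin-strict
          2 * suc t ^ N ≤⟨ *-monoʳ-≤ 2 (^-monoˡ-≤ N t<2^) ⟩
          2 * (2 ^ suc L) ^ N ≡⟨ cong (2 *_) (^-*-assoc 2 (suc L) N) ⟩
          2 ^ suc (suc L * N) <⟨ ^-monoʳ-< 2 (s≤s (s≤s z≤n)) (n<1+n (suc (suc L * N))) ⟩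
          2 ^ B ∎
    module _ (x : Fin (N * N) → Bool) where
      dense-sign : Bool
      dense-sign = ⌊ K * t * N ≤? coinSize N x true ⌋
      dense : K * t * N ≤ coinSize N x dense-sign
      dense with K * t * N ≤? coinSize N x true
      ... | yes p = p
      ... | no p = +-cancelˡ-≤ (coinSize N x true) _ _ (+-cancelʳ-≤ N _ _ (begin
        coinSize N x true + K * t * N + N ≤⟨ +-monoˡ-≤ N (+-monoˡ-≤ (K * t * N) (<⇒≤ (≰⇒> p))) ⟩
        K * t * N + K * t * N + N ≡⟨ eq K t N ⟩
        (2 * (K * t) + 1) * N ≤⟨ *-monoˡ-≤ N (≤-trans (+-monoʳ-≤ (2 * (K * t)) 1≤t) (≤-reflexive (eq₂ K t))) ⟩
        N * N ≤⟨ coin-dense N x ⟩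
        coinSize N x true + (coinSize N x false + N) ≡⟨ +-assoc (coinSize N x true) _ N ⟨
        coinSize N x true + coinSize N x false + N ∎))
        where
        eq : ∀ K t N → K * t * N + K * t * N + N ≡ (2 * (K * t) + 1) * N
        eq = solve-∀
        eq₂ : ∀ K t → 2 * (K * t) + t ≡ suc (2 * K) * t
        eq₂ = solve-∀

-- Minors of induced subgraphs

module _ (G : Graph n) (A : VSet n) where

  open Enum (enum A)

  induced : Graph ∣ A ∣
  induced = record { adj = λ i j → adj G (elt i) (elt j) ; sym = λ i j → sym G (elt i) (elt j) ; irref = λ i → irref G (elt i) }

  induced-edges : E induced full ≡ E G A
  induced-edges = begin
    sum (λ i → sum (λ j → b2n (adj G (elt i) (elt j)))) ≡⟨ sum-cong-≗ (λ i → sum-elt (λ v → b2n (adj G (elt i) v))) ⟨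
    sum (λ i → row (elt i)) ≡⟨ sum-elt row ⟨
    sum (λ u → if A u then row u else 0) ≡⟨ sum-cong-≗ (λ u → outer u (A u)) ⟩
    sum (λ u → sum (λ v → b2n (A u ∧ (A v ∧ adj G u v)))) ∎
    where
    open ≡-Reasoning
    row : Fin n → ℕ
    row u = sum (λ v → if A v then b2n (adj G u v) else 0)
    inner : ∀ a b → (if a then b2n b else 0) ≡ b2n (a ∧ b)
    inner true b = refl
    inner false b = refl
    outer : ∀ u a → (if a then row u else 0) ≡ sum (λ v → b2n (a ∧ (A v ∧ adj G u v)))
    outer u true = sum-cong-≗ (λ v → inner (A v) (adj G u v))
    outer u false = ≡sym (sum-zero {n} (λ v → b2n (false ∧ (A v ∧ adj G u v))) (λ _ → refl))

  induced-minor : ∀ {t m} → KtMinorWithin t m induced → KtMinorWithin t ∣ A ∣ G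
  induced-minor {t} (β , nonempty , connected , joined , _) = β′ ,
    (λ i → let x , p = nonempty i in elt x , trans (β′-elt x) p) ,
    (λ i u v p q → let x , xu , bx = β′-elim u i p ; y , yv , by = β′-elim v i q in subst₂ (ReachIn G (λ w → β′ w ≡ just i)) xu yv (reach (connected i x y bx by))) ,
    (λ i j ne → let x , y , p , q , e = joined i j ne in elt x , elt y , trans (β′-elt x) p , trans (β′-elt y) q , e) ,
    ≤-trans (≤-reflexive (lsum-allFin (λ v → b2n (is-just (β′ v))))) (∣∣-mono (λ v → is-just (β′ v)) A used)
    where
    find : (v : Fin n) → Dec (∃[ i ] elt i ≡ v)
    find v = any? (λ i → elt i ≟ v)
    via : ∀ {v} → Dec (∃[ i ] elt i ≡ v) → Maybe (Fin t)
    via (yes (i , _)) = β i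
    via (no _) = nothing
    β′ : Fin n → Maybe (Fin t)
    β′ v = via (find v)
    β′-elt : ∀ x → β′ (elt x) ≡ β x
    β′-elt x with find (elt x)
    ... | yes (y , p) = cong β (elt-inj y x p)
    ... | no none = contradiction (x , refl) none
    β′-elim : ∀ v i → β′ v ≡ just i → ∃[ x ] elt x ≡ v × β x ≡ just i
    β′-elim v i p with find v
    ... | yes (x , q) = x , q , p
    used : ∀ v → is-just (β′ v) ≡ true → v ∈ A
    used v p with find v
    ... | yes (x , q) = subst (_∈ A) q (elt∈ x)
    reach : ∀ {i x y} → ReachIn induced (λ w → β w ≡ just i) x y → ReachIn G (λ w → β′ w ≡ just i) (elt x) (elt y)
    reach here = here
    reach (step {w = w} e p r) = step e (trans (β′-elt w) p) (reach r)

minor-≤ : ∀ {t m m′} (G : Graph n) → m ≤ m′ → KtMinorWithin t m G → KtMinorWithin t m′ G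
minor-≤ G le (β , a , b , c , size) = β , a , b , c , ≤-trans size le

-- The two applications of the degree hypothesis

module _ (k t′ : ℕ) (1≤k : 1 ≤ k) where

  private
    t C : ℕ
    t = 2 + t′
    C = localSize k t + sizeConstant k t

  minor-or-subdivision : (G : Graph n) → 1 ≤ n → ¬ ForcesMinor t (ℕ→ℚ (rounding k * t)) →
    (∀ a → k * E G full < suc k * a * n → ForcesMinor t (ℕ→ℚ a)) →
    KtMinorWithin t C G ⊎ ShortSubdivision t C G
  minor-or-subdivision {n} G 1≤n unforced forced = conclude (dense-part-or-subdivision k t′ 1≤k G 1≤n D D-large (m/n*n≤m (E G full) n))
    where
    open ≤-Reasoning
    instance
      nz-n : NonZero n
      nz-n = >-nonZero 1≤n
      nz-k : NonZero k
      nz-k = >-nonZero 1≤k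
    D = E G full / n
    E< : E G full < suc D * n
    E< = begin-strict
      E G full ≡⟨ m≡m%n+[m/n]*n (E G full) n ⟩
      E G full % n + D * n <⟨ +-monoˡ-< (D * n) (m%n<n (E G full) n) ⟩
      n + D * n ∎
    -- A smaller average degree would make `rounding k * t` force the minor, against the random
    -- graph.
    E-large : rounding k * t * n ≤ E G full
    E-large = ≮⇒≥ λ lt → unforced (forced (rounding k * t) (begin-strict
      k * E G full <⟨ *-monoʳ-< k lt ⟩
      k * (rounding k * t * n) ≤⟨ *-monoˡ-≤ (rounding k * t * n) (n≤1+n k) ⟩
      suc k * (rounding k * t * n) ≡⟨ *-assoc (suc k) (rounding k * t) n ⟨
      suc k * (rounding k * t) * n ∎))
    D-large : rounding k * t ≤ D
    D-large = s≤s⁻¹ (*-cancelʳ-< _ _ _ (≤-<-trans E-large E<))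
    conclude : ∃[ D′ ] k * suc D ≤ suc k * D′ × ((∃[ A ] ∣ A ∣ ≤ localSize k t × Dense G 1 D′ A) ⊎
        ShortSubdivision t (sizeConstant k t) G) →
      KtMinorWithin t C G ⊎ ShortSubdivision t C G
    conclude (D′ , rounded , inj₂ (s , sub , le)) = inj₂ (s , sub , ≤-trans le (^-monoʳ-≤ n (m≤n+m (sizeConstant k t) (localSize k t))))
    conclude (D′ , rounded , inj₁ (A , small , o , d)) = inj₁ (minor-≤ G (≤-trans small (m≤m+n (localSize k t) (sizeConstant k t)))
      (induced-minor G A (forced D′ high ∣ A ∣ (induced G A) (avgDeg-intro (induced G A) o D′
        (≤-trans d (≤-reflexive (trans (*-identityˡ (E G A)) (≡sym (induced-edges G A)))))))))
      where
      -- The average degree is below `D + 1`, hence below `(1 + 1 / k) D′`; so `D′` forces the minor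
      -- in the induced subgraph on `A`.
      high : k * E G full < suc k * D′ * n
      high = begin-strict
        k * E G full <⟨ *-monoʳ-< k E< ⟩
        k * (suc D * n) ≡⟨ *-assoc k (suc D) n ⟨
        k * suc D * n ≤⟨ *-monoˡ-≤ n rounded ⟩
        suc k * D′ * n ∎

theorem1p3 : ∀ (ε : ℚ) → 0ℚ ℚ.< ε →
    ∃[ t₀ ] ∀ (t : ℕ) → t₀ ≤ t → ∃[ C ] ∀ (n : ℕ) (G : Graph n) →
    1 ≤ n → DegHyp ε t G →
    KtMinorWithin t C G ⊎ (∃[ s ] (KtSubdivOfSize t s G × 2 ^ s ≤ n ^ C))
theorem1p3 ε pos = let k , 1≤k , bound = inverse-bound ε pos ; t₀ , unforced = not-forced (rounding k) in
  2 + t₀ , λ t le → at k 1≤k bound (unforced t (≤-trans (m≤n+m t₀ 2) le)) (≤-trans (m≤m+n 2 t₀) le)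
  where
  at : ∀ k → 1 ≤ k → ScaledBound ε k →
    ∀ {t} → ¬ ForcesMinor t (ℕ→ℚ (rounding k * t)) → 2 ≤ t → ∃[ C ] ∀ (n : ℕ) (G : Graph n) →
    1 ≤ n → DegHyp ε t G → KtMinorWithin t C G ⊎ ShortSubdivision t C G
  at k 1≤k bound {suc (suc t′)} unforced _ = _ , λ n G 1≤n hyp → minor-or-subdivision k t′ 1≤k G 1≤n unforced
    λ a lt → hyp (ℕ→ℚ a) (bound a (2 * edges G) n (≤-trans (≤-reflexive (cong (λ e → suc (k * e)) (handshake G))) lt))
  at k 1≤k bound {suc zero} unforced (s≤s ())
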